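{- Let $G$ be a circular interval graph satisfying $\chi_l(G) \geq \Delta(G) \geq 9$. Then $G$ contains a complete subgraph $K_{\Delta(G)}$ on $\Delta(G)$ vertices.
   Context: Graphs are finite and simple. $\Delta(G)$ is the maximum degree and $\chi_l(G)$ the list chromatic number (choice number) of $G$. Given a (finite) set $V$ of points on the unit circle together with a set $C$ of closed intervals on the unit circle, define a graph with vertex set $V$ in which two different vertices are adjacent if and only if they are both contained in some element of $C$. Any graph isomorphic to such a graph is a circular interval graph. -}

module Defs where

open import Data.Fin using (Fin)
open import Data.Integer using (+<+; -<+)
open import Data.List using (List; allFin; filter; length; map)
open import Data.List.Extrema.Nat using (max)
open import Data.List.Membership.Propositional using () renaming (_∈_ to _∈ₗ_)
open import Data.List.Relation.Unary.Unique.Propositional using (Unique)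
open import Data.Nat using (ℕ; s≤s; z≤n) renaming (_≤_ to _≤ₙ_)
open import Data.Product using (Σ-syntax; ∃-syntax; _×_; _,_)
open import Data.Rational using (ℚ; 0ℚ; 1ℚ; -_; *<*) renaming (_<_ to _<ℚ_; _+_ to _+ℚ_)
open import Data.Rational.Properties using (<-asym; <-cmp; <-dense; <-trans; +-identityʳ; +-monoʳ-<)
open import Data.Sum using (_⊎_; inj₁; inj₂)
open import Function.Bundles using (_⇔_; mk⇔; _↣_; Injection)
open import Level using (0ℓ) renaming (suc to lsuc)
open import Relation.Binary.Core using (Rel)
open import Relation.Binary.Definitions using (Decidable; Irreflexive; Symmetric; tri<; tri≈; tri>)
open import Relation.Binary.PropositionalEquality using (_≡_; _≢_; refl; subst)
open import Relation.Nullary using (¬_)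
open import Relation.Unary using (Pred; _∈_)

------------------------------------------------------------------------
-- Finite simple graphs

record Graph (n : ℕ) : Set₁ where
  field
    Adj    : Rel (Fin n) 0ℓ
    adj?   : Decidable Adj
    sym    : Symmetric Adj
    irrefl : Irreflexive _≡_ Adj

  degree : Fin n → ℕ
  degree v = length (filter (adj? v) (allFin n))

  -- Maximum degree; the leading 0 only matters for the graph without vertices.
  Δ : ℕ
  Δ = max 0 (map degree (allFin n))

open Graph public using (Δ)

ContainsComplete : ∀ {n} → Graph n → ℕ → Set
ContainsComplete {n} G m =
  Σ[ f ∈ Fin m ↣ Fin n ]
    (∀ i j → i ≢ j → Graph.Adj G (Injection.to f i) (Injection.to f j))

------------------------------------------------------------------------
-- List colouring

-- Finite sets of colours are duplicate-free lists.  Taking the colours from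
-- ℕ is no restriction, since only finitely many colours occur in the lists
-- of a finite graph.
Choosable : ∀ {n} → Graph n → ℕ → Set
Choosable {n} G k =
  (L : Fin n → List ℕ) →
  (∀ v → Unique (L v)) →
  (∀ v → k ≤ₙ length (L v)) →
  Σ[ c ∈ (Fin n → ℕ) ] (∀ v → c v ∈ₗ L v) × (∀ u v → Graph.Adj G u v → c u ≢ c v)

IsListChromaticNumber : ∀ {n} → Graph n → ℕ → Set
IsListChromaticNumber G k = Choosable G k × (∀ j → Choosable G j → k ≤ₙ j)

------------------------------------------------------------------------
-- Real numbers, as two-sided Dedekind cuts of ℚ

record ℝ : Set₁ where
  field
    L U         : Pred ℚ 0ℓ
    L-inhabited : ∃[ q ] q ∈ L
    U-inhabited : ∃[ q ] q ∈ U
    L-rounded   : ∀ q → q ∈ L ⇔ (∃[ r ] q <ℚ r × r ∈ L)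
    U-rounded   : ∀ r → r ∈ U ⇔ (∃[ q ] q <ℚ r × q ∈ U)
    disjoint    : ∀ q → ¬ (q ∈ L × q ∈ U)
    located     : ∀ q r → q <ℚ r → q ∈ L ⊎ r ∈ U

infix 4 _≤_ _<_ _≈_

_≤_ : ℝ → ℝ → Set
x ≤ y = ∀ q → q ∈ ℝ.L x → q ∈ ℝ.L y

_<_ : ℝ → ℝ → Set
x < y = ∃[ q ] q ∈ ℝ.U x × q ∈ ℝ.L y

_≈_ : ℝ → ℝ → Set
x ≈ y = x ≤ y × y ≤ x

fromℚ : ℚ → ℝ
fromℚ p = record
  { L           = λ q → q <ℚ p
  ; U           = λ q → p <ℚ q
  ; L-inhabited = p +ℚ (- 1ℚ) , shift (*<* -<+)
  ; U-inhabited = p +ℚ 1ℚ , shift′ (*<* (+<+ (s≤s z≤n)))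
  ; L-rounded   = λ _ → mk⇔ (λ q<p → let m , q<m , m<p = <-dense q<p in m , q<m , m<p)
                            (λ (_ , q<r , r<p) → <-trans q<r r<p)
  ; U-rounded   = λ _ → mk⇔ (λ p<r → let m , p<m , m<r = <-dense p<r in m , m<r , p<m)
                            (λ (_ , q<r , p<q) → <-trans p<q q<r)
  ; disjoint    = λ _ (q<p , p<q) → <-asym q<p p<q
  ; located     = located
  }
  where
  shift : ∀ {d} → d <ℚ 0ℚ → p +ℚ d <ℚ p
  shift {d} d<0 = subst (p +ℚ d <ℚ_) (+-identityʳ p) (+-monoʳ-< p d<0)

  shift′ : ∀ {d} → 0ℚ <ℚ d → p <ℚ p +ℚ d
  shift′ {d} 0<d = subst (_<ℚ p +ℚ d) (+-identityʳ p) (+-monoʳ-< p 0<d)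

  located : ∀ q r → q <ℚ r → q <ℚ p ⊎ p <ℚ r
  located q r q<r with <-cmp q p
  ... | tri< q<p _ _    = inj₁ q<p
  ... | tri≈ _ refl _   = inj₂ q<r
  ... | tri> _ _ p<q    = inj₂ (<-trans p<q q<r)

------------------------------------------------------------------------
-- The unit circle and its closed intervals

-- The point (cos 2πt , sin 2πt) is given by its angle t ∈ [0,1), measured in
-- full turns.
record Circle : Set₁ where
  field
    angle   : ℝ
    0≤angle : fromℚ 0ℚ ≤ angle
    angle<1 : angle < fromℚ 1ℚ

open Circle public using (angle)

-- The closed interval swept out counterclockwise from `start` to `end`.
record Arc : Set₁ where
  field
    start end : Circle

infix 4 _∈ᴬ_

-- The second case is that of an interval passing through the angle 0.
data _∈ᴬ_ (x : Circle) (I : Arc) : Set where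
  plain : angle (Arc.start I) ≤ angle x → angle x ≤ angle (Arc.end I) → x ∈ᴬ I
  wrap  : angle (Arc.end I) < angle (Arc.start I) →
          angle (Arc.start I) ≤ angle x ⊎ angle x ≤ angle (Arc.end I) → x ∈ᴬ I

-- `point` is an isomorphism from G onto the graph with vertex set
-- V = { point v }, an n-element set of points, determined by the set C.
record CircularInterval {n : ℕ} (G : Graph n) : Set₂ where
  field
    point     : Fin n → Circle
    injective : ∀ u v → angle (point u) ≈ angle (point v) → u ≡ v
    C         : Pred Arc (lsuc 0ℓ)
    adjacency : ∀ u v → Graph.Adj G u v ⇔
                  (u ≢ v × ∃[ I ] I ∈ C × point u ∈ᴬ I × point v ∈ᴬ I)

{-# OPTIONS --safe #-}

-- Put k = Δ − 1 and suppose that no k + 1 vertices form a clique; we colour from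
-- lists of k colours.  By induction proper induced subgraphs can be coloured, so
-- all degrees are k or k + 1.  Number the vertices clockwise; adjacent vertices
-- bound a clique on one of their two sides.
--
-- If k or k − 1 consecutive vertices form a clique K, colour everything outside
-- a set H consisting of K and one or two vertices next to K.  A vertex with d
-- neighbours in H keeps at least d − 1 colours.  Nonadjacent pairs whose lists
-- meet get a common colour, and once no such pair is left the rest of H has
-- distinct representatives by Hall's theorem: two disjoint lists are together
-- as large as H.
--
-- Otherwise all cliques of consecutive vertices have at most k − 2 vertices, and
-- two consecutive vertices u, u′ can be coloured last, as in Brooks' theorem:
-- two nonadjacent pairs of neighbours of u are coloured first, so that they
-- block only two colours at u, and then the vertices not adjacent to u are
-- coloured clockwise.  Each of them sees at most k − 3 colours behind it and at
-- most two ahead.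
--
-- The order of the angles is decidable only up to double negation.  This is
-- enough, as it is decidable whether a clique of given size exists.
module Submission where

open import Defs using (Graph; Δ; CircularInterval; IsListChromaticNumber; ContainsComplete)
open import Defs using (Choosable; ℝ; angle; Arc; _∈ᴬ_; plain; wrap) renaming (_≤_ to _≤ᴿ_; _<_ to _<ᴿ_)
open import Data.Empty using (⊥; ⊥-elim)
open import Data.Fin using (Fin)
import Data.Fin as Fin
import Data.Fin.Properties as Fin
open import Data.List using (List; []; _∷_; _++_; allFin; filter; length; lookup; map; take)
open import Data.List.Extrema.Nat using (xs≤max)
open import Data.List.Membership.Propositional using (_∈_; _∉_; find; lose)
open import Data.List.Membership.Propositional.Properties
  using (∈-∃++; ∈-++⁺ˡ; ∈-++⁺ʳ; ∈-++⁻; ∈-allFin; ∈-filter⁺; ∈-filter⁻; ∈-lookup; ∈-map⁺; ∈-map⁻)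
open import Data.List.Properties using (length-++; length-map; length-take)
open import Data.List.Relation.Binary.Permutation.Propositional
  using (_↭_; ↭-refl; ↭-sym; ↭⇒↭ₛ; module PermutationReasoning)
import Data.List.Relation.Binary.Permutation.Propositional.Properties as Perm
import Data.List.Relation.Binary.Permutation.Setoid.Properties as PermSetoid
open import Data.List.Relation.Binary.Subset.Propositional using (_⊆_)
open import Data.List.Relation.Unary.All using (All; []; _∷_)
import Data.List.Relation.Unary.All as All
import Data.List.Relation.Unary.All.Properties as All
open import Data.List.Relation.Unary.AllPairs using (AllPairs; []; _∷_; allPairs?)
import Data.List.Relation.Unary.AllPairs.Properties as AllPairs
open import Data.List.Relation.Unary.Any using (here; there; any?)
open import Data.List.Relation.Unary.Sorted.TotalOrder.Properties using (Sorted⇒AllPairs)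
open import Data.List.Relation.Unary.Unique.Propositional using (Unique)
import Data.List.Relation.Unary.Unique.Propositional.Properties as Unique
import Data.List.Sort
import Data.Nat
open import Data.Nat hiding (_≟_; _≤?_; _%_; _/_)
open import Data.Nat.DivMod using (_%_; _/_; m%n<n; m<n⇒m%n≡m; m≡m%n+[m/n]*n; [m+kn]%n≡m%n)
open import Data.Nat.Properties hiding (_≟_; _≤?_; _<?_)
open import Data.Nat.Tactic.RingSolver using (solve-∀)
open import Data.Product using (∃; _×_; _,_; proj₁; proj₂)
import Data.Rational as ℚ
import Data.Rational.Properties as ℚ
open import Data.Sum using (_⊎_; inj₁; inj₂)
open import Function using (_∘_; id; case_of_; mk↣; Equivalence)
open import Relation.Binary.Bundles using (DecTotalOrder)
open import Relation.Binary.Definitions using (DecidableEquality; Tri; tri<; tri≈; tri>)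
open import Relation.Binary.PropositionalEquality
open import Relation.Nullary using (¬_; Dec; yes; no; ¬?; _→-dec_; contradiction)
open import Relation.Nullary.Decidable using (True; toWitness; ¬¬-excluded-middle)

-- A vertex may have k + 1 neighbours and only k colours, so greedy colouring falls short by two. A
-- colour is gained from each neighbour that is coloured later and from each nonadjacent pair of
-- neighbours that together block one colour only; both halves of the proof consist in securing two
-- such gains wherever they are needed.
--
-- The number 9 comes from the large cliques. A vertex next to K enters H with at least four
-- neighbours there, which leaves it the three colours that its pair requires. If the vertex before
-- K is adjacent to all but the last three vertices of K, and the vertex after K to all but the
-- first three, then each has four neighbours in K and some vertex of K is adjacent to both,
-- provided that K has at least seven vertices. As K has at least k - 1 vertices, this is k ≥ 8.
--
-- An edge determines a side of the circle only if no vertex is adjacent to all others. This holds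
-- from k + 3 vertices on; k + 1 and k + 2 vertices are coloured directly by means of one or two
-- nonadjacent pairs.

infixl 5 _⊕_
_⊕_ : ∀ {a b c d} → a ≤ b → c ≤ d → a + c ≤ b + d
_⊕_ = +-mono-≤

-- With a sum A ≤ B of known inequalities, a linear inequality becomes an
-- identity once the slack s is made explicit.
lin : ∀ {A B a b} → A ≤ B → (s : ℕ) → a + B + s ≡ b + A → a ≤ b
lin {A} {B} {a} {b} h s eq =
  +-cancelʳ-≤ B a b (≤-trans (m≤m+n (a + B) s) (≤-trans (≤-reflexive eq) (+-monoʳ-≤ b h)))

linᶜ : ∀ {w} {W : Set w} {A B} → A ≤ B → (s : ℕ) → A ≡ B + suc s → W
linᶜ {A = A} {B} h s eq =
  ⊥-elim (n≮n B (≤-trans (≤-trans (m≤m+n (suc B) s) (≤-reflexive (trans (sym (+-suc B s)) (sym eq)))) h))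

-- Counting in duplicate-free lists

unique-⊆-length : {A : Set} {xs ys : List A} → Unique xs → xs ⊆ ys → length xs ≤ length ys
unique-⊆-length []         sub = z≤n
unique-⊆-length {xs = x ∷ xs} (x∉ ∷ xs!) sub with ∈-∃++ (sub (here refl))
... | as , bs , refl = begin
  suc (length xs)              ≤⟨ s≤s (unique-⊆-length xs! xs⊆) ⟩
  suc (length (as ++ bs))      ≡⟨ cong suc (length-++ as) ⟩
  suc (length as + length bs)  ≡⟨ +-suc (length as) (length bs) ⟨
  length as + suc (length bs)  ≡⟨ length-++ as ⟨
  length (as ++ x ∷ bs)        ∎
  where
  open ≤-Reasoning
  xs⊆ : xs ⊆ as ++ bs
  xs⊆ y∈ with ∈-++⁻ as (sub (there y∈))
  ... | inj₁ y∈as          = ∈-++⁺ˡ y∈as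
  ... | inj₂ (here refl)   = contradiction refl (All.lookup x∉ y∈)
  ... | inj₂ (there y∈bs)  = ∈-++⁺ʳ as y∈bs

unique-++ : {A : Set} {xs ys : List A} → Unique xs → Unique ys → (∀ {x} → x ∈ xs → x ∉ ys) →
            Unique (xs ++ ys)
unique-++ xs! ys! dis = Unique.++⁺ xs! ys! (λ (p , q) → dis p q)

module Finite {A : Set} (_≟_ : DecidableEquality A) where

  open import Data.List.Membership.DecPropositional _≟_ public using (_∈?_)

  infixl 6 _∖_
  _∖_ : List A → List A → List A
  xs ∖ bad = filter (λ x → ¬? (x ∈? bad)) xs

  ∈-∖⁺ : ∀ {x xs bad} → x ∈ xs → x ∉ bad → x ∈ xs ∖ bad
  ∈-∖⁺ = ∈-filter⁺ _

  ∈-∖⁻ : ∀ {x} xs bad → x ∈ xs ∖ bad → x ∈ xs × x ∉ bad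
  ∈-∖⁻ xs bad = ∈-filter⁻ (λ x → ¬? (x ∈? bad))

  unique-∖ : ∀ {xs} bad → Unique xs → Unique (xs ∖ bad)
  unique-∖ bad = Unique.filter⁺ (λ x → ¬? (x ∈? bad))

  length-∖ : ∀ {xs} bad → Unique xs → length xs ≤ length (xs ∖ bad) + length bad
  length-∖ {xs} bad xs! = subst (length xs ≤_) (length-++ (xs ∖ bad)) (unique-⊆-length xs! sub)
    where
    sub : xs ⊆ (xs ∖ bad) ++ bad
    sub {x} x∈ with x ∈? bad
    ... | yes x∈bad = ∈-++⁺ʳ (xs ∖ bad) x∈bad
    ... | no  x∉bad = ∈-++⁺ˡ (∈-∖⁺ x∈ x∉bad)

  length-∖₁ : ∀ {xs} x → Unique xs → length xs ≤ suc (length (xs ∖ (x ∷ [])))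
  length-∖₁ {xs} x xs! = subst (length xs ≤_) (+-comm _ 1) (length-∖ (x ∷ []) xs!)

  ∃∉ : ∀ {xs} bad → Unique xs → length bad < length xs → ∃ λ x → x ∈ xs × x ∉ bad
  ∃∉ {xs} bad xs! lt with any? (λ x → ¬? (x ∈? bad)) xs
  ... | yes p = find p
  ... | no ¬p = contradiction (unique-⊆-length xs! sub) (<⇒≱ lt)
    where
    sub : xs ⊆ bad
    sub {x} x∈ with x ∈? bad
    ... | yes q = q
    ... | no ¬q = contradiction (lose x∈ ¬q) ¬p

-- Hall's theorem by alternating paths

module Maps {V : Set} (_≟_ : DecidableEquality V) where

  infix 8 _[_↦_]
  _[_↦_] : (V → ℕ) → V → ℕ → V → ℕ
  (φ [ u ↦ c ]) a with a ≟ u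
  ... | yes _ = c
  ... | no  _ = φ a

  update-≡ : ∀ φ {u} c → (φ [ u ↦ c ]) u ≡ c
  update-≡ φ {u} c with u ≟ u
  ... | yes _ = refl
  ... | no ¬p = contradiction refl ¬p

  update-≢ : ∀ φ {u a} c → a ≢ u → (φ [ u ↦ c ]) a ≡ φ a
  update-≢ φ {u} {a} c a≢u with a ≟ u
  ... | yes p = contradiction p a≢u
  ... | no  _ = refl

-- Hall's theorem: a system of distinct representatives, or a set S of vertices
-- whose lists lie in a set U smaller than S.  A new vertex v is matched by an
-- alternating search.
module Hall {V : Set} (_≟_ : DecidableEquality V) (L : V → List ℕ) where

  open Finite _≟_ using (_∈?_)
  open Finite Data.Nat._≟_ using () renaming (_∈?_ to _∈ℕ?_)
  open Maps _≟_

  SDR : List V → Set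
  SDR vs = ∃ λ (φ : V → ℕ) → (∀ {a} → a ∈ vs → φ a ∈ L a) ×
                             (∀ {a b} → a ∈ vs → b ∈ vs → φ a ≡ φ b → a ≡ b)

  Violator : List V → Set
  Violator vs = ∃ λ S → ∃ λ U → Unique S × S ⊆ vs × (∀ {a} → a ∈ S → L a ⊆ U) × length U < length S

  module Augment (v : V) (vs : List V) (v∉vs : v ∉ vs)
                 (φ : V → ℕ) (φ∈ : ∀ {a} → a ∈ vs → φ a ∈ L a) where

    -- The state reached by an alternating path from `v` to `u`: only `u` lacks a colour. No colour
    -- outside the image of `φ` is in use (`image`), so such a colour in the list of `u` ends the
    -- search; off `S` nothing has changed (`agree`), so the path can be continued through any
    -- vertex there.
    record Missing (u : V) (S : List V) : Set where
      field
        ψ      : V → ℕ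
        ψ∈     : ∀ {a} → a ∈ v ∷ vs → a ≢ u → ψ a ∈ L a
        inj    : ∀ {a b} → a ∈ v ∷ vs → b ∈ v ∷ vs → a ≢ u → b ≢ u → ψ a ≡ ψ b → a ≡ b
        image  : ∀ {a} → a ∈ v ∷ vs → a ≢ u → ψ a ∈ map φ vs
        agree  : ∀ {a} → a ∈ vs → a ∉ S → ψ a ≡ φ a

    open Missing

    weaken : ∀ {u S S′} → S ⊆ S′ → Missing u S → Missing u S′
    weaken S⊆ m = record
      { ψ = ψ m ; ψ∈ = ψ∈ m ; inj = inj m ; image = image m ; agree = λ a∈ a∉ → agree m a∈ (a∉ ∘ S⊆) }

    finish : ∀ {u c S} → u ∈ v ∷ vs → c ∈ L u → c ∉ map φ vs → Missing u S → SDR (v ∷ vs)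
    finish {u} {c} u∈ c∈ c∉ m = χ , χ∈ , χ-inj
      where
      χ = ψ m [ u ↦ c ]
      χ∈ : ∀ {a} → a ∈ v ∷ vs → χ a ∈ L a
      χ∈ {a} a∈ with a ≟ u
      ... | yes refl = c∈
      ... | no a≢u   = ψ∈ m a∈ a≢u
      χ-inj : ∀ {a b} → a ∈ v ∷ vs → b ∈ v ∷ vs → χ a ≡ χ b → a ≡ b
      χ-inj {a} {b} a∈ b∈ eq with a ≟ u | b ≟ u
      ... | yes refl | yes refl = refl
      ... | yes _    | no b≢u   = contradiction (subst (_∈ map φ vs) (sym eq) (image m b∈ b≢u)) c∉
      ... | no a≢u   | yes _    = contradiction (subst (_∈ map φ vs) eq (image m a∈ a≢u)) c∉
      ... | no a≢u   | no b≢u   = inj m a∈ b∈ a≢u b≢u eq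

    -- `u` takes over the colour of `w`, which is left out instead. Because `w ∉ S`, the vertex `w`
    -- still carries `φ w` under `ψ`, and by injectivity no other vertex does.
    shift : ∀ {u w S} → u ∈ S → w ∈ vs → w ∉ S → φ w ∈ L u → Missing u S → Missing w (w ∷ S)
    shift {u} {w} {S} u∈S w∈ w∉S c∈ m = record
      { ψ = χ ; ψ∈ = χ∈ ; inj = χ-inj ; image = χ-image
      ; agree = λ a∈ a∉ → trans (update-≢ (ψ m) (φ w) λ { refl → a∉ (there u∈S) }) (agree m a∈ (a∉ ∘ there)) }
      where
      χ = ψ m [ u ↦ φ w ]
      w≢u : w ≢ u
      w≢u refl = w∉S u∈S
      ψw : ψ m w ≡ φ w
      ψw = agree m w∈ w∉S
      χ∈ : ∀ {a} → a ∈ v ∷ vs → a ≢ w → χ a ∈ L a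
      χ∈ {a} a∈ a≢w with a ≟ u
      ... | yes refl = c∈
      ... | no a≢u   = ψ∈ m a∈ a≢u
      χ-inj : ∀ {a b} → a ∈ v ∷ vs → b ∈ v ∷ vs → a ≢ w → b ≢ w → χ a ≡ χ b → a ≡ b
      χ-inj {a} {b} a∈ b∈ a≢w b≢w eq with a ≟ u | b ≟ u
      ... | yes refl | yes refl = refl
      ... | yes _    | no b≢u   = contradiction (sym (inj m (there w∈) b∈ w≢u b≢u (trans ψw eq))) b≢w
      ... | no a≢u   | yes _    = contradiction (inj m a∈ (there w∈) a≢u w≢u (trans eq (sym ψw))) a≢w
      ... | no a≢u   | no b≢u   = inj m a∈ b∈ a≢u b≢u eq
      χ-image : ∀ {a} → a ∈ v ∷ vs → a ≢ w → χ a ∈ map φ vs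
      χ-image {a} a∈ a≢w with a ≟ u
      ... | yes refl = ∈-map⁺ φ w∈
      ... | no a≢u   = image m a∈ a≢u

    search : ∀ fuel ws → Unique ws → ws ⊆ vs → length vs ≤ length ws + fuel →
             (∀ {u} → u ∈ v ∷ ws → Missing u (v ∷ ws)) → SDR (v ∷ vs) ⊎ Violator (v ∷ vs)
    search fuel ws ws! ws⊆ enough reach
      with any? (λ u → any? (λ c → ¬? (c ∈ℕ? map φ ws)) (L u)) (v ∷ ws)
    ... | no none = inj₂ (v ∷ ws , map φ ws , All.¬Any⇒All¬ ws (v∉vs ∘ ws⊆) ∷ ws! ,
                          S⊆ , L⊆ , s≤s (≤-reflexive (length-map φ ws)))
      where
      S⊆ : v ∷ ws ⊆ v ∷ vs
      S⊆ (here p)  = here p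
      S⊆ (there p) = there (ws⊆ p)
      L⊆ : ∀ {a} → a ∈ v ∷ ws → L a ⊆ map φ ws
      L⊆ a∈ {c} c∈ with c ∈ℕ? map φ ws
      ... | yes p = p
      ... | no ¬p = contradiction (lose a∈ (lose c∈ ¬p)) none
    ... | yes some with find some
    ... | u , u∈ , q with find q
    ... | c , c∈ , c∉ with c ∈ℕ? map φ vs
    ... | no c∉vs = inj₁ (finish (S⊆ u∈) c∈ c∉vs (reach u∈))
      where
      S⊆ : v ∷ ws ⊆ v ∷ vs
      S⊆ (here p)  = here p
      S⊆ (there p) = there (ws⊆ p)
    ... | yes c∈vs with ∈-map⁻ φ c∈vs
    ... | w , w∈ , refl = grow fuel enough
      where
      w∉ws : w ∉ ws
      w∉ws p = c∉ (∈-map⁺ φ p)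
      w∉S : w ∉ v ∷ ws
      w∉S (here refl) = v∉vs w∈
      w∉S (there p)   = w∉ws p
      w∷ws! : Unique (w ∷ ws)
      w∷ws! = All.¬Any⇒All¬ ws w∉ws ∷ ws!
      w∷ws⊆ : w ∷ ws ⊆ vs
      w∷ws⊆ (here refl) = w∈
      w∷ws⊆ (there p)   = ws⊆ p
      reach′ : ∀ {x} → x ∈ v ∷ w ∷ ws → Missing x (v ∷ w ∷ ws)
      reach′ (here refl)         = weaken (λ { (here p) → here p ; (there p) → there (there p) }) (reach (here refl))
      reach′ (there (here refl)) =
        weaken (λ { (here p) → there (here p) ; (there (here p)) → here p ; (there (there p)) → there (there p) })
               (shift u∈ w∈ w∉S c∈ (reach u∈))
      reach′ (there (there p))   = weaken (λ { (here p) → here p ; (there p) → there (there p) }) (reach (there p))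
      grow : ∀ fuel → length vs ≤ length ws + fuel → SDR (v ∷ vs) ⊎ Violator (v ∷ vs)
      grow zero e =
        contradiction (≤-trans (unique-⊆-length w∷ws! w∷ws⊆) (≤-trans e (≤-reflexive (+-identityʳ _)))) (n≮n _)
      grow (suc f) e = search f (w ∷ ws) w∷ws! w∷ws⊆ (≤-trans e (≤-reflexive (+-suc _ f))) reach′

  hall : ∀ vs → Unique vs → SDR vs ⊎ Violator vs
  hall [] [] = inj₁ ((λ _ → 0) , (λ ()) , λ ())
  hall (v ∷ vs) (v∉ ∷ vs!) with hall vs vs!
  ... | inj₂ (S , U , S! , S⊆ , L⊆ , lt) = inj₂ (S , U , S! , there ∘ S⊆ , L⊆ , lt)
  ... | inj₁ (φ , φ∈ , φ-inj) = search (length vs) [] [] (λ ()) ≤-refl λ { (here refl) → start }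
    where
    v∉vs : v ∉ vs
    v∉vs p = All.lookup v∉ p refl
    open Augment v vs v∉vs φ φ∈
    tail : ∀ {a} → a ∈ v ∷ vs → a ≢ v → a ∈ vs
    tail (here p)  a≢v = contradiction p a≢v
    tail (there p) _   = p
    start : Missing v (v ∷ [])
    start = record
      { ψ = φ ; ψ∈ = λ a∈ a≢ → φ∈ (tail a∈ a≢)
      ; inj = λ a∈ b∈ a≢ b≢ → φ-inj (tail a∈ a≢) (tail b∈ b≢)
      ; image = λ a∈ a≢ → ∈-map⁺ φ (tail a∈ a≢)
      ; agree = λ _ _ → refl }

-- Permutations and flattened lists of pairs

unique-resp-↭ : {A : Set} {xs ys : List A} → xs ↭ ys → Unique xs → Unique ys
unique-resp-↭ {A} p = PermSetoid.Unique-resp-↭ (setoid A) (↭⇒↭ₛ p)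

Unique-tail : {A : Set} {x : A} {xs : List A} → Unique (x ∷ xs) → Unique xs
Unique-tail (_ ∷ u) = u

Unique-head : {A : Set} {x : A} {xs : List A} → Unique (x ∷ xs) → x ∉ xs
Unique-head (x∉ ∷ _) p = All.lookup x∉ p refl

Unique-++ʳ : {A : Set} (xs : List A) {ys : List A} → Unique (xs ++ ys) → Unique ys
Unique-++ʳ []       u = u
Unique-++ʳ (_ ∷ xs) u = Unique-++ʳ xs (Unique-tail u)

nonempty : {A : Set} {n : ℕ} (xs : List A) → n < length xs → ∃ λ x → x ∈ xs
nonempty (x ∷ _) _ = x , here refl

flat : {A : Set} → List (A × A) → List A
flat []             = []
flat ((f , y) ∷ ps) = f ∷ y ∷ flat ps

length-flat : {A : Set} (ps : List (A × A)) → length (flat ps) ≡ length ps + length ps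
length-flat []       = refl
length-flat (_ ∷ ps) = cong suc (trans (cong suc (length-flat ps)) (sym (+-suc _ _)))

flat-++ : {A : Set} (ps qs : List (A × A)) → flat (ps ++ qs) ≡ flat ps ++ flat qs
flat-++ []       qs = refl
flat-++ (_ ∷ ps) qs = cong (λ xs → _ ∷ _ ∷ xs) (flat-++ ps qs)

∈-flat⁻ : {A : Set} {v : A} (ps : List (A × A)) → v ∈ flat ps →
          ∃ λ p → p ∈ ps × (v ≡ proj₁ p ⊎ v ≡ proj₂ p)
∈-flat⁻ (p ∷ ps) (here refl)         = p , here refl , inj₁ refl
∈-flat⁻ (p ∷ ps) (there (here refl)) = p , here refl , inj₂ refl
∈-flat⁻ (p ∷ ps) (there (there q)) with ∈-flat⁻ ps q
... | r , r∈ , e = r , there r∈ , e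

∈-flat⁺ : {A : Set} {f y : A} {ps : List (A × A)} → (f , y) ∈ ps → f ∈ flat ps × y ∈ flat ps
∈-flat⁺ (here refl) = here refl , there (here refl)
∈-flat⁺ (there p) with ∈-flat⁺ p
... | f∈ , y∈ = there (there f∈) , there (there y∈)

flat-shift : {A : Set} (as : List (A × A)) (f y : A) (bs : List (A × A)) (zs : List A) →
             flat (as ++ (f , y) ∷ bs) ++ zs ↭ f ∷ y ∷ flat (as ++ bs) ++ zs
flat-shift as f y bs zs = begin
  flat (as ++ (f , y) ∷ bs) ++ zs          ≡⟨ cong (_++ zs) (flat-++ as _) ⟩
  (flat as ++ f ∷ y ∷ flat bs) ++ zs       ↭⟨ Perm.++⁺ʳ zs (Perm.shift f (flat as) (y ∷ flat bs)) ⟩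
  f ∷ (flat as ++ y ∷ flat bs) ++ zs       ↭⟨ Perm.++⁺ʳ zs (_↭_.prep f (Perm.shift y (flat as) (flat bs))) ⟩
  f ∷ y ∷ (flat as ++ flat bs) ++ zs       ≡⟨ cong (λ xs → f ∷ y ∷ xs ++ zs) (flat-++ as bs) ⟨
  f ∷ y ∷ flat (as ++ bs) ++ zs            ∎
  where open PermutationReasoning

-- List colourings of a finite set of vertices

module Colouring {V : Set} (_≟_ : DecidableEquality V) (Adj : V → V → Set)
                 (adj? : ∀ u v → Dec (Adj u v)) (adj-sym : ∀ {u v} → Adj u v → Adj v u)
                 (adj-irrefl : ∀ {v} → ¬ Adj v v) where

  open Finite _≟_
  open Maps _≟_
  module Colour = Finite Data.Nat._≟_

  Colours : (V → List ℕ) → List V → (V → ℕ) → Set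
  Colours L vs φ = (∀ {v} → v ∈ vs → φ v ∈ L v) ×
                   (∀ {u v} → u ∈ vs → v ∈ vs → Adj u v → φ u ≢ φ v)

  Colourable : (V → List ℕ) → List V → Set
  Colourable L vs = ∃ (Colours L vs)

  colours-⊆ : ∀ {L us vs φ} → us ⊆ vs → Colours L vs φ → Colours L us φ
  colours-⊆ us⊆ (φ∈ , φ≢) = φ∈ ∘ us⊆ , λ u∈ v∈ → φ≢ (us⊆ u∈) (us⊆ v∈)

  adj⇒≢ : ∀ {u v} → Adj u v → u ≢ v
  adj⇒≢ a refl = adj-irrefl a

  extend : ∀ {L cs φ w c} → Colours L cs φ → c ∈ L w →
           (∀ {u} → u ∈ cs → Adj w u → φ u ≢ c) → Colours L (w ∷ cs) (φ [ w ↦ c ])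
  extend {L} {cs} {φ} {w} {c} (φ∈ , φ≢) c∈ ok = χ∈ , χ≢
    where
    χ = φ [ w ↦ c ]
    old : ∀ {v} → v ∈ w ∷ cs → v ≢ w → v ∈ cs
    old (here p)  v≢w = contradiction p v≢w
    old (there p) _   = p
    χ∈ : ∀ {v} → v ∈ w ∷ cs → χ v ∈ L v
    χ∈ {v} v∈ with v ≟ w
    ... | yes refl = c∈
    ... | no v≢w   = φ∈ (old v∈ v≢w)
    χ≢ : ∀ {u v} → u ∈ w ∷ cs → v ∈ w ∷ cs → Adj u v → χ u ≢ χ v
    χ≢ {u} {v} u∈ v∈ a with u ≟ w | v ≟ w
    ... | yes refl | yes refl = contradiction a adj-irrefl
    ... | yes refl | no v≢w   = λ e → ok (old v∈ v≢w) a (sym e)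
    ... | no u≢w   | yes refl = ok (old u∈ u≢w) (adj-sym a)
    ... | no u≢w   | no v≢w   = φ≢ (old u∈ u≢w) (old v∈ v≢w) a

  nbrs : V → List V → List V
  nbrs v = filter (adj? v)

  ∈-nbrs⁺ : ∀ {v u vs} → u ∈ vs → Adj v u → u ∈ nbrs v vs
  ∈-nbrs⁺ {v} = ∈-filter⁺ (adj? v)

  ∈-nbrs⁻ : ∀ {v u} vs → u ∈ nbrs v vs → u ∈ vs × Adj v u
  ∈-nbrs⁻ {v} vs = ∈-filter⁻ (adj? v)

  greedy : ∀ {L cs φ w} → Colours L cs φ → w ∉ cs → Unique (L w) → length (nbrs w cs) < length (L w) →
           ∃ λ φ′ → Colours L (w ∷ cs) φ′ × (∀ {a} → a ∈ cs → φ′ a ≡ φ a)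
  greedy {L} {cs} {φ} {w} col w∉ L! few
    with Colour.∃∉ (map φ (nbrs w cs)) L! (subst (_< length (L w)) (sym (length-map φ (nbrs w cs))) few)
  ... | c , c∈ , c∉ = φ [ w ↦ c ] ,
        extend col c∈ (λ u∈ a e → c∉ (subst (_∈ map φ (nbrs w cs)) e (∈-map⁺ φ (∈-nbrs⁺ u∈ a)))) ,
        λ a∈ → update-≢ φ c λ { refl → w∉ a∈ }

  -- Colouring by means of nonadjacent pairs

  -- A pair (f , y) of nonadjacent vertices whose lists meet is given a common
  -- colour; then one colour and one pair fewer remain and every bound below is
  -- preserved.  If no pair is left whose lists meet, Hall's condition holds: a
  -- violating set contains at most one vertex of each pair.
  record Separated (L : V → List ℕ) (ρ j : ℕ) (p : V × V) : Set where
    constructor separated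
    field
      nonadjacent : ¬ Adj (proj₁ p) (proj₂ p)
      first       : suc j ≤ length (L (proj₁ p))
      second      : ρ + j ≤ length (L (proj₂ p))
      both        : ρ + 2 + (j + j) ≤ length (L (proj₁ p)) + length (L (proj₂ p))

  module NoShare (L : V → List ℕ) (ps : List (V × V)) (u₁ u₂ : V) (R : List V)
                 (H! : Unique (flat ps ++ u₁ ∷ u₂ ∷ R))
                 (L! : ∀ {v} → v ∈ flat ps ++ u₁ ∷ u₂ ∷ R → Unique (L v))
                 (sep : ∀ {p} → p ∈ ps → Separated L (length R) (length ps) p)
                 (l₁ : length R + 2 + length ps ≤ length (L u₁))
                 (l₂ : length R + 1 + length ps ≤ length (L u₂))
                 (lR : ∀ {v} → v ∈ R → length R + length ps ≤ length (L v))
                 (noshare : ∀ {p c} → p ∈ ps → c ∈ L (proj₁ p) → c ∉ L (proj₂ p)) where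

    H : List V
    H = flat ps ++ u₁ ∷ u₂ ∷ R

    open Hall _≟_ L
    open Separated

    ρ = length R
    j = length ps

    length-H : length H ≡ (j + j) + (2 + ρ)
    length-H = trans (length-++ (flat ps)) (cong (_+ (2 + ρ)) (length-flat ps))

    module _ (S : List V) (U : List ℕ) (S! : Unique S) (S⊆ : S ⊆ H)
             (L⊆U : ∀ {a} → a ∈ S → L a ⊆ U) (small : length U < length S) where

      short : ∀ {v} → v ∈ S → length (L v) < length S
      short v∈ = ≤-<-trans (unique-⊆-length (L! (S⊆ v∈)) (L⊆U v∈)) small

      notBoth : ∀ {p} → p ∈ ps → proj₁ p ∈ S → proj₂ p ∉ S
      notBoth {f , y} p∈ f∈ y∈ = (linᶜ (union ⊕ small ⊕ S≤ ⊕ (both (sep p∈))) 0 (id {A = ∀ j lf ls lu ly ρ → (lf + ly) + (suc (lu)) + ls + (ρ + 2 + (j + j)) ≡ lu + ls + ((j + j) + (2 + ρ)) + (lf + ly) + suc 0} solve-∀ j lf ls lu ly ρ))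
        where
        lf = length (L f)
        ly = length (L y)
        lu = length U
        ls = length S
        union : lf + ly ≤ lu
        union = subst (_≤ lu) (length-++ (L f))
          (unique-⊆-length (unique-++ (L! (S⊆ f∈)) (L! (S⊆ y∈)) (noshare p∈))
            (λ q → case ∈-++⁻ (L f) q of λ { (inj₁ r) → L⊆U f∈ r ; (inj₂ r) → L⊆U y∈ r }))
        S≤ : ls ≤ (j + j) + (2 + ρ)
        S≤ = subst (ls ≤_) length-H (unique-⊆-length S! S⊆)

      -- By `notBoth` one representative of each pair covers the part of `S` inside the pairs. Hence
      -- the pairs, with `j + j` vertices, add only `j` to the bound on `S`.
      choose : ∀ qs → qs ⊆ ps → ∃ λ Q → length Q ≡ length qs × (∀ {s} → s ∈ S → s ∈ flat qs → s ∈ Q)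
      choose [] _ = [] , refl , λ _ ()
      choose ((f , y) ∷ qs) qs⊆ with choose qs (qs⊆ ∘ there) | f ∈? S
      ... | Q , e , h | yes f∈ = f ∷ Q , cong suc e , λ
        { _  (here refl)         → here refl
        ; y∈ (there (here refl)) → contradiction y∈ (notBoth (qs⊆ (here refl)) f∈)
        ; s∈ (there (there q))   → there (h s∈ q) }
      ... | Q , e , h | no f∉ = y ∷ Q , cong suc e , λ
        { f∈ (here refl)         → contradiction f∈ f∉
        ; _  (there (here refl)) → here refl
        ; s∈ (there (there q))   → there (h s∈ q) }

      bound : ∀ Z → (∀ {s} → s ∈ S → s ∈ u₁ ∷ u₂ ∷ R → s ∈ Z) → length S ≤ j + length Z
      bound Z rest with choose ps id
      ... | Q , e , h = subst (λ q → length S ≤ q + length Z) e (subst (length S ≤_) (length-++ Q) (unique-⊆-length S! λ s∈ →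
        case ∈-++⁻ (flat ps) (S⊆ s∈) of λ { (inj₁ q) → ∈-++⁺ˡ (h s∈ q) ; (inj₂ q) → ∈-++⁺ʳ Q (rest s∈ q) }))

      -- The required list sizes are graded to fit this order of exclusion. Every vertex of `S` has
      -- fewer colours than `S` has vertices, which rules out `u₁`. Without `u₁` the bound on `S`
      -- drops by one, which rules out `u₂`; it drops again, which rules out `R` and the second
      -- members of the pairs. What remains are first members: at most `j` of them, each with more
      -- than `j` colours.
      absurd : ⊥
      absurd with u₁ ∈? S | u₂ ∈? S
      ... | yes p | _ = (linᶜ ((short p) ⊕ l₁ ⊕ (bound (u₁ ∷ u₂ ∷ R) λ _ q → q)) 0 (id {A = ∀ a j r s → (suc (a)) + (r + 2 + j) + s ≡ s + a + (j + (2 + r)) + suc 0} solve-∀ a j r s))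
        where
        a = length (L u₁)
        s = length S
        r = length R
      ... | no p | yes q = (linᶜ ((short q) ⊕ l₂ ⊕ (bound (u₂ ∷ R) λ { s∈ (here refl) → contradiction s∈ p ; _ (there x) → x })) 0 (id {A = ∀ a j r s → (suc (a)) + (r + 1 + j) + s ≡ s + a + (j + (1 + r)) + suc 0} solve-∀ a j r s))
        where
        a = length (L u₂)
        s = length S
        r = length R
      ... | no p | no q = contradiction (unique-⊆-length S! firsts) (<⇒≱ few)
        where
        S≤ : length S ≤ length R + length ps
        S≤ = subst (length S ≤_) (+-comm j ρ) (bound R λ
          { s∈ (here refl) → contradiction s∈ p ; s∈ (there (here refl)) → contradiction s∈ q ; _ (there (there x)) → x })
        firsts : S ⊆ map proj₁ ps
        firsts s∈ with ∈-++⁻ (flat ps) (S⊆ s∈)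
        ... | inj₂ (here refl)          = contradiction s∈ p
        ... | inj₂ (there (here refl))  = contradiction s∈ q
        ... | inj₂ (there (there s∈R))  = contradiction (≤-trans S≤ (lR s∈R)) (<⇒≱ (short s∈))
        ... | inj₁ s∈ps with ∈-flat⁻ ps s∈ps
        ... | pr , pr∈ , inj₁ refl = ∈-map⁺ proj₁ pr∈
        ... | pr , pr∈ , inj₂ refl = contradiction (≤-trans S≤ (second (sep pr∈))) (<⇒≱ (short s∈))
        few : length (map proj₁ ps) < length S
        few with nonempty S small
        ... | s , s∈ with ∈-map⁻ proj₁ (firsts s∈)
        ... | pr , pr∈ , refl = subst (_< length S) (sym (length-map proj₁ ps)) (<-trans (first (sep pr∈)) (short s∈))

    colourable : Colourable L H
    colourable with hall H H!
    ... | inj₁ (φ , φ∈ , inj) = φ , φ∈ , λ u∈ v∈ a e → adj⇒≢ a (inj u∈ v∈ e)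
    ... | inj₂ (S , U , S! , S⊆ , L⊆ , lt) = ⊥-elim (absurd S U S! S⊆ L⊆ lt)

  pairs-colourable :
    ∀ N (L : V → List ℕ) ps u₁ u₂ R → length ps ≤ N →
    Unique (flat ps ++ u₁ ∷ u₂ ∷ R) →
    (∀ {v} → v ∈ flat ps ++ u₁ ∷ u₂ ∷ R → Unique (L v)) →
    (∀ {p} → p ∈ ps → Separated L (length R) (length ps) p) →
    length R + 2 + length ps ≤ length (L u₁) →
    length R + 1 + length ps ≤ length (L u₂) →
    (∀ {v} → v ∈ R → length R + length ps ≤ length (L v)) →
    Colourable L (flat ps ++ u₁ ∷ u₂ ∷ R)
  pairs-colourable zero L [] u₁ u₂ R _ H! L! sep l₁ l₂ lR =
    NoShare.colourable L [] u₁ u₂ R H! L! sep l₁ l₂ lR λ ()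
  pairs-colourable (suc N) L ps u₁ u₂ R ≤N H! L! sep l₁ l₂ lR
    with any? (λ p → any? (λ c → c Colour.∈? L (proj₂ p)) (L (proj₁ p))) ps
  ... | no none = NoShare.colourable L ps u₁ u₂ R H! L! sep l₁ l₂ lR
                    λ p∈ c∈ c∈′ → none (lose p∈ (lose c∈ c∈′))
  ... | yes some with find some
  ... | (f , y) , p∈ , s with find s
  ... | c , c∈f , c∈y with ∈-∃++ p∈
  ... | as , bs , refl = colour (pairs-colourable N L′ (as ++ bs) u₁ u₂ R (s≤s⁻¹ (subst (_≤ suc N) j≡ ≤N)) H′! L′! sep′
                           (drop u₁∈ (≤-trans (≤-reflexive (drop-eq _)) l₁)) (drop u₂∈ (≤-trans (≤-reflexive (drop-eq _)) l₂))
                           λ v∈ → drop (there (there (∈-++⁺ʳ (flat (as ++ bs)) (there (there v∈))))) (≤-trans (≤-reflexive (drop-eq₀ _)) (lR v∈)))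
    where
    open Separated
    j′ = length (as ++ bs)
    Z = u₁ ∷ u₂ ∷ R
    H′ = flat (as ++ bs) ++ Z
    perm : flat (as ++ (f , y) ∷ bs) ++ Z ↭ f ∷ y ∷ H′
    perm = flat-shift as f y bs Z
    all! : Unique (f ∷ y ∷ H′)
    all! = unique-resp-↭ perm H!
    H′! : Unique H′
    H′! = Unique-tail (Unique-tail all!)
    L′ : V → List ℕ
    L′ v = L v Colour.∖ (c ∷ [])
    orig : ∀ {v} → v ∈ f ∷ y ∷ H′ → v ∈ flat (as ++ (f , y) ∷ bs) ++ Z
    orig = Perm.∈-resp-↭ (↭-sym perm)
    L′! : ∀ {v} → v ∈ H′ → Unique (L′ v)
    L′! v∈ = Colour.unique-∖ (c ∷ []) (L! (orig (there (there v∈))))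
    j≡ : length (as ++ (f , y) ∷ bs) ≡ suc j′
    j≡ = trans (length-++ as) (trans (+-suc _ _) (cong suc (sym (length-++ as))))
    drop-eq : ∀ a → suc (length R + suc a + j′) ≡ length R + suc a + length (as ++ (f , y) ∷ bs)
    drop-eq a = trans (sym (+-suc (length R + suc a) j′)) (cong (length R + suc a +_) (sym j≡))
    drop-eq₀ : ∀ a → suc (a + j′) ≡ a + length (as ++ (f , y) ∷ bs)
    drop-eq₀ a = trans (sym (+-suc a j′)) (cong (a +_) (sym j≡))
    drop : ∀ {v n} → v ∈ f ∷ y ∷ H′ → suc n ≤ length (L v) → n ≤ length (L′ v)
    drop v∈ n< = s≤s⁻¹ (≤-trans n< (Colour.length-∖₁ c (L! (orig v∈))))
    u₁∈ : u₁ ∈ f ∷ y ∷ H′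
    u₁∈ = there (there (∈-++⁺ʳ (flat (as ++ bs)) (here refl)))
    u₂∈ : u₂ ∈ f ∷ y ∷ H′
    u₂∈ = there (there (∈-++⁺ʳ (flat (as ++ bs)) (there (here refl))))
    keep : as ++ bs ⊆ as ++ (f , y) ∷ bs
    keep q with ∈-++⁻ as q
    ... | inj₁ r = ∈-++⁺ˡ r
    ... | inj₂ r = ∈-++⁺ʳ as (there r)
    sep′ : ∀ {p} → p ∈ as ++ bs → Separated L′ (length R) j′ p
    sep′ {a , b} q = separated (nonadjacent old)
      (drop a∈ (subst (λ n → suc n ≤ length (L a)) j≡ (first old)))
      (drop b∈ (≤-trans (≤-reflexive (drop-eq₀ _)) (second old)))
      -- Each of the two lists loses at most one colour, while `j + j` drops by two.
      (lin ((both old) ⊕ ≤-reflexive (sym j≡) ⊕ ≤-reflexive (sym j≡) ⊕ (Colour.length-∖₁ c (L! (orig a∈))) ⊕ (Colour.length-∖₁ c (L! (orig b∈)))) 0 (id {A = ∀ a′ b′ j′ j₁ la lb r → r + 2 + (j′ + j′) + ((la + lb) + j₁ + j₁ + (suc a′) + (suc b′)) + 0 ≡ a′ + b′ + ((r + 2 + (j₁ + j₁)) + (suc j′) + (suc j′) + la + lb)} solve-∀ a′ b′ j′ j₁ la lb r))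
      where
      old = sep (keep q)
      a∈ : a ∈ f ∷ y ∷ H′
      a∈ = there (there (∈-++⁺ˡ (proj₁ (∈-flat⁺ q))))
      b∈ : b ∈ f ∷ y ∷ H′
      b∈ = there (there (∈-++⁺ˡ (proj₂ (∈-flat⁺ q))))
      r = length R
      j₁ = length (as ++ (f , y) ∷ bs)
      la = length (L a)
      lb = length (L b)
      a′ = length (L′ a)
      b′ = length (L′ b)
    colour : Colourable L′ H′ → Colourable L (flat (as ++ (f , y) ∷ bs) ++ Z)
    colour (φ , φ∈ , φ≢) = _ , colours-⊆ (Perm.∈-resp-↭ perm) (extend (extend base c∈y λ v∈ _ → ≢c v∈) c∈f ok)
      where
      base : Colours L H′ φ
      base = (λ v∈ → proj₁ (Colour.∈-∖⁻ (L _) (c ∷ []) (φ∈ v∈))) , φ≢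
      ≢c : ∀ {v} → v ∈ H′ → φ v ≢ c
      ≢c v∈ e = proj₂ (Colour.∈-∖⁻ (L _) (c ∷ []) (φ∈ v∈)) (here e)
      ok : ∀ {u} → u ∈ y ∷ H′ → Adj f u → (φ [ y ↦ c ]) u ≢ c
      ok (here refl) a = contradiction a (nonadjacent (sep p∈))
      ok (there u∈)  a = λ e → ≢c u∈ (trans (sym (update-≢ φ c λ { refl → Unique-head (Unique-tail all!) u∈ })) e)

  -- Reduction to a subset H

  pick : ∀ {xs} D → Unique xs → Unique D → D ⊆ xs →
         ∃ λ R → Unique (D ++ R) × xs ⊆ D ++ R × R ⊆ xs × length D + length R ≡ length xs
  pick {xs} D xs! D! D⊆ = R , DR! , xs⊆ , R⊆ , trans (sym (length-++ D)) (≤-antisym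
      (unique-⊆-length DR! (λ q → case ∈-++⁻ D q of λ { (inj₁ r) → D⊆ r ; (inj₂ r) → R⊆ r }))
      (unique-⊆-length xs! xs⊆))
    where
    R = xs ∖ D
    R⊆ : R ⊆ xs
    R⊆ q = proj₁ (∈-∖⁻ xs D q)
    DR! : Unique (D ++ R)
    DR! = unique-++ D! (unique-∖ D xs!) λ p q → proj₂ (∈-∖⁻ xs D q) p
    xs⊆ : xs ⊆ D ++ R
    xs⊆ {x} x∈ with x ∈? D
    ... | yes p = ∈-++⁺ˡ p
    ... | no ¬p = ∈-++⁺ʳ D (∈-∖⁺ x∈ ¬p)

  clique-or-pair : ∀ xs → Unique xs →
    AllPairs Adj xs ⊎ ∃ λ f → ∃ λ y → f ∈ xs × y ∈ xs × f ≢ y × ¬ Adj f y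
  clique-or-pair [] _ = inj₁ []
  clique-or-pair (x ∷ xs) (x∉ ∷ xs!) with clique-or-pair xs xs! | All.all? (adj? x) xs
  ... | inj₂ (f , y , f∈ , y∈ , f≢ , na) | _ = inj₂ (f , y , there f∈ , there y∈ , f≢ , na)
  ... | inj₁ c | yes a = inj₁ (a ∷ c)
  ... | inj₁ c | no ¬a with find (All.¬All⇒Any¬ (adj? x) xs ¬a)
  ... | y , y∈ , na = inj₂ (x , y , here refl , there y∈ , All.lookup x∉ y∈ , na)

  -- What remains of the lists once the vertices outside H are coloured: a vertex
  -- with d neighbours in H sees at most k + 1 − d colours outside.
  record Residual (k : ℕ) (vs H : List V) (L′ : V → List ℕ) : Set where
    field
      unique   : ∀ v → Unique (L′ v)
      d₁-bound : ∀ {v ns} → v ∈ H → Unique ns → ns ⊆ H → (∀ {u} → u ∈ ns → Adj v u) →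
                 length ns ≤ suc (length (L′ v))
      inside   : ∀ {v} → v ∈ H → (∀ {u} → u ∈ vs → Adj v u → u ∈ H) → k ≤ length (L′ v)

  module _ {k : ℕ} {L : V → List ℕ} (L! : ∀ v → Unique (L v)) (L≡ : ∀ v → length (L v) ≡ k)
           (deg : ∀ {v ns} → Unique ns → (∀ {u} → u ∈ ns → Adj v u) → length ns ≤ suc k) where

    reduce : ∀ {vs} H → Unique vs → Colourable L (vs ∖ H) →
             (∀ L′ → Residual k vs H L′ → Colourable L′ H) → Colourable L vs
    reduce {vs} H vs! (ψ , ψ∈ , ψ≢) solveH = χ , χ∈ , χ≢
      where
      out = vs ∖ H
      used : V → List ℕ
      used v = map ψ (nbrs v out)
      L′ : V → List ℕ
      L′ v = L v Colour.∖ used v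
      left : ∀ v → k ≤ length (L′ v) + length (nbrs v out)
      left v = subst₂ _≤_ (L≡ v) (cong (length (L′ v) +_) (length-map ψ (nbrs v out))) (Colour.length-∖ (used v) (L! v))
      res : Residual k vs H L′
      res = record
        { unique = λ v → Colour.unique-∖ (used v) (L! v)
        ; d₁-bound = λ {v} {ns} v∈ ns! ns⊆ adj → +-cancelʳ-≤ (length (nbrs v out)) _ _
            (≤-trans (subst (_≤ suc k) (length-++ ns) (deg
              (unique-++ ns! (Unique.filter⁺ (adj? v) (unique-∖ H vs!))
                λ p q → proj₂ (∈-∖⁻ vs H (proj₁ (∈-nbrs⁻ out q))) (ns⊆ p))
              λ q → case ∈-++⁻ ns q of λ { (inj₁ r) → adj r ; (inj₂ r) → proj₂ (∈-nbrs⁻ out r) }))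
            (s≤s (left v)))
        ; inside = λ {v} v∈ all → ≤-trans (left v) (≤-reflexive (trans
            (cong (length (L′ v) +_) (cong length (none v all))) (+-identityʳ _))) }
        where
        none : ∀ v → (∀ {u} → u ∈ vs → Adj v u → u ∈ H) → nbrs v out ≡ []
        none v all with nbrs v out in eq
        ... | [] = refl
        ... | u ∷ _ with ∈-nbrs⁻ {v} out (subst (u ∈_) (sym eq) (here refl))
        ... | u∈ , a with ∈-∖⁻ vs H u∈
        ... | u∈vs , u∉H = contradiction (all u∈vs a) u∉H
      sol = solveH L′ res
      φ = proj₁ sol
      χ : V → ℕ
      χ v with v ∈? H
      ... | yes _ = φ v
      ... | no  _ = ψ v
      χ∈ : ∀ {v} → v ∈ vs → χ v ∈ L v
      χ∈ {v} v∈ with v ∈? H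
      ... | yes p = proj₁ (Colour.∈-∖⁻ (L v) (used v) (proj₁ (proj₂ sol) p))
      ... | no ¬p = ψ∈ (∈-∖⁺ v∈ ¬p)
      cross : ∀ {u v} → u ∈ H → v ∈ out → Adj u v → φ u ≢ ψ v
      cross {u} u∈ v∈ a e = proj₂ (Colour.∈-∖⁻ (L u) (used u) (proj₁ (proj₂ sol) u∈))
        (subst (_∈ used u) (sym e) (∈-map⁺ ψ (∈-nbrs⁺ v∈ a)))
      χ≢ : ∀ {u v} → u ∈ vs → v ∈ vs → Adj u v → χ u ≢ χ v
      χ≢ {u} {v} u∈ v∈ a with u ∈? H | v ∈? H
      ... | yes p | yes q = proj₂ (proj₂ sol) p q a
      ... | yes p | no ¬q = cross p (∈-∖⁺ v∈ ¬q) a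
      ... | no ¬p | yes q = λ e → cross q (∈-∖⁺ u∈ ¬p) (adj-sym a) (sym e)
      ... | no ¬p | no ¬q = ψ≢ (∈-∖⁺ u∈ ¬p) (∈-∖⁺ v∈ ¬q) a

  -- A clique with one or two further vertices

  IsClique : List V → Set
  IsClique K = ∀ {a b} → a ∈ K → b ∈ K → a ≢ b → Adj a b

  clique⇒AllPairs : ∀ {K} → Unique K → IsClique K → AllPairs Adj K
  clique⇒AllPairs []         _   = []
  clique⇒AllPairs {x ∷ K} (x∉ ∷ K!) clq =
    All.tabulate (λ y∈ → clq (here refl) (there y∈) (All.lookup x∉ y∈)) ∷ clique⇒AllPairs K! (λ p q → clq (there p) (there q))

  module _ {k : ℕ} {vs : List V} {L′ : V → List ℕ} where

    -- The neighbours of `v` in `H` include all of `K` except `v` itself, and `ns`. The 2 is one for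
    -- `v` and one for the possible excess of its degree over `k`.
    clique-bound : ∀ {K H v} → Residual k vs H L′ → Unique K → IsClique K → K ⊆ H → v ∈ K →
                   ∀ ns → Unique ns → ns ⊆ H → (∀ {u} → u ∈ ns → Adj v u) → (∀ {u} → u ∈ ns → u ∉ K) →
                   length K + length ns ≤ 2 + length (L′ v)
    clique-bound {K} {H} {v} res K! clq K⊆ v∈ ns ns! ns⊆ adj out =
      ≤-trans (+-monoˡ-≤ (length ns) (length-∖₁ v K!)) (s≤s (subst (_≤ suc (length (L′ v))) (length-++ (K ∖ (v ∷ [])))
        (Residual.d₁-bound res (K⊆ v∈)
          (unique-++ (unique-∖ (v ∷ []) K!) ns! λ p q → out q (proj₁ (∈-∖⁻ K _ p)))
          (λ q → case ∈-++⁻ (K ∖ (v ∷ [])) q of λ { (inj₁ r) → K⊆ (proj₁ (∈-∖⁻ K _ r)) ; (inj₂ r) → ns⊆ r })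
          (λ q → case ∈-++⁻ (K ∖ (v ∷ [])) q of λ
            { (inj₁ r) → clq v∈ (proj₁ (∈-∖⁻ K _ r)) (λ { refl → proj₂ (∈-∖⁻ K _ r) (here refl) }) ; (inj₂ r) → adj r }))))

    -- One pair requires `length R + 3` colours at `u₁`. Adjacency to the rest of the clique and to
    -- `p` would guarantee only `length R + 2`, so `u₁` is taken without neighbours outside `H` and
    -- keeps its full list. Four neighbours leave `p` three colours, which together with the
    -- `length R + 1` colours of `z` meet the bound on the sum exactly.
    one-out : ∀ {p z u₁ u₂ R} → let K = z ∷ u₁ ∷ u₂ ∷ R ; H = p ∷ K in
      Residual k vs H L′ → Unique H → IsClique K → 3 + length R ≤ k →
      (∀ {u} → u ∈ vs → Adj u₁ u → u ∈ H) → ¬ Adj p z → Adj u₂ p →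
      ∀ ns → Unique ns → ns ⊆ H → (∀ {u} → u ∈ ns → Adj p u) → 4 ≤ length ns →
      Colourable L′ H
    one-out {p} {z} {u₁} {u₂} {R} res H! clq ≤k inside p≁z u₂~p ns ns! ns⊆ adj 4≤ =
      pairs-colourable 1 L′ ((p , z) ∷ []) u₁ u₂ R ≤-refl H! (λ {v} _ → Residual.unique res v)
        (λ { (here refl) → separated p≁z
               (lin (p≤ ⊕ 4≤) 1 (id {A = ∀ lp n → 2 + ((suc lp) + n) + 1 ≡ lp + (n + 4)} solve-∀ lp n))
               (lin z≤ 0 (id {A = ∀ lz r → r + 1 + (2 + lz) + 0 ≡ lz + ((3 + r) + 0)} solve-∀ lz r))
               (lin (p≤ ⊕ 4≤ ⊕ z≤) 0 (id {A = ∀ lp lz n r → r + 2 + (1 + 1) + ((suc lp) + n + (2 + lz)) + 0 ≡ lp + lz + (n + 4 + ((3 + r) + 0))} solve-∀ lp lz n r)) })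
        (lin (≤k ⊕ (Residual.inside res (there (there (here refl))) inside)) 0 (id {A = ∀ k l₁ r → r + 2 + 1 + (k + l₁) + 0 ≡ l₁ + ((3 + r) + k)} solve-∀ k l₁ r))
        (lin u₂≤ 0 (id {A = ∀ l₂ r → r + 1 + 1 + (2 + l₂) + 0 ≡ l₂ + ((3 + r) + 1)} solve-∀ l₂ r))
        (λ {v} v∈ → R≤ (length (L′ v)) (bound (there (there (there v∈))) [] [] (λ ()) (λ ()) (λ ())))
      where
      r = length R
      n = length ns
      lp = length (L′ p)
      lz = length (L′ z)
      l₁ = length (L′ u₁)
      l₂ = length (L′ u₂)
      bound = λ {v} → clique-bound {v = v} res (Unique-tail H!) clq there
      p≤ : n ≤ suc lp
      p≤ = Residual.d₁-bound res (here refl) ns! ns⊆ adj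
      z≤ : (3 + r) + 0 ≤ 2 + lz
      z≤ = bound (here refl) [] [] (λ ()) (λ ()) (λ ())
      u₂≤ : (3 + r) + 1 ≤ 2 + l₂
      u₂≤ = bound (there (there (here refl))) (p ∷ []) ([] ∷ []) (λ { (here refl) → here refl })
              (λ { (here refl) → u₂~p }) (λ { (here refl) → Unique-head H! })
      R≤ : ∀ l → (3 + r) + 0 ≤ 2 + l → r + 1 ≤ l
      R≤ l h = (lin h 0 (id {A = ∀ l r → r + 1 + (2 + l) + 0 ≡ l + ((3 + r) + 0)} solve-∀ l r))

    -- Each of f and g comes with a nonneighbour in K.  For the pair (f , y) the
    -- lists are long enough if f has five neighbours in H or y is adjacent to g.
    two-outs : ∀ {f y g y′ u₁ u₂ R} → let K = y ∷ y′ ∷ u₁ ∷ u₂ ∷ R ; H = f ∷ g ∷ K in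
      Residual k vs H L′ → Unique H → IsClique K → ¬ Adj f y → ¬ Adj g y′ →
      Adj u₁ f → Adj u₁ g → Adj u₂ f →
      ∀ ns → Unique ns → ns ⊆ H → (∀ {u} → u ∈ ns → Adj f u) → 4 ≤ length ns → 5 ≤ length ns ⊎ Adj y g →
      ∀ ns′ → Unique ns′ → ns′ ⊆ H → (∀ {u} → u ∈ ns′ → Adj g u) → 4 ≤ length ns′ → 5 ≤ length ns′ ⊎ Adj y′ f →
      Colourable L′ H
    two-outs {f} {y} {g} {y′} {u₁} {u₂} {R} res H! clq f≁y g≁y′ u₁~f u₁~g u₂~f ns ns! ns⊆ adj 4≤ alt ns′ ns′! ns′⊆ adj′ 4≤′ alt′ =
      proj₁ sol , colours-⊆ H⊆ (proj₂ sol)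
      where
      K = y ∷ y′ ∷ u₁ ∷ u₂ ∷ R
      H = f ∷ g ∷ K
      H₂ = f ∷ y ∷ g ∷ y′ ∷ u₁ ∷ u₂ ∷ R
      r = length R
      perm : H ↭ H₂
      perm = _↭_.prep f (_↭_.swap g y ↭-refl)
      H⊆ : H ⊆ H₂
      H⊆ = Perm.∈-resp-↭ perm
      f∉ : f ∉ K
      f∉ q = Unique-head H! (there q)
      g∉ : g ∉ K
      g∉ = Unique-head (Unique-tail H!)
      bound = λ {v} → clique-bound {v = v} res (Unique-tail (Unique-tail H!)) clq (there ∘ there)
      basic : ∀ {v} → v ∈ K → (4 + r) + 0 ≤ 2 + length (L′ v)
      basic v∈ = bound v∈ [] [] (λ ()) (λ ()) (λ ())
      ~f : ∀ {v} → v ∈ K → Adj v f → (4 + r) + 1 ≤ 2 + length (L′ v)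
      ~f v∈ a = bound v∈ (f ∷ []) ([] ∷ []) (λ { (here refl) → here refl }) (λ { (here refl) → a }) (λ { (here refl) → f∉ })
      ~g : ∀ {v} → v ∈ K → Adj v g → (4 + r) + 1 ≤ 2 + length (L′ v)
      ~g v∈ a = bound v∈ (g ∷ []) ([] ∷ []) (λ { (here refl) → there (here refl) }) (λ { (here refl) → a }) (λ { (here refl) → g∉ })
      u₁≤ : (4 + r) + 2 ≤ 2 + length (L′ u₁)
      u₁≤ = bound (there (there (here refl))) (f ∷ g ∷ []) (((λ { refl → Unique-head H! (here refl) }) ∷ []) ∷ [] ∷ [])
        (λ { (here refl) → here refl ; (there (here refl)) → there (here refl) })
        (λ { (here refl) → u₁~f ; (there (here refl)) → u₁~g })
        (λ { (here refl) → f∉ ; (there (here refl)) → g∉ })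
      sep : ∀ {f y} → ¬ Adj f y → y ∈ K → ∀ n → n ≤ suc (length (L′ f)) → 4 ≤ n →
            5 ≤ n ⊎ ((4 + r) + 1 ≤ 2 + length (L′ y)) → Separated L′ r 2 (f , y)
      sep {f} {y} na y∈ n n≤ 4≤n alt = separated na
        (lin (n≤ ⊕ 4≤n) 0 (id {A = ∀ a n → 3 + ((suc a) + n) + 0 ≡ a + (n + 4)} solve-∀ a n))
        (lin (basic y∈) 0 (id {A = ∀ b r → r + 2 + (2 + b) + 0 ≡ b + ((4 + r) + 0)} solve-∀ b r))
        (both alt)
        where
        a = length (L′ f)
        b = length (L′ y)
        both : 5 ≤ n ⊎ ((4 + r) + 1 ≤ 2 + b) → r + 2 + (2 + 2) ≤ a + b
        both (inj₁ h) = (lin (n≤ ⊕ h ⊕ (basic y∈)) 0 (id {A = ∀ a b n r → r + 2 + (2 + 2) + ((suc a) + n + (2 + b)) + 0 ≡ a + b + (n + 5 + ((4 + r) + 0))} solve-∀ a b n r))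
        both (inj₂ h) = (lin (n≤ ⊕ 4≤n ⊕ h) 0 (id {A = ∀ a b n r → r + 2 + (2 + 2) + ((suc a) + n + (2 + b)) + 0 ≡ a + b + (n + 4 + ((4 + r) + 1))} solve-∀ a b n r))
      map₂ : ∀ {A B C : Set} → (B → C) → A ⊎ B → A ⊎ C
      map₂ h (inj₁ a) = inj₁ a
      map₂ h (inj₂ b) = inj₂ (h b)
      last : ∀ l → (4 + r) + 0 ≤ 2 + l → r + 2 ≤ l
      last l h = (lin h 0 (id {A = ∀ l r → r + 2 + (2 + l) + 0 ≡ l + ((4 + r) + 0)} solve-∀ l r))
      sol : Colourable L′ H₂
      sol = pairs-colourable 2 L′ ((f , y) ∷ (g , y′) ∷ []) u₁ u₂ R ≤-refl (unique-resp-↭ perm H!) (λ {v} _ → Residual.unique res v)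
        (λ { (here refl) → sep f≁y (here refl) (length ns) (Residual.d₁-bound res (here refl) ns! ns⊆ adj) 4≤
                             (map₂ (~g (here refl)) alt)
           ; (there (here refl)) → sep g≁y′ (there (here refl)) (length ns′) (Residual.d₁-bound res (there (here refl)) ns′! ns′⊆ adj′) 4≤′
                             (map₂ (~f (there (here refl))) alt′) })
        -- `u₁` gains one colour from each of `f` and `g`, and both gains are needed; for `u₂` the
        -- one from `f` is enough.
        (lin u₁≤ 0 (id {A = ∀ l₁ r → r + 2 + 2 + (2 + l₁) + 0 ≡ l₁ + ((4 + r) + 2)} solve-∀ l₁ r))
        (lin (~f (there (there (there (here refl)))) u₂~f) 0 (id {A = ∀ l₂ r → r + 1 + 2 + (2 + l₂) + 0 ≡ l₂ + ((4 + r) + 1)} solve-∀ l₂ r))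
        (λ {v} v∈ → last (length (L′ v)) (basic (there (there (there (there v∈))))))
        where
        l₁ = length (L′ u₁)
        l₂ = length (L′ u₂)

  -- Sets of k + 1 or k + 2 vertices

  module _ {k : ℕ} {L : V → List ℕ} (L! : ∀ v → Unique (L v)) (L≡ : ∀ v → length (L v) ≡ k)
           (noclique : ∀ {K} → AllPairs Adj K → length K ≢ suc k) where

    -- There are `length R + 4` vertices, so the largest demand, `length R + 3` colours at `u₁`,
    -- equals `k`.
    one-missing : ∀ {vs} → 3 ≤ k → Unique vs → length vs ≡ 1 + k → Colourable L vs
    one-missing {vs} 3≤k vs! len with clique-or-pair vs vs!
    ... | inj₁ c = contradiction len (noclique c)
    ... | inj₂ (f , y , f∈ , y∈ , f≢y , na)
      with pick (f ∷ y ∷ []) vs! ((f≢y ∷ []) ∷ [] ∷ []) (λ { (here refl) → f∈ ; (there (here refl)) → y∈ })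
    ... | []          , _ , _ , _ , l = (linᶜ (3≤k ⊕ ≤-reflexive (sym l) ⊕ ≤-reflexive (sym len)) 1 (id {A = ∀ k n → 3 + n + (1 + k) ≡ k + (2 + 0) + n + suc 1} solve-∀ k n))
      where n = length vs
    ... | _ ∷ []      , _ , _ , _ , l = (linᶜ (3≤k ⊕ ≤-reflexive (sym l) ⊕ ≤-reflexive (sym len)) 0 (id {A = ∀ k n → 3 + n + (1 + k) ≡ k + (2 + 1) + n + suc 0} solve-∀ k n))
      where n = length vs
    ... | u₁ ∷ u₂ ∷ R , H! , vs⊆ , _ , l = proj₁ sol , colours-⊆ vs⊆ (proj₂ sol)
      where
      r = length R
      k≡ : k ≡ 3 + r
      k≡ = suc-injective (trans (sym len) (sym l))
      big : ∀ v n → n ≤ 3 + r → n ≤ length (L v)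
      big v n h = ≤-trans h (≤-reflexive (trans (sym k≡) (sym (L≡ v))))
      sol : Colourable L (f ∷ y ∷ u₁ ∷ u₂ ∷ R)
      sol = pairs-colourable 1 L ((f , y) ∷ []) u₁ u₂ R ≤-refl H! (λ {v} _ → L! v)
        (λ { (here refl) → separated na (big f 2 (lin (z≤n {0}) (1 + r) (id {A = ∀ r → 2 + (0) + (1 + r) ≡ 3 + r + (0)} solve-∀ r))) (big y (r + 1) (lin (z≤n {0}) 2 (id {A = ∀ r → r + 1 + (0) + 2 ≡ 3 + r + (0)} solve-∀ r)))
               (≤-trans (lin (z≤n {0}) (2 + r) (id {A = ∀ r → r + 2 + 2 + (0) + (2 + r) ≡ (3 + r) + (3 + r) + (0)} solve-∀ r)) (+-mono-≤ (big f _ ≤-refl) (big y _ ≤-refl))) })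
        (big u₁ _ (lin (z≤n {0}) 0 (id {A = ∀ r → r + 2 + 1 + (0) + 0 ≡ 3 + r + (0)} solve-∀ r))) (big u₂ _ (lin (z≤n {0}) 1 (id {A = ∀ r → r + 1 + 1 + (0) + 1 ≡ 3 + r + (0)} solve-∀ r))) (λ {v} _ → big v _ (lin (z≤n {0}) 2 (id {A = ∀ r → r + 1 + (0) + 2 ≡ 3 + r + (0)} solve-∀ r)))

    -- By the degree condition every vertex has at most one nonneighbour besides itself, so distinct
    -- nonadjacent pairs are disjoint. A second pair exists because the `k + 1` vertices other than
    -- `f` do not form a clique. With two pairs the demand at `u₁` is again exactly `k`.
    two-missing : ∀ {vs} → 4 ≤ k → Unique vs → length vs ≡ 2 + k → (∀ {v} → v ∈ vs → k ≤ length (nbrs v vs)) →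
                  Colourable L vs
    two-missing {vs} 4≤k vs! len mindeg with clique-or-pair vs vs!
    ... | inj₁ [] = case len of λ ()
    ... | inj₁ (_ ∷ c) = contradiction (suc-injective len) (noclique c)
    ... | inj₂ (f , y , f∈ , y∈ , f≢y , f≁y)
      with pick (f ∷ []) vs! ([] ∷ []) (λ { (here refl) → f∈ })
    ... | R₀ , f∷R₀! , vs⊆₀ , R₀⊆ , l₀ with clique-or-pair R₀ (Unique-tail f∷R₀!)
    ... | inj₁ c = contradiction (suc-injective (trans l₀ len)) (noclique c)
    ... | inj₂ (g , y′ , g∈₀ , y′∈₀ , g≢y′ , g≁y′) = finish
      where
      g∈ = R₀⊆ g∈₀
      y′∈ = R₀⊆ y′∈₀
      ≢f : ∀ {x} → x ∈ R₀ → f ≢ x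
      ≢f x∈ refl = Unique-head f∷R₀! x∈
      lone : ∀ {v a b} → v ∈ vs → a ∈ vs → b ∈ vs → v ≢ a → v ≢ b → a ≢ b → ¬ Adj v a → ¬ Adj v b → ⊥
      lone {v} {a} {b} v∈ a∈ b∈ v≢a v≢b a≢b na nb =
        (linᶜ ((mindeg v∈) ⊕ ≤-reflexive len ⊕ all) 0 (id {A = ∀ d k n → k + n + (3 + d) ≡ d + (2 + k) + n + suc 0} solve-∀ d k n))
        where
        n = length vs
        d = length (nbrs v vs)
        all : 3 + d ≤ n
        all = unique-⊆-length {xs = v ∷ a ∷ b ∷ nbrs v vs}
          (All.¬Any⇒All¬ _ (λ { (here e) → v≢a e ; (there (here e)) → v≢b e
                              ; (there (there q)) → adj-irrefl (proj₂ (∈-nbrs⁻ vs q)) }) ∷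
           All.¬Any⇒All¬ _ (λ { (here e) → a≢b e ; (there q) → na (proj₂ (∈-nbrs⁻ vs q)) }) ∷
           All.¬Any⇒All¬ _ (λ q → nb (proj₂ (∈-nbrs⁻ vs q))) ∷ Unique.filter⁺ (adj? v) vs!)
          λ { (here refl) → v∈ ; (there (here refl)) → a∈ ; (there (there (here refl))) → b∈
            ; (there (there (there q))) → proj₁ (∈-nbrs⁻ vs q) }
      y≢g : y ≢ g
      y≢g refl = lone y∈ f∈ y′∈ (f≢y ∘ sym) g≢y′ (≢f y′∈₀) (f≁y ∘ adj-sym) g≁y′
      y≢y′ : y ≢ y′
      y≢y′ refl = lone y∈ f∈ g∈ (f≢y ∘ sym) (g≢y′ ∘ sym) (≢f g∈₀) (f≁y ∘ adj-sym) (g≁y′ ∘ adj-sym)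
      finish : Colourable L vs
      finish with pick (f ∷ y ∷ g ∷ y′ ∷ []) vs!
                    ((f≢y ∷ ≢f g∈₀ ∷ ≢f y′∈₀ ∷ []) ∷ (y≢g ∷ y≢y′ ∷ []) ∷ (g≢y′ ∷ []) ∷ [] ∷ [])
                    (λ { (here refl) → f∈ ; (there (here refl)) → y∈ ; (there (there (here refl))) → g∈
                       ; (there (there (there (here refl)))) → y′∈ })
      ... | []          , _ , _ , _ , l = (linᶜ (4≤k ⊕ ≤-reflexive (sym l) ⊕ ≤-reflexive (sym len)) 1 (id {A = ∀ k n → 4 + n + (2 + k) ≡ k + (4 + 0) + n + suc 1} solve-∀ k n))
        where n = length vs
      ... | _ ∷ []      , _ , _ , _ , l = (linᶜ (4≤k ⊕ ≤-reflexive (sym l) ⊕ ≤-reflexive (sym len)) 0 (id {A = ∀ k n → 4 + n + (2 + k) ≡ k + (4 + 1) + n + suc 0} solve-∀ k n))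
        where n = length vs
      ... | u₁ ∷ u₂ ∷ R , H! , vs⊆ , _ , l = proj₁ sol , colours-⊆ vs⊆ (proj₂ sol)
        where
        r = length R
        k≡ : k ≡ 4 + r
        k≡ = suc-injective (suc-injective (trans (sym len) (sym l)))
        big : ∀ v n → n ≤ 4 + r → n ≤ length (L v)
        big v n h = ≤-trans h (≤-reflexive (trans (sym k≡) (sym (L≡ v))))
        sep : ∀ {f y} → ¬ Adj f y → Separated L r 2 (f , y)
        sep {f} {y} na = separated na (big f 3 (lin (z≤n {0}) (1 + r) (id {A = ∀ r → 3 + (0) + (1 + r) ≡ 4 + r + (0)} solve-∀ r))) (big y (r + 2) (lin (z≤n {0}) 2 (id {A = ∀ r → r + 2 + (0) + 2 ≡ 4 + r + (0)} solve-∀ r)))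
               (≤-trans (lin (z≤n {0}) (2 + r) (id {A = ∀ r → r + 2 + 4 + (0) + (2 + r) ≡ (4 + r) + (4 + r) + (0)} solve-∀ r)) (+-mono-≤ (big f _ ≤-refl) (big y _ ≤-refl)))
        sol : Colourable L (f ∷ y ∷ g ∷ y′ ∷ u₁ ∷ u₂ ∷ R)
        sol = pairs-colourable 2 L ((f , y) ∷ (g , y′) ∷ []) u₁ u₂ R ≤-refl H! (λ {v} _ → L! v)
          (λ { (here refl) → sep f≁y ; (there (here refl)) → sep g≁y′ })
          (big u₁ _ (lin (z≤n {0}) 0 (id {A = ∀ r → r + 2 + 2 + (0) + 0 ≡ 4 + r + (0)} solve-∀ r))) (big u₂ _ (lin (z≤n {0}) 1 (id {A = ∀ r → r + 1 + 2 + (0) + 1 ≡ 4 + r + (0)} solve-∀ r))) (λ {v} _ → big v _ (lin (z≤n {0}) 2 (id {A = ∀ r → r + 2 + (0) + 2 ≡ 4 + r + (0)} solve-∀ r)))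

  -- Saving colours at the last two vertices

  -- A pair of vertices coloured a and b blocks at most one colour of A.
  Saves : List ℕ → ℕ → ℕ → Set
  Saves A a b = ∃ λ c → ∀ {x} → x ∈ A → x ≡ a ⊎ x ≡ b → x ≡ c

  saves-≡ : ∀ {A a} → Saves A a a
  saves-≡ {a = a} = a , λ { _ (inj₁ e) → e ; _ (inj₂ e) → e }

  saves-ˡ : ∀ {A a b} → a ∉ A → Saves A a b
  saves-ˡ {b = b} a∉ = b , λ { x∈ (inj₁ refl) → contradiction x∈ a∉ ; _ (inj₂ e) → e }

  saves-ʳ : ∀ {A a b} → b ∉ A → Saves A a b
  saves-ʳ {a = a} b∉ = a , λ { _ (inj₁ e) → e ; x∈ (inj₂ refl) → contradiction x∈ b∉ }

  common? : ∀ X Y → (∃ λ c → c ∈ X × c ∈ Y) ⊎ (∀ {c} → c ∈ X → c ∉ Y)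
  common? X Y with any? (Colour._∈? Y) X
  ... | yes p = inj₁ (find p)
  ... | no ¬p = inj₂ λ c∈ c∈′ → ¬p (lose c∈ c∈′)

  missing? : ∀ X A → (∃ λ c → c ∈ X × c ∉ A) ⊎ X ⊆ A
  missing? X A with any? (λ c → ¬? (c Colour.∈? A)) X
  ... | yes p = inj₁ (find p)
  ... | no ¬p = inj₂ λ {c} c∈ → case c Colour.∈? A of λ { (yes q) → q ; (no ¬q) → contradiction (lose c∈ ¬q) ¬p }

  -- If `X` and `Y` have no common colour, they do not both fit into `A`, and a colour outside `A`
  -- blocks nothing.
  save₁ : ∀ {X Y A} → Unique X → Unique Y → 0 < length X → 0 < length Y → length A < length X + length Y →
          ∃ λ a → ∃ λ b → a ∈ X × b ∈ Y × Saves A a b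
  save₁ {X} {Y} {A} X! Y! 0<X 0<Y lt with common? X Y
  ... | inj₁ (c , c∈ , c∈′) = c , c , c∈ , c∈′ , saves-≡
  ... | inj₂ dis with Colour.∃∉ A (unique-++ X! Y! dis) (subst (length A <_) (sym (length-++ X)) lt)
  ... | c , c∈ , c∉ with ∈-++⁻ X c∈
  ... | inj₁ c∈X = let d , d∈ = nonempty Y 0<Y in c , d , c∈X , d∈ , saves-ˡ c∉
  ... | inj₂ c∈Y = let d , d∈ = nonempty X 0<X in d , c , d∈ , c∈Y , saves-ʳ c∉

  full : ∀ {X A : List ℕ} {c} → Unique X → X ⊆ A → length A ≡ length X → c ∉ X → c ∉ A
  full X! X⊆ e c∉ c∈ = contradiction
    (≤-trans (unique-⊆-length (All.¬Any⇒All¬ _ c∉ ∷ X!) λ { (here refl) → c∈ ; (there q) → X⊆ q }) (≤-reflexive e)) (n≮n _)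

  -- Equal lengths matter when `X` and `Y` are disjoint: by `full`, `X ⊆ A` makes them the same set,
  -- so that no colour of `Y` lies in `A`; likewise `Y ⊆ A′` keeps `X` away from `A′`. If an
  -- inclusion fails, a colour that witnesses this saves at that list.
  save₂ : ∀ {k X Y A A′} → Unique X → Unique Y → 0 < k → length X ≡ k → length Y ≡ k → length A ≡ k → length A′ ≡ k →
          ∃ λ a → ∃ λ b → a ∈ X × b ∈ Y × Saves A a b × Saves A′ a b
  save₂ {k} {X} {Y} {A} {A′} X! Y! 0<k X≡ Y≡ A≡ A′≡ with common? X Y
  ... | inj₁ (c , c∈ , c∈′) = c , c , c∈ , c∈′ , saves-≡ , saves-≡
  ... | inj₂ dis with missing? X A | missing? Y A′
  ... | inj₁ (c , c∈ , c∉) | inj₁ (d , d∈ , d∉) = c , d , c∈ , d∈ , saves-ˡ c∉ , saves-ʳ d∉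
  ... | inj₁ (c , c∈ , c∉) | inj₂ Y⊆A′ =
    let d , d∈ = nonempty Y (subst (0 <_) (sym Y≡) 0<k)
    in c , d , c∈ , d∈ , saves-ˡ c∉ , saves-ˡ (full Y! Y⊆A′ (trans A′≡ (sym Y≡)) (dis c∈))
  ... | inj₂ X⊆A | m = second m
    where
    c∈X = nonempty X (subst (0 <_) (sym X≡) 0<k)
    d∈Y = nonempty Y (subst (0 <_) (sym Y≡) 0<k)
    Y∉A : ∀ {d} → d ∈ Y → d ∉ A
    Y∉A d∈ = full X! X⊆A (trans A≡ (sym X≡)) λ d∈X → dis d∈X d∈
    second : (∃ λ d → d ∈ Y × d ∉ A′) ⊎ Y ⊆ A′ → ∃ λ a → ∃ λ b → a ∈ X × b ∈ Y × Saves A a b × Saves A′ a b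
    second (inj₁ (d , d∈ , d∉)) = let c , c∈ = c∈X in c , d , c∈ , d∈ , saves-ʳ (Y∉A d∈) , saves-ʳ d∉
    second (inj₂ Y⊆A′) = let c , c∈ = c∈X ; d , d∈ = d∈Y in
      c , d , c∈ , d∈ , saves-ʳ (Y∉A d∈) , saves-ˡ (full Y! Y⊆A′ (trans A′≡ (sym Y≡)) (dis c∈))

  -- A degeneracy order read from the right: `P` is coloured beforehand, then `os`, then `o`.
  data Sparse (k : ℕ) (P : List V) : List V → Set where
    []  : Sparse k P []
    _∷_ : ∀ {o os} → length (nbrs o (os ++ P)) < k → Sparse k P os → Sparse k P (o ∷ os)

  module _ {k : ℕ} {L : V → List ℕ} (L! : ∀ v → Unique (L v)) (L≡ : ∀ v → length (L v) ≡ k)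
           (deg : ∀ {v ns} → Unique ns → (∀ {u} → u ∈ ns → Adj v u) → length ns ≤ suc k) where

    greedy-list : ∀ {P φ} O → Colours L P φ → Unique (O ++ P) → Sparse k P O →
                  ∃ λ φ′ → Colours L (O ++ P) φ′ × (∀ {a} → a ∈ P → φ′ a ≡ φ a)
    greedy-list [] col _ _ = _ , col , λ _ → refl
    greedy-list {P} (o ∷ O) col (o∉ ∷ O!) (few ∷ sp) with greedy-list O col O! sp
    ... | φ₁ , col₁ , same₁ with greedy col₁ (λ q → All.lookup o∉ q refl) (L! o) (subst (_ <_) (sym (L≡ o)) few)
    ... | φ₂ , col₂ , same₂ = φ₂ , col₂ , λ a∈ → trans (same₂ (∈-++⁺ʳ O a∈)) (same₁ a∈)

    -- Of the at most `k + 1` neighbours of `w`, two are `u` and `u′`, which are still uncoloured.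
    inner-sparse : ∀ {u u′ P} I → u ≢ u′ → Unique (I ++ P) → u ∉ I ++ P → u′ ∉ I ++ P →
                   (∀ {w} → w ∈ I → Adj w u × Adj w u′) → Sparse k P I
    inner-sparse [] _ _ _ _ _ = []
    inner-sparse {u} {u′} {P} (w ∷ I) u≢u′ (w∉ ∷ I!) u∉ u′∉ adj =
      s≤s⁻¹ (deg (((u≢u′ ∷ All.¬Any⇒All¬ _ (λ q → u∉ (there (proj₁ (∈-nbrs⁻ (I ++ P) q)))))) ∷
             All.¬Any⇒All¬ _ (λ q → u′∉ (there (proj₁ (∈-nbrs⁻ (I ++ P) q)))) ∷ Unique.filter⁺ (adj? w) I!)
        λ { (here refl) → proj₁ (adj (here refl)) ; (there (here refl)) → proj₂ (adj (here refl))
          ; (there (there q)) → proj₂ (∈-nbrs⁻ (I ++ P) q) })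
      ∷ inner-sparse I u≢u′ I! (u∉ ∘ there) (u′∉ ∘ there) (adj ∘ there)

    precolour : ∀ {u u′ p s q e} → let P = p ∷ s ∷ q ∷ e ∷ [] in 5 ≤ k → Unique P → ¬ Adj p s → ¬ Adj q e →
      ∃ λ φ → Colours L P φ × Saves (L u) (φ p) (φ s) × Saves (L u′) (φ p) (φ s) × Saves (L u) (φ q) (φ e)
    precolour {u} {u′} {p} {s} {q} {e} 5≤k P! p≁s q≁e
      with save₂ (L! p) (L! s) (≤-trans (s≤s z≤n) 5≤k) (L≡ p) (L≡ s) (L≡ u) (L≡ u′)
    ... | cp , cs , cp∈ , cs∈ , save-u , save-u′
      -- With the colours of `p` and `s` struck out, the second pair cannot clash with the first.
      -- The two lists keep `2 (k − 2)` colours between them, which exceeds `k` because `k ≥ 5`.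
      with save₁ {A = L u} (Colour.unique-∖ (cp ∷ cs ∷ []) (L! q)) (Colour.unique-∖ (cp ∷ cs ∷ []) (L! e))
             (positive q) (positive e) (≤-trans (≤-reflexive (cong suc (L≡ u))) enough)
      where
      X = L q Colour.∖ (cp ∷ cs ∷ [])
      Y = L e Colour.∖ (cp ∷ cs ∷ [])
      left : ∀ v → k ≤ length (L v Colour.∖ (cp ∷ cs ∷ [])) + 2
      left v = subst (_≤ _) (L≡ v) (Colour.length-∖ (cp ∷ cs ∷ []) (L! v))
      positive : ∀ v → 0 < length (L v Colour.∖ (cp ∷ cs ∷ []))
      positive v = (lin ((left v) ⊕ 5≤k) 2 (id {A = ∀ k x → suc (0) + ((x + 2) + k) + 2 ≡ x + (k + 5)} solve-∀ k x))
        where x = length (L v Colour.∖ (cp ∷ cs ∷ []))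
      enough : suc k ≤ length X + length Y
      enough = (lin ((left q) ⊕ (left e) ⊕ 5≤k) 0 (id {A = ∀ k x y → suc k + ((x + 2) + (y + 2) + k) + 0 ≡ x + y + (k + k + 5)} solve-∀ k x y))
        where
        x = length X
        y = length Y
    ... | cq , ce , cq∈ , ce∈ , save′-u = φ₀ , col₀ ,
        subst₂ (Saves (L u)) (sym 0p) (sym 0s) save-u , subst₂ (Saves (L u′)) (sym 0p) (sym 0s) save-u′ ,
        subst₂ (Saves (L u)) (sym 0q) (sym 0e) save′-u
      where
      p∉ : p ∉ s ∷ q ∷ e ∷ []
      p∉ = Unique-head P!
      s∉ : s ∉ q ∷ e ∷ []
      s∉ = Unique-head (Unique-tail P!)
      q∉ : q ∉ e ∷ []
      q∉ = Unique-head (Unique-tail (Unique-tail P!))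
      avoid : ∀ {v c} → c ∈ L v Colour.∖ (cp ∷ cs ∷ []) → c ∈ L v × c ≢ cp × c ≢ cs
      avoid {v} c∈ with Colour.∈-∖⁻ (L v) (cp ∷ cs ∷ []) c∈
      ... | c∈L , c∉ = c∈L , (λ { refl → c∉ (here refl) }) , λ { refl → c∉ (there (here refl)) }
      φe φq φs φ₀ : V → ℕ
      -- The value 0 is a placeholder at vertices not yet coloured.
      φe = (λ _ → 0) [ e ↦ ce ]
      φq = φe [ q ↦ cq ]
      φs = φq [ s ↦ cs ]
      φ₀ = φs [ p ↦ cp ]
      qe : φq e ≡ ce
      qe = trans (update-≢ φe cq λ { refl → q∉ (here refl) }) (update-≡ (λ _ → 0) ce)
      se : φs e ≡ ce
      se = trans (update-≢ φq cs λ { refl → s∉ (there (here refl)) }) qe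
      sq : φs q ≡ cq
      sq = trans (update-≢ φq cs λ { refl → s∉ (here refl) }) (update-≡ φe cq)
      0p : φ₀ p ≡ cp
      0p = update-≡ φs cp
      0s : φ₀ s ≡ cs
      0s = trans (update-≢ φs cp λ { refl → p∉ (here refl) }) (update-≡ φq cs)
      0q : φ₀ q ≡ cq
      0q = trans (update-≢ φs cp λ { refl → p∉ (there (here refl)) }) sq
      0e : φ₀ e ≡ ce
      0e = trans (update-≢ φs cp λ { refl → p∉ (there (there (here refl))) }) se
      col₁ : Colours L (e ∷ []) φe
      col₁ = extend ((λ ()) , λ ()) (proj₁ (avoid {e} ce∈)) (λ ())
      col₂ : Colours L (q ∷ e ∷ []) φq
      col₂ = extend col₁ (proj₁ (avoid {q} cq∈)) λ { (here refl) a → contradiction a q≁e }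
      col₃ : Colours L (s ∷ q ∷ e ∷ []) φs
      col₃ = extend col₂ cs∈ λ
        { (here refl) _ eq → proj₂ (proj₂ (avoid {q} cq∈)) (trans (sym (update-≡ φe cq)) eq)
        ; (there (here refl)) _ eq → proj₂ (proj₂ (avoid {e} ce∈)) (trans (sym qe) eq) }
      col₀ : Colours L (p ∷ s ∷ q ∷ e ∷ []) φ₀
      col₀ = extend col₃ cp∈ λ
        { (here refl) a → contradiction a p≁s
        ; (there (here refl)) _ eq → proj₁ (proj₂ (avoid {q} cq∈)) (trans (sym sq) eq)
        ; (there (there (here refl))) _ eq → proj₁ (proj₂ (avoid {e} ce∈)) (trans (sym se) eq) }

    -- All of `D` is charged only the colours in `cs`; neighbours outside `D` are charged one colour
    -- each.
    extend-saving : ∀ {X φ w} D cs → Colours L X φ → w ∉ X → (∀ {x} → x ∈ D → φ x ∈ L w → φ x ∈ cs) →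
      length cs + length (nbrs w (X ∖ D)) < k → ∃ λ φ′ → Colours L (w ∷ X) φ′ × (∀ {x} → x ∈ X → φ′ x ≡ φ x)
    extend-saving {X} {φ} {w} D cs col w∉ block few
      with Colour.∃∉ (cs ++ map φ (nbrs w (X ∖ D))) (L! w)
             (subst₂ _<_ (sym (trans (length-++ cs) (cong (length cs +_) (length-map φ (nbrs w (X ∖ D)))))) (sym (L≡ w)) few)
    ... | d , d∈ , d∉ = φ [ w ↦ d ] , extend col d∈ ok , λ x∈ → update-≢ φ d λ { refl → w∉ x∈ }
      where
      ok : ∀ {x} → x ∈ X → Adj w x → φ x ≢ d
      ok {x} x∈ a refl with x ∈? D
      ... | yes x∈D = d∉ (∈-++⁺ˡ (block x∈D d∈))
      ... | no  x∉D = d∉ (∈-++⁺ʳ cs (∈-map⁺ φ (∈-nbrs⁺ (∈-∖⁺ x∈ x∉D) a)))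

    nbrs-∖-bound : ∀ {w X} D → Unique D → Unique X → (∀ {x} → x ∈ D → Adj w x) →
      ∀ E → Unique (E ++ D) → (∀ {x} → x ∈ E → Adj w x) → (∀ {x} → x ∈ E → x ∉ X) →
      length (E ++ D) + length (nbrs w (X ∖ D)) ≤ suc k
    nbrs-∖-bound {w} {X} D D! X! adjD E ED! adjE E∉ = subst (_≤ suc k) (length-++ (E ++ D)) (deg
      (unique-++ ED! (Unique.filter⁺ (adj? w) (unique-∖ D X!)) λ x∈ r → case ∈-++⁻ E x∈ of λ
        { (inj₁ q) → E∉ q (proj₁ (out r)) ; (inj₂ q) → proj₂ (out r) q })
      λ r → case ∈-++⁻ (E ++ D) r of λ
        { (inj₂ q) → proj₂ (∈-nbrs⁻ (X ∖ D) q)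
        ; (inj₁ q) → case ∈-++⁻ E q of λ { (inj₁ x∈) → adjE x∈ ; (inj₂ x∈) → adjD x∈ } })
      where
      out : ∀ {x} → x ∈ nbrs w (X ∖ D) → x ∈ X × x ∉ D
      out r = ∈-∖⁻ X D (proj₁ (∈-nbrs⁻ (X ∖ D) r))

    module Last (u u′ p s q e : V) (X : List V) (all! : Unique (u ∷ u′ ∷ X))
                (P⊆X : p ∷ s ∷ q ∷ e ∷ [] ⊆ X) (P! : Unique (p ∷ s ∷ q ∷ e ∷ [])) where

      P : List V
      P = p ∷ s ∷ q ∷ e ∷ []

      colour-u′ : ∀ {φ} → Colours L X φ → Saves (L u′) (φ p) (φ s) → Adj u u′ → Adj u′ p → Adj u′ s →
        ∃ λ φ′ → Colours L (u′ ∷ X) φ′ × (∀ {x} → x ∈ X → φ′ x ≡ φ x)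
      colour-u′ {φ} col (c , save) u~u′ u′~p u′~s =
        extend-saving {X} {φ} {u′} (p ∷ s ∷ []) (c ∷ []) col (Unique-head (Unique-tail all!)) block few
        where
        u∉X : u ∉ X
        u∉X = Unique-head all! ∘ there
        block : ∀ {x} → x ∈ p ∷ s ∷ [] → φ x ∈ L u′ → φ x ∈ c ∷ []
        block (here refl)         c∈ = here (save c∈ (inj₁ refl))
        block (there (here refl)) c∈ = here (save c∈ (inj₂ refl))
        p≢s : p ≢ s
        p≢s p≡s = Unique-head P! (here p≡s)
        few : 1 + length (nbrs u′ (X ∖ (p ∷ s ∷ []))) < k
        -- Besides the pair `p`, `s`, which blocks one colour, the uncoloured `u` is among the at
        -- most `k + 1` neighbours: at most `1 + (k + 1 − 3)` colours are blocked, so one pair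
        -- suffices at `u′`.
        few = s≤s⁻¹ (nbrs-∖-bound {u′} {X} (p ∷ s ∷ []) ((p≢s ∷ []) ∷ [] ∷ []) (Unique-tail (Unique-tail all!))
          (λ { (here refl) → u′~p ; (there (here refl)) → u′~s }) (u ∷ [])
          (((λ { refl → u∉X (P⊆X (here refl)) }) ∷ (λ { refl → u∉X (P⊆X (there (here refl))) }) ∷ []) ∷ (p≢s ∷ []) ∷ [] ∷ [])
          (λ { (here refl) → adj-sym u~u′ }) (λ { (here refl) → u∉X }))

      colour-u : ∀ {φ} → Colours L (u′ ∷ X) φ → Saves (L u) (φ p) (φ s) → Saves (L u) (φ q) (φ e) →
        (∀ {x} → x ∈ P → Adj u x) → Colourable L (u ∷ u′ ∷ X)
      colour-u {φ} col (c₁ , save₁) (c₂ , save₂) u~P =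
        let φ′ , col′ , _ = extend-saving {u′ ∷ X} {φ} {u} P (c₁ ∷ c₂ ∷ []) col (Unique-head all!) block few in φ′ , col′
        where
        block : ∀ {x} → x ∈ P → φ x ∈ L u → φ x ∈ c₁ ∷ c₂ ∷ []
        block (here refl)                         c∈ = here (save₁ c∈ (inj₁ refl))
        block (there (here refl))                 c∈ = here (save₁ c∈ (inj₂ refl))
        block (there (there (here refl)))         c∈ = there (here (save₂ c∈ (inj₁ refl)))
        block (there (there (there (here refl)))) c∈ = there (here (save₂ c∈ (inj₂ refl)))
        few : 2 + length (nbrs u ((u′ ∷ X) ∖ P)) < k
        -- No neighbour is left uncoloured now, so both pairs are needed: at most `2 + (k + 1 − 4)`
        -- colours are blocked.
        few = s≤s⁻¹ (nbrs-∖-bound {u} {u′ ∷ X} P P! (Unique-tail all!) u~P [] P! (λ ()) (λ ()))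

    -- Brooks-style ordering: u and u′ come last, and the colours of the two
    -- nonadjacent pairs (p , s), (q , e) are chosen first so as to block at most
    -- two colours at u, and at most one colour of (p , s) at u′.
    config : ∀ {vs} u u′ p s q e O I → let P = p ∷ s ∷ q ∷ e ∷ [] in 5 ≤ k →
      Unique (u ∷ u′ ∷ I ++ O ++ P) → vs ⊆ u ∷ u′ ∷ I ++ O ++ P → Sparse k P O →
      (∀ {w} → w ∈ I → Adj w u × Adj w u′) → Adj u u′ → (∀ {x} → x ∈ P → Adj u x) → Adj u′ p → Adj u′ s →
      ¬ Adj p s → ¬ Adj q e → Colourable L vs
    config {vs} u u′ p s q e O I 5≤k all! vs⊆ sparse inner u~u′ u~P u′~p u′~s p≁s q≁e =
      let φ₀ , col₀ , save-u , save-u′ , save′-u = precolour {u} {u′} 5≤k P! p≁s q≁e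
          φ₁ , col₁ , same₁ = greedy-list O col₀ OP! sparse
          φ₂ , col₂ , same₂ = greedy-list I col₁ X! sparse′
          to₂ = λ {x} (x∈ : x ∈ P) → sym (trans (same₂ (∈-++⁺ʳ O x∈)) (same₁ x∈))
          φ₃ , col₃ , same₃ = colour-u′ {φ₂} col₂ (subst₂ (Saves (L u′)) (to₂ (here refl)) (to₂ (there (here refl))) save-u′) u~u′ u′~p u′~s
          to₃ = λ {x} (x∈ : x ∈ P) → trans (to₂ x∈) (sym (same₃ (P⊆X x∈)))
          φ₄ , col₄ = colour-u {φ₃} col₃ (subst₂ (Saves (L u)) (to₃ (here refl)) (to₃ (there (here refl))) save-u)
                        (subst₂ (Saves (L u)) (to₃ (there (there (here refl)))) (to₃ (there (there (there (here refl))))) save′-u) u~P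
      in φ₄ , colours-⊆ {L = L} vs⊆ col₄
      where
      P = p ∷ s ∷ q ∷ e ∷ []
      X = I ++ O ++ P
      X! : Unique X
      X! = Unique-tail (Unique-tail all!)
      OP! : Unique (O ++ P)
      OP! = Unique-++ʳ I X!
      P! : Unique P
      P! = Unique-++ʳ O OP!
      P⊆X : P ⊆ X
      P⊆X = ∈-++⁺ʳ I ∘ ∈-++⁺ʳ O
      sparse′ : Sparse k (O ++ P) I
      sparse′ = inner-sparse {u} {u′} I (λ { refl → Unique-head all! (here refl) }) X! (Unique-head all! ∘ there)
                  (Unique-head (Unique-tail all!)) inner
      open Last u u′ p s q e X all! P⊆X P! using (colour-u′; colour-u)

  -- Cliques of consecutive vertices on the circle

  -- The vertices of vs are numbered clockwise by ℕ with period n; Cl i j says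
  -- that positions i, …, j carry a clique.
  record Cl (val : ℕ → V) (i j : ℕ) : Set where
    constructor clique
    field
      on : ∀ {a b} → i ≤ a → a < b → b ≤ j → Adj (val a) (val b)

  open Cl

  module Around
    {k n : ℕ} {vs : List V} {L : V → List ℕ} (val : ℕ → V) (vs! : Unique vs)
    (L! : ∀ v → Unique (L v)) (L≡ : ∀ v → length (L v) ≡ k)
    (deg : ∀ {v ns} → Unique ns → (∀ {u} → u ∈ ns → Adj v u) → length ns ≤ suc k)
    (mindeg : ∀ {v} → v ∈ vs → k ≤ length (nbrs v vs))
    (outside : ∀ {H v} → v ∈ H → v ∈ vs → Colourable L (vs ∖ H))
    (n≥ : 3 + k ≤ n)
    (val∈ : ∀ i → val i ∈ vs)
    (periodic : ∀ i → val (n + i) ≡ val i)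
    (distinct : ∀ {i j} → i < j → j < n + i → val i ≢ val j)
    (cover : ∀ {v} s → v ∈ vs → ∃ λ t → s ≤ t × t < n + s × val t ≡ v)
    (arc : ∀ {i j} → i < j → j < n + i → Adj (val i) (val j) → Cl val i j ⊎ Cl val j (n + i))
    where

    E : ℕ → ℕ → Set
    E i j = Adj (val i) (val j)

    C : ℕ → ℕ → Set
    C = Cl val

    C? : ∀ i j → Dec (C i j)
    C? i j with allUpTo? (λ b → allUpTo? (λ a → (i Data.Nat.≤? a) →-dec adj? (val a) (val b)) b) (suc j)
    ... | yes h = yes (clique λ i≤a a<b b≤j → h (s≤s b≤j) a<b i≤a)
    ... | no ¬h = no λ c → ¬h λ b<j a<b i≤a → on c i≤a a<b (s≤s⁻¹ b<j)

    C-mono : ∀ {i i′ j j′} → i ≤ i′ → j′ ≤ j → C i j → C i′ j′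
    C-mono i≤ j≤ c = clique λ i≤a a<b b≤j → on c (≤-trans i≤ i≤a) a<b (≤-trans b≤j j≤)

    E-up : ∀ {a b} → E a b → E (n + a) (n + b)
    E-up {a} {b} = subst₂ Adj (sym (periodic a)) (sym (periodic b))

    E-down : ∀ {a b} → E (n + a) (n + b) → E a b
    E-down {a} {b} = subst₂ Adj (periodic a) (periodic b)

    C-up : ∀ {i j} → C i j → C (n + i) (n + j)
    C-up {i} {j} c = clique up
      where
      up : ∀ {a b} → n + i ≤ a → a < b → b ≤ n + j → E a b
      up i≤a a<b b≤j with m≤n⇒∃[o]m+o≡n (≤-trans (m≤m+n n i) i≤a)
                        | m≤n⇒∃[o]m+o≡n (≤-trans (≤-trans (m≤m+n n i) i≤a) (<⇒≤ a<b))
      ... | a′ , refl | b′ , refl = E-up (on c (+-cancelˡ-≤ n _ _ i≤a) (+-cancelˡ-< n _ _ a<b) (+-cancelˡ-≤ n _ _ b≤j))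

    C-down : ∀ {i j} → C (n + i) (n + j) → C i j
    C-down c = clique λ i≤a a<b b≤j → E-down (on c (+-monoʳ-≤ n i≤a) (+-monoʳ-< n a<b) (+-monoʳ-≤ n b≤j))

    abstract
      seg : ℕ → ℕ → List V
      seg i zero    = []
      seg i (suc d) = val i ∷ seg (suc i) d

      length-seg : ∀ i d → length (seg i d) ≡ d
      length-seg i zero    = refl
      length-seg i (suc d) = cong suc (length-seg (suc i) d)

      ∈-seg⁻ : ∀ {v} i d → v ∈ seg i d → ∃ λ t → i ≤ t × t < d + i × v ≡ val t
      ∈-seg⁻ i (suc d) (here refl) = i , ≤-refl , s≤s (m≤n+m i d) , refl
      ∈-seg⁻ i (suc d) (there q) with ∈-seg⁻ (suc i) d q
      ... | t , i<t , t< , e = t , <⇒≤ i<t , subst (t <_) (+-suc d i) t< , e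

      ∈-seg⁺ : ∀ {t} i d → i ≤ t → t < d + i → val t ∈ seg i d
      ∈-seg⁺ i zero i≤t t< = contradiction i≤t (<⇒≱ t<)
      ∈-seg⁺ {t} i (suc d) i≤t t< with i Data.Nat.≟ t
      ... | yes refl = here refl
      ... | no i≢t   = there (∈-seg⁺ (suc i) d (≤∧≢⇒< i≤t i≢t) (subst (t <_) (sym (+-suc d i)) t<))

      before∉seg : ∀ {s} i d → s < i → d + i ≤ n + s → val s ∉ seg i d
      before∉seg i d s<i d≤ q with ∈-seg⁻ i d q
      ... | t , i≤t , t< , e = distinct (≤-trans s<i i≤t) (≤-trans t< d≤) e

      after∉seg : ∀ {s} i d → d + i ≤ s → s < n + i → val s ∉ seg i d
      after∉seg i d d≤s s< q with ∈-seg⁻ i d q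
      ... | t , i≤t , t< , e = distinct (≤-trans t< d≤s) (≤-trans s< (+-monoʳ-≤ n i≤t)) (sym e)

      seg-unique : ∀ i d → d ≤ n → Unique (seg i d)
      seg-unique i zero    d≤n = []
      seg-unique i (suc d) d≤n =
        All.¬Any⇒All¬ _ (before∉seg (suc i) d ≤-refl (subst (_≤ n + i) (sym (+-suc d i)) (+-monoˡ-≤ i d≤n)))
        ∷ seg-unique (suc i) d (<⇒≤ d≤n)

    seg-adj : ∀ {s} i d → (∀ {t} → i ≤ t → t < d + i → E s t) → ∀ {u} → u ∈ seg i d → Adj (val s) u
    seg-adj i d h q with ∈-seg⁻ i d q
    ... | t , i≤t , t< , refl = h i≤t t<

    seg-clique : ∀ i d j → d + i ≤ suc j → C i j → IsClique (seg i d)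
    seg-clique i d j d≤ c p q a≢b with ∈-seg⁻ i d p | ∈-seg⁻ i d q
    ... | s , i≤s , s< , refl | t , i≤t , t< , refl with <-cmp s t
    ... | tri< s<t _ _ = on c i≤s s<t (s≤s⁻¹ (≤-trans t< d≤))
    ... | tri≈ _ refl _ = contradiction refl a≢b
    ... | tri> _ _ t<s = adj-sym (on c i≤t t<s (s≤s⁻¹ (≤-trans s< d≤)))

    -- `val i` would be adjacent to all other vertices, and `n ≥ k + 3` makes these at least
    -- `k + 2`. Hence an edge cannot bound cliques on both of its sides.
    no-universal : ∀ {i j} → C i j → C (suc j) (n + i) → ⊥
    no-universal {i} {j} c c′ =
      contradiction (deg (seg-unique (suc i) (2 + k) (lin n≥ 1 (id {A = ∀ k n → 2 + k + (n) + 1 ≡ n + (3 + k)} solve-∀ k n))) (seg-adj {i} (suc i) (2 + k) adj))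
        (<⇒≱ (subst (suc k <_) (sym (length-seg (suc i) (2 + k))) ≤-refl))
      where
      adj : ∀ {t} → suc i ≤ t → t < 2 + k + suc i → E i t
      adj {t} i<t t< with t Data.Nat.≤? j
      ... | yes t≤j = on c ≤-refl i<t t≤j
      ... | no  t≰j = subst (λ v → Adj v (val t)) (periodic i)
            (adj-sym (on c′ (≰⇒> t≰j) (lin (t< ⊕ n≥) 0 (id {A = ∀ i k n t → suc (t) + ((2 + k + suc i) + n) + 0 ≡ n + i + ((suc (t)) + (3 + k))} solve-∀ i k n t)) ≤-refl))

    -- Since the clique on the near side is excluded, an edge would give one on the far side;
    -- together with `C a b` it makes `val a` adjacent to every vertex.
    nonadjacent-right : ∀ {a b} → a ≤ b → suc b < n + a → C a b → ¬ C a (suc b) → ¬ E a (suc b)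
    nonadjacent-right a≤b b< c ¬c e with arc (s≤s a≤b) b< e
    ... | inj₁ c′ = ¬c c′
    ... | inj₂ c′ = no-universal c c′

    nonadjacent-left : ∀ {a b} → a < b → b < n + a → C (suc a) b → ¬ C a b → ¬ E a b
    nonadjacent-left {a} {b} a<b b< c ¬c e with arc a<b b< e
    ... | inj₁ c′ = ¬c c′
    ... | inj₂ c′ = no-universal c′ (subst (λ i → C i (n + b)) (+-suc n a) (C-up c))

    -- By `arc`, a neighbour beyond `z` yields a clique that contains the positions from `y` to
    -- `suc z`, or, one turn later, those from `w` to `y`.
    nbr-within : ∀ {w y z u} → suc w ≤ y → y ≤ z → z < n + w → ¬ C y (suc z) → ¬ C w y →
                 u ∈ vs → Adj (val y) u → ∃ λ t → suc w ≤ t × t ≤ z × u ≡ val t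
    nbr-within {w} {y} {z} w<y y≤z z< ¬r ¬l u∈ a with cover (suc w) u∈
    ... | t , w<t , t< , refl with t Data.Nat.≤? z
    ... | yes t≤z = t , w<t , t≤z , refl
    ... | no  t≰z with arc (≤-<-trans y≤z (≰⇒> t≰z)) (<-≤-trans t< (+-monoʳ-≤ n w<y)) a
    ... | inj₁ c = contradiction (C-mono ≤-refl (≰⇒> t≰z) c) ¬r
    ... | inj₂ c = contradiction (C-down (C-mono (s≤s⁻¹ (subst (t <_) (+-suc n w) t<)) ≤-refl c)) ¬l

    degree-within : ∀ {w y z} d → suc w ≤ y → y ≤ z → z < n + w → z ≡ suc w + d → ¬ C y (suc z) → ¬ C w y → k ≤ d
    degree-within {w} {y} {z} d w<y y≤z z< z≡ ¬r ¬l = s≤s⁻¹ (≤-trans (s≤s (mindeg (val∈ y)))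
      (subst (suc (length (nbrs (val y) vs)) ≤_) (length-seg (suc w) (suc d))
        (unique-⊆-length {xs = val y ∷ nbrs (val y) vs}
          (All.¬Any⇒All¬ _ (λ q → adj-irrefl (proj₂ (∈-nbrs⁻ vs q))) ∷ Unique.filter⁺ (adj? (val y)) vs!) sub)))
      where
      <end : ∀ {t} → t ≤ z → t < suc d + suc w
      <end {t} t≤z = s≤s (≤-trans t≤z (≤-reflexive (trans z≡ (+-comm (suc w) d))))
      sub : val y ∷ nbrs (val y) vs ⊆ seg (suc w) (suc d)
      sub (here refl) = ∈-seg⁺ (suc w) (suc d) w<y (<end y≤z)
      sub (there q) with ∈-nbrs⁻ vs q
      ... | u∈ , a with nbr-within w<y y≤z z< ¬r ¬l u∈ a
      ... | t , w<t , t≤z , refl = ∈-seg⁺ (suc w) (suc d) w<t (<end t≤z)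

    last-true : ∀ {P : ℕ → Set} → (∀ i → Dec (P i)) → ∀ a d → P a → ¬ P (d + a) →
                ∃ λ t → a ≤ t × t < d + a × P t × ¬ P (suc t)
    last-true P? a zero    pa ¬p = contradiction pa ¬p
    last-true P? a (suc d) pa ¬p with P? (d + a)
    ... | yes p = d + a , m≤n+m a d , ≤-refl , p , ¬p
    ... | no ¬q with last-true P? a d pa ¬q
    ... | t , a≤t , t< , p , ¬s = t , a≤t , m≤n⇒m≤1+n t< , p , ¬s

    last-false : ∀ {P : ℕ → Set} → (∀ i → Dec (P i)) → ∀ a d → ¬ P a → P (d + a) →
                 ∃ λ t → a ≤ t × t < d + a × ¬ P t × P (suc t)
    last-false P? a zero    ¬p pa = contradiction pa ¬p
    last-false P? a (suc d) ¬p pa with P? (d + a)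
    ... | no ¬q = d + a , m≤n+m a d , ≤-refl , ¬q , pa
    ... | yes q with last-false P? a d ¬p q
    ... | t , a≤t , t< , ¬t , s = t , a≤t , m≤n⇒m≤1+n t< , ¬t , s

    -- Large cliques of consecutive vertices

    -- K = {x, …, z} with x = 2 + a and z = 8 + r + a, so |K| = 7 + r.
    module NearMaximum (a r : ℕ) (7+r≤k : 7 + r ≤ k) (clq : C (2 + a) (8 + r + a)) (maximum : ∀ i → ¬ C i (7 + r + i)) where

      K : List V
      K = seg (2 + a) (7 + r)

      K-clique : IsClique K
      K-clique = seg-clique (2 + a) (7 + r) (8 + r + a) (lin (z≤n {0}) 0 (id {A = ∀ a r → 7 + r + (2 + a) + (0) + 0 ≡ 1 + (8 + r + a) + (0)} solve-∀ a r)) clq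

      n≥10+r : 10 + r ≤ n
      n≥10+r = ≤-trans (+-monoʳ-≤ 3 7+r≤k) n≥

      K! : Unique K
      K! = seg-unique (2 + a) (7 + r) (lin n≥10+r 3 (id {A = ∀ n r → 7 + r + (n) + 3 ≡ n + (10 + r)} solve-∀ n r))

      ∈K : ∀ {t} → 2 + a ≤ t → t ≤ 8 + r + a → val t ∈ K
      ∈K {t} ≤t t≤ = ∈-seg⁺ (2 + a) (7 + r) ≤t (lin t≤ 0 (id {A = ∀ a r t → suc (t) + (8 + r + a) + 0 ≡ 7 + r + (2 + a) + (t)} solve-∀ a r t))

      two-outs-at : ∀ f g {y y′ u₁ u₂} → val f ≢ val g → val f ∉ K → val g ∉ K →
        let D = val y ∷ val y′ ∷ val u₁ ∷ val u₂ ∷ [] in Unique D → D ⊆ K →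
        ¬ E f y → ¬ E g y′ → E f u₁ → E g u₁ → E f u₂ →
        ∀ ns → Unique ns → ns ⊆ val f ∷ val g ∷ K → (∀ {u} → u ∈ ns → Adj (val f) u) → 4 ≤ length ns → 5 ≤ length ns ⊎ E y g →
        ∀ ns′ → Unique ns′ → ns′ ⊆ val f ∷ val g ∷ K → (∀ {u} → u ∈ ns′ → Adj (val g) u) → 4 ≤ length ns′ → 5 ≤ length ns′ ⊎ E y′ f →
        Colourable L vs
      two-outs-at f g {y} {y′} {u₁} {u₂} f≢g f∉ g∉ D! D⊆ ¬fy ¬gy′ fu₁ gu₁ fu₂ ns ns! ns⊆ adj 4≤ alt ns′ ns′! ns′⊆ adj′ 4≤′ alt′
        with pick (val y ∷ val y′ ∷ val u₁ ∷ val u₂ ∷ []) K! D! D⊆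
      ... | R , DR! , K⊆ , R⊆ , _ = reduce L! L≡ deg H vs! (outside (here refl) (val∈ f)) λ L′ res →
        two-outs res H! (λ p q → K-clique (back p) (back q)) ¬fy ¬gy′ (adj-sym fu₁) (adj-sym gu₁) (adj-sym fu₂)
          ns ns! (forth ∘ ns⊆) adj 4≤ alt ns′ ns′! (forth ∘ ns′⊆) adj′ 4≤′ alt′
        where
        D = val y ∷ val y′ ∷ val u₁ ∷ val u₂ ∷ []
        H = val f ∷ val g ∷ D ++ R
        back : D ++ R ⊆ K
        back q = case ∈-++⁻ D q of λ { (inj₁ p) → D⊆ p ; (inj₂ p) → R⊆ p }
        forth : val f ∷ val g ∷ K ⊆ H
        forth (here p)          = here p
        forth (there (here p))  = there (here p)
        forth (there (there p)) = there (there (K⊆ p))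
        H! : Unique H
        H! = All.¬Any⇒All¬ _ (λ { (here p) → f≢g p ; (there p) → f∉ (back p) }) ∷ All.¬Any⇒All¬ _ (g∉ ∘ back) ∷ DR!

      one-out-at : ∀ f {y u₁ u₂} → k ≡ 7 + r → val f ∉ K →
        let D = val y ∷ val u₁ ∷ val u₂ ∷ [] in Unique D → D ⊆ K →
        ¬ E f y → E f u₂ → (∀ {u} → u ∈ vs → Adj (val u₁) u → u ∈ val f ∷ K) →
        ∀ ns → Unique ns → ns ⊆ val f ∷ K → (∀ {u} → u ∈ ns → Adj (val f) u) → 4 ≤ length ns →
        Colourable L vs
      one-out-at f {y} {u₁} {u₂} k≡ f∉ D! D⊆ ¬fy fu₂ inside ns ns! ns⊆ adj 4≤
        with pick (val y ∷ val u₁ ∷ val u₂ ∷ []) K! D! D⊆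
      ... | R , DR! , K⊆ , R⊆ , len = reduce L! L≡ deg H vs! (outside (here refl) (val∈ f)) λ L′ res →
        one-out res H! (λ p q → K-clique (back p) (back q)) (≤-reflexive (trans len (trans (length-seg (2 + a) (7 + r)) (sym k≡))))
          (λ u∈ a → forth (inside u∈ a)) ¬fy (adj-sym fu₂) ns ns! (forth ∘ ns⊆) adj 4≤
        where
        D = val y ∷ val u₁ ∷ val u₂ ∷ []
        H = val f ∷ D ++ R
        back : D ++ R ⊆ K
        back q = case ∈-++⁻ D q of λ { (inj₁ p) → D⊆ p ; (inj₂ p) → R⊆ p }
        forth : val f ∷ K ⊆ H
        forth (here p)  = here p
        forth (there p) = there (K⊆ p)
        H! : Unique H
        H! = All.¬Any⇒All¬ _ (f∉ ∘ back) ∷ DR!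

      too-long : ∀ {i j} → 7 + r + i ≤ j → ¬ C i j
      too-long {i} ≤j c = maximum i (C-mono ≤-refl ≤j c)

      ≢-near : ∀ {s t} → s < t → a ≤ s → t ≤ 9 + r + a → val s ≢ val t
      ≢-near {s} {t} s<t a≤s t≤ = distinct s<t (lin (n≥10+r ⊕ a≤s ⊕ t≤) 0 (id {A = ∀ a n r s t → suc (t) + (n + s + (9 + r + a)) + 0 ≡ n + s + ((10 + r) + a + t)} solve-∀ a n r s t))

      seg⊆K : ∀ i d → 2 + a ≤ i → d + i ≤ 9 + r + a → seg i d ⊆ K
      seg⊆K i d i≥ d≤ q with ∈-seg⁻ i d q
      ... | t , i≤t , t< , refl = ∈K (≤-trans i≥ i≤t) (s≤s⁻¹ (≤-trans t< d≤))

      seg₄! : ∀ i → Unique (seg i 4)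
      seg₄! i = seg-unique i 4 (lin n≥10+r (6 + r) (id {A = ∀ n r → 4 + (n) + (6 + r) ≡ n + (10 + r)} solve-∀ n r))

      before∉K : ∀ {s} → s < 2 + a → a ≤ s → val s ∉ K
      before∉K {s} s< a≤s = before∉seg (2 + a) (7 + r) s< (lin (n≥10+r ⊕ a≤s) 1 (id {A = ∀ a n r s → 7 + r + (2 + a) + (n + s) + 1 ≡ n + s + ((10 + r) + a)} solve-∀ a n r s))

      after∉K : ∀ {s} → 9 + r + a ≤ s → s ≤ 10 + r + a → val s ∉ K
      after∉K {s} ≤s s≤ = after∉seg (2 + a) (7 + r) (lin ≤s 0 (id {A = ∀ a r s → 7 + r + (2 + a) + (s) + 0 ≡ s + (9 + r + a)} solve-∀ a r s))
        (lin (n≥10+r ⊕ s≤) 1 (id {A = ∀ a n r s → suc (s) + (n + (10 + r + a)) + 1 ≡ n + (2 + a) + ((10 + r) + s)} solve-∀ a n r s))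

      aa : ∀ c d {_ : True (c Data.Nat.≤? d)} → c + a ≤ d + a
      aa c d {h} = +-monoˡ-≤ a (toWitness h)

      ar : ∀ c d {_ : True (c Data.Nat.≤? d)} → c + a ≤ d + r + a
      ar c d {h} = +-monoˡ-≤ a (≤-trans (toWitness h) (m≤m+n d r))

      rr : ∀ c d {_ : True (c Data.Nat.≤? d)} → c + r + a ≤ d + r + a
      rr c d {h} = +-monoˡ-≤ a (+-monoˡ-≤ r (toWitness h))

      first≁last : ¬ E (1 + a) (8 + r + a)
      first≁last = nonadjacent-left {1 + a} {8 + r + a} (ar 2 8) (lin n≥10+r 2 (id {A = ∀ a n r → suc (8 + r + a) + (n) + 2 ≡ n + (1 + a) + (10 + r)} solve-∀ a n r)) clq
        (too-long (lin (z≤n {0}) 0 (id {A = ∀ a r → 7 + r + (1 + a) + (0) + 0 ≡ 8 + r + a + (0)} solve-∀ a r)))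

      last≁first : ¬ E (9 + r + a) (2 + a)
      last≁first = nonadjacent-right {2 + a} {8 + r + a} (ar 2 8) (lin n≥10+r 2 (id {A = ∀ a n r → suc (9 + r + a) + (n) + 2 ≡ n + (2 + a) + (10 + r)} solve-∀ a n r)) clq
        (too-long (lin (z≤n {0}) 0 (id {A = ∀ a r → 7 + r + (2 + a) + (0) + 0 ≡ 9 + r + a + (0)} solve-∀ a r))) ∘ adj-sym

      4≤seg : ∀ i → 4 ≤ length (seg i 4)
      4≤seg i = ≤-reflexive (sym (length-seg i 4))

      distinct₄ : ∀ {i j k l} → i ≢ j → i ≢ k → i ≢ l → j ≢ k → j ≢ l → k ≢ l → Unique {A = V} (i ∷ j ∷ k ∷ l ∷ [])
      distinct₄ ij ik il jk jl kl = (ij ∷ ik ∷ il ∷ []) ∷ (jk ∷ jl ∷ []) ∷ (kl ∷ []) ∷ [] ∷ []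

      ∷-unique : ∀ {v} i → val v ∉ seg i 4 → Unique (val v ∷ seg i 4)
      ∷-unique i v∉ = All.¬Any⇒All¬ _ v∉ ∷ seg₄! i

      -- Each outer vertex is paired with the far end of `K`. That end is adjacent to the other
      -- outer vertex, so four neighbours suffice. Position `5 + a` is within reach of both outer
      -- vertices because `5 + a ≤ 5 + r + a`.
      two-sides : C (5 + a) (9 + r + a) → C (1 + a) (5 + r + a) → Colourable L vs
      two-sides cr cl = two-outs-at f g (≢-near (ar 2 9) (aa 0 1) (rr 9 9)) (before∉K (aa 2 2) (aa 0 1)) (after∉K (rr 9 9) (rr 9 10))
        (distinct₄ (≢-near (ar 3 8) (aa 0 2) (rr 8 9) ∘ sym) (≢-near (ar 6 8) (aa 0 5) (rr 8 9) ∘ sym)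
                   (≢-near (ar 4 8) (aa 0 3) (rr 8 9) ∘ sym) (≢-near (aa 3 5) (aa 0 2) (ar 5 9))
                   (≢-near (aa 3 3) (aa 0 2) (ar 3 9)) (≢-near (aa 4 5) (aa 0 3) (ar 5 9) ∘ sym))
        (λ { (here refl) → ∈K (ar 2 8) (rr 8 8) ; (there (here refl)) → ∈K (aa 2 2) (ar 2 8)
           ; (there (there (here refl))) → ∈K (aa 2 5) (ar 5 8) ; (there (there (there (here refl)))) → ∈K (aa 2 3) (ar 3 8) })
        first≁last last≁first
        (on cl (aa 1 1) (aa 2 5) (ar 5 5)) (adj-sym (on cr (aa 5 5) (ar 6 9) (rr 9 9))) (on cl (aa 1 1) (aa 2 3) (ar 3 5))
        (seg (2 + a) 4) (seg₄! (2 + a)) (λ q → there (there (seg⊆K (2 + a) 4 (aa 2 2) (ar 6 9) q)))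
        (seg-adj (2 + a) 4 λ i≤t t< → on cl (aa 1 1) i≤t (≤-trans (s≤s⁻¹ t<) (ar 5 5)))
        (4≤seg _) (inj₂ (on cr (ar 5 8) (rr 9 9) (rr 9 9)))
        (seg (5 + r + a) 4) (seg₄! (5 + r + a)) (λ q → there (there (seg⊆K (5 + r + a) 4 (ar 2 5) (rr 9 9) q)))
        (seg-adj (5 + r + a) 4 λ i≤t t< → adj-sym (on cr (≤-trans (ar 5 5) i≤t) t< (rr 9 9)))
        (4≤seg _) (inj₂ (adj-sym (on cl (aa 1 1) (aa 2 2) (ar 2 5))))
        where
        f = 1 + a
        g = 9 + r + a

      -- The two outer vertices are adjacent to each other and to the first four vertices of `K`,
      -- which gives each five neighbours in `H`. The clique starting at `a` breaks off before the
      -- last vertex of `K`, so the nonneighbour found there for `val a` differs from the one used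
      -- for `val (1 + a)`.
      two-left : C a (5 + a) → Colourable L vs
      two-left c with last-true (C? a) (5 + a) (2 + r) c (too-long (lin (z≤n {0}) 0 (id {A = ∀ a r → 7 + r + a + (0) + 0 ≡ 2 + r + (5 + a) + (0)} solve-∀ a r)))
      ... | t , 5≤t , t< , ct , ¬ct = two-outs-at a (1 + a) (≢-near (aa 1 1) (aa 0 0) (ar 1 9)) (before∉K (aa 1 2) (aa 0 0)) (before∉K (aa 2 2) (aa 0 1))
        (distinct₄ (≢-near y<8 (≤-trans (aa 0 6) (s≤s 5≤t)) (rr 8 9)) (≢-near (≤-trans (aa 3 6) (s≤s 5≤t)) (aa 0 2) (≤-trans (<⇒≤ y<8) (rr 8 9)) ∘ sym)
                   (≢-near (≤-trans (aa 4 6) (s≤s 5≤t)) (aa 0 3) (≤-trans (<⇒≤ y<8) (rr 8 9)) ∘ sym)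
                   (≢-near (ar 3 8) (aa 0 2) (rr 8 9) ∘ sym) (≢-near (ar 4 8) (aa 0 3) (rr 8 9) ∘ sym) (≢-near (aa 3 3) (aa 0 2) (ar 3 9)))
        (λ { (here refl) → ∈K (≤-trans (aa 2 6) (s≤s 5≤t)) (<⇒≤ y<8) ; (there (here refl)) → ∈K (ar 2 8) (rr 8 8)
           ; (there (there (here refl))) → ∈K (aa 2 2) (ar 2 8) ; (there (there (there (here refl)))) → ∈K (aa 2 3) (ar 3 8) })
        (nonadjacent-right (≤-trans (aa 0 5) 5≤t) (<-≤-trans y<8 (lin n≥10+r 2 (id {A = ∀ a n r → 8 + r + a + (n) + 2 ≡ n + a + (10 + r)} solve-∀ a n r))) ct ¬ct) first≁last
        (on c (aa 0 0) (aa 1 2) (aa 2 5)) (on c (aa 0 1) (aa 2 2) (aa 2 5)) (on c (aa 0 0) (aa 1 3) (aa 3 5))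
        (val (1 + a) ∷ seg (2 + a) 4) (∷-unique (2 + a) (before∉K (aa 2 2) (aa 0 1) ∘ sub)) (λ { (here p) → there (here p) ; (there q) → there (there (sub q)) })
        (λ { (here refl) → on c (aa 0 0) (aa 1 1) (aa 1 5) ; (there q) → seg-adj (2 + a) 4 (λ i≤t t< → on c (aa 0 0) (≤-trans (aa 1 2) i≤t) (s≤s⁻¹ t<)) q })
        (m≤n⇒m≤1+n (4≤seg _)) (inj₁ (s≤s (4≤seg _)))
        (val a ∷ seg (2 + a) 4) (∷-unique (2 + a) (before∉K (aa 1 2) (aa 0 0) ∘ sub)) (λ { (here p) → here p ; (there q) → there (there (sub q)) })
        (λ { (here refl) → adj-sym (on c (aa 0 0) (aa 1 1) (aa 1 5)) ; (there q) → seg-adj (2 + a) 4 (λ i≤t t< → on c (aa 0 1) i≤t (s≤s⁻¹ t<)) q })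
        (m≤n⇒m≤1+n (4≤seg _)) (inj₁ (s≤s (4≤seg _)))
        where
        sub : seg (2 + a) 4 ⊆ K
        sub = seg⊆K (2 + a) 4 (aa 2 2) (ar 6 9)
        y<8 : suc t < 8 + r + a
        y<8 = (lin t< 0 (id {A = ∀ a r t → suc (suc t) + (2 + r + (5 + a)) + 0 ≡ 8 + r + a + (suc (t))} solve-∀ a r t))

      two-right : C (5 + r + a) (10 + r + a) → Colourable L vs
      two-right c with last-false (λ t → C? t (10 + r + a)) (3 + a) (2 + r) (too-long (lin (z≤n {0}) 0 (id {A = ∀ a r → 7 + r + (3 + a) + (0) + 0 ≡ 10 + r + a + (0)} solve-∀ a r)))
                         (C-mono (lin (z≤n {0}) 0 (id {A = ∀ a r → 5 + r + a + (0) + 0 ≡ 2 + r + (3 + a) + (0)} solve-∀ a r)) ≤-refl c)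
      ... | t , 3≤t , t< , ¬ct , ct = two-outs-at (10 + r + a) (9 + r + a) (distinct (rr 10 10) (lin n≥10+r (8 + r) (id {A = ∀ a n r → suc (10 + r + a) + (n) + (8 + r) ≡ n + (9 + r + a) + (10 + r)} solve-∀ a n r)) ∘ sym)
        (after∉K (rr 9 10) (rr 10 10)) (after∉K (rr 9 9) (rr 9 10))
        (distinct₄ (≢-near 3≤t (aa 0 2) (≤-trans (<⇒≤ y<5) (rr 5 9)) ∘ sym) (≢-near (≤-trans y<5 (rr 5 8)) (≤-trans (aa 0 3) 3≤t) (rr 8 9))
                   (≢-near (≤-trans y<5 (rr 5 7)) (≤-trans (aa 0 3) 3≤t) (rr 7 9)) (≢-near (ar 3 8) (aa 0 2) (rr 8 9))
                   (≢-near (ar 3 7) (aa 0 2) (rr 7 9)) (≢-near (rr 8 8) (ar 0 7) (rr 8 9) ∘ sym))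
        (λ { (here refl) → ∈K (≤-trans (aa 2 3) 3≤t) (≤-trans (<⇒≤ y<5) (rr 5 8)) ; (there (here refl)) → ∈K (aa 2 2) (ar 2 8)
           ; (there (there (here refl))) → ∈K (ar 2 8) (rr 8 8) ; (there (there (there (here refl)))) → ∈K (ar 2 7) (rr 7 8) })
        (nonadjacent-left (≤-trans y<5 (rr 5 10)) (lin (n≥10+r ⊕ 3≤t) 2 (id {A = ∀ a n r t → suc (10 + r + a) + (n + t) + 2 ≡ n + t + ((10 + r) + (3 + a))} solve-∀ a n r t)) ct ¬ct ∘ adj-sym) last≁first
        (adj-sym (on c (rr 5 8) (rr 9 10) (rr 10 10))) (adj-sym (on c (rr 5 8) (rr 9 9) (rr 9 10))) (adj-sym (on c (rr 5 7) (rr 8 10) (rr 10 10)))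
        (val (9 + r + a) ∷ seg (5 + r + a) 4) (∷-unique (5 + r + a) (after∉K (rr 9 9) (rr 9 10) ∘ sub)) (λ { (here p) → there (here p) ; (there q) → there (there (sub q)) })
        (λ { (here refl) → adj-sym (on c (rr 5 9) (rr 10 10) (rr 10 10)) ; (there q) → seg-adj (5 + r + a) 4 (λ i≤t t< → adj-sym (on c i≤t (≤-trans t< (rr 9 10)) (rr 10 10))) q })
        (m≤n⇒m≤1+n (4≤seg _)) (inj₁ (s≤s (4≤seg _)))
        (val (10 + r + a) ∷ seg (5 + r + a) 4) (∷-unique (5 + r + a) (after∉K (rr 9 10) (rr 10 10) ∘ sub)) (λ { (here p) → here p ; (there q) → there (there (sub q)) })
        (λ { (here refl) → on c (rr 5 9) (rr 10 10) (rr 10 10) ; (there q) → seg-adj (5 + r + a) 4 (λ i≤t t< → adj-sym (on c i≤t t< (rr 9 10))) q })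
        (m≤n⇒m≤1+n (4≤seg _)) (inj₁ (s≤s (4≤seg _)))
        where
        sub : seg (5 + r + a) 4 ⊆ K
        sub = seg⊆K (5 + r + a) 4 (ar 2 5) (rr 9 9)
        y<5 : t < 5 + r + a
        y<5 = (lin t< 0 (id {A = ∀ a r t → suc (t) + (2 + r + (3 + a)) + 0 ≡ 5 + r + a + (suc (t))} solve-∀ a r t))

      -- The two negated hypotheses confine the neighbours of `val (5 + a)` to `K` and
      -- `val (1 + a)`, so it can play `u₁` in `one-out`.
      one-left : k ≡ 7 + r → C (1 + a) (5 + a) → ¬ C a (5 + a) → ¬ C (5 + a) (9 + r + a) → Colourable L vs
      one-left k≡ c ¬l ¬r = one-out-at (1 + a) k≡ (before∉K (aa 2 2) (aa 0 1))
        (((≢-near (ar 6 8) (aa 0 5) (rr 8 9) ∘ sym) ∷ (≢-near (ar 3 8) (aa 0 2) (rr 8 9) ∘ sym) ∷ []) ∷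
         ((≢-near (aa 3 5) (aa 0 2) (ar 5 9) ∘ sym) ∷ []) ∷ [] ∷ [])
        (λ { (here refl) → ∈K (ar 2 8) (rr 8 8) ; (there (here refl)) → ∈K (aa 2 5) (ar 5 8)
           ; (there (there (here refl))) → ∈K (aa 2 2) (ar 2 8) })
        first≁last (on c (aa 1 1) (aa 2 2) (aa 2 5)) inside
        (seg (2 + a) 4) (seg₄! _) (there ∘ seg⊆K (2 + a) 4 (aa 2 2) (ar 6 9))
        (seg-adj (2 + a) 4 λ i≤t t< → on c (aa 1 1) i≤t (s≤s⁻¹ t<)) (4≤seg _)
        where
        inside : ∀ {u} → u ∈ vs → Adj (val (5 + a)) u → u ∈ val (1 + a) ∷ K
        inside u∈ adj with nbr-within {a} {5 + a} {8 + r + a} (aa 1 5) (ar 5 8) (lin n≥10+r 1 (id {A = ∀ a n r → suc (8 + r + a) + (n) + 1 ≡ n + a + (10 + r)} solve-∀ a n r)) ¬r ¬l u∈ adj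
        ... | t , 1≤t , t≤ , refl with t Data.Nat.≟ 1 + a
        ... | yes refl = here refl
        ... | no t≢    = there (∈K (≤∧≢⇒< 1≤t (t≢ ∘ sym)) t≤)

      one-right : k ≡ 7 + r → C (5 + r + a) (9 + r + a) → ¬ C (1 + a) (5 + r + a) → ¬ C (5 + r + a) (10 + r + a) → Colourable L vs
      one-right k≡ c ¬l ¬r = one-out-at (9 + r + a) k≡ (after∉K (rr 9 9) (rr 9 10))
        ((≢-near (ar 3 5) (aa 0 2) (rr 5 9) ∷ ≢-near (ar 3 8) (aa 0 2) (rr 8 9) ∷ []) ∷
         (≢-near (rr 6 8) (ar 0 5) (rr 8 9) ∷ []) ∷ [] ∷ [])
        (λ { (here refl) → ∈K (aa 2 2) (ar 2 8) ; (there (here refl)) → ∈K (ar 2 5) (rr 5 8)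
           ; (there (there (here refl))) → ∈K (ar 2 8) (rr 8 8) })
        last≁first (adj-sym (on c (rr 5 8) (rr 9 9) (rr 9 9))) inside
        (seg (5 + r + a) 4) (seg₄! _) (there ∘ seg⊆K (5 + r + a) 4 (ar 2 5) (rr 9 9))
        (seg-adj (5 + r + a) 4 λ i≤t t< → adj-sym (on c i≤t t< (rr 9 9))) (4≤seg _)
        where
        inside : ∀ {u} → u ∈ vs → Adj (val (5 + r + a)) u → u ∈ val (9 + r + a) ∷ K
        inside u∈ adj with nbr-within {1 + a} {5 + r + a} {9 + r + a} (ar 2 5) (rr 5 9) (lin n≥10+r 1 (id {A = ∀ a n r → suc (9 + r + a) + (n) + 1 ≡ n + (1 + a) + (10 + r)} solve-∀ a n r)) ¬r ¬l u∈ adj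
        ... | t , 2≤t , t≤ , refl with t Data.Nat.≟ 9 + r + a
        ... | yes refl = here refl
        ... | no t≢    = there (∈K 2≤t (s≤s⁻¹ (≤∧≢⇒< t≤ t≢)))

      -- The fourth vertex from either end of `K` decides. If the clique from `5 + a` does not
      -- extend past `K`, that vertex has no neighbour to the right of `K`, and its degree forces
      -- either two neighbours to the left of `K`, or exactly one, in which case `K` has `k`
      -- vertices. The other end is similar.
      near-maximum : k ≤ 8 + r → Colourable L vs
      near-maximum k≤8+r with C? (5 + a) (9 + r + a) | C? (1 + a) (5 + r + a)
      ... | yes cr | yes cl = two-sides cr cl
      ... | no ¬r | _ with C? a (5 + a)
      ...   | yes c = two-left c
      ...   | no ¬c = one-left (≤-antisym k≤7+r 7+r≤k) c′ ¬c ¬r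
        where
        k≤7+r : k ≤ 7 + r
        k≤7+r = degree-within {a} {5 + a} {8 + r + a} (7 + r) (aa 1 5) (ar 5 8) (lin n≥10+r 1 (id {A = ∀ a n r → suc (8 + r + a) + (n) + 1 ≡ n + a + (10 + r)} solve-∀ a n r))
          (≤-antisym (lin (z≤n {0}) 0 (id {A = ∀ a r → 8 + r + a + (0) + 0 ≡ suc a + (7 + r) + (0)} solve-∀ a r)) (lin (z≤n {0}) 0 (id {A = ∀ a r → suc a + (7 + r) + (0) + 0 ≡ 8 + r + a + (0)} solve-∀ a r))) ¬r ¬c
        c′ : C (1 + a) (5 + a)
        c′ with C? (1 + a) (5 + a)
        ... | yes c = c
        ... | no ¬c′ = contradiction (≤-trans 7+r≤k (degree-within {1 + a} {5 + a} {8 + r + a} (6 + r) (aa 2 5) (ar 5 8)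
                (lin n≥10+r 2 (id {A = ∀ a n r → suc (8 + r + a) + (n) + 2 ≡ n + (1 + a) + (10 + r)} solve-∀ a n r)) (≤-antisym (lin (z≤n {0}) 0 (id {A = ∀ a r → 8 + r + a + (0) + 0 ≡ suc (1 + a) + (6 + r) + (0)} solve-∀ a r)) (lin (z≤n {0}) 0 (id {A = ∀ a r → suc (1 + a) + (6 + r) + (0) + 0 ≡ 8 + r + a + (0)} solve-∀ a r))) ¬r ¬c′)) (n≮n _)
      near-maximum k≤8+r | yes cr | no ¬l with C? (5 + r + a) (10 + r + a)
      ...   | yes c = two-right c
      ...   | no ¬r = one-right (≤-antisym k≤7+r 7+r≤k) (C-mono (ar 5 5) ≤-refl cr) ¬l ¬r
        where
        k≤7+r : k ≤ 7 + r
        k≤7+r = degree-within {1 + a} {5 + r + a} {9 + r + a} (7 + r) (ar 2 5) (rr 5 9) (lin n≥10+r 1 (id {A = ∀ a n r → suc (9 + r + a) + (n) + 1 ≡ n + (1 + a) + (10 + r)} solve-∀ a n r))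
          (≤-antisym (lin (z≤n {0}) 0 (id {A = ∀ a r → 9 + r + a + (0) + 0 ≡ suc (1 + a) + (7 + r) + (0)} solve-∀ a r)) (lin (z≤n {0}) 0 (id {A = ∀ a r → suc (1 + a) + (7 + r) + (0) + 0 ≡ 9 + r + a + (0)} solve-∀ a r))) ¬r ¬l

    -- Only short cliques of consecutive vertices

    module Short (h : ℕ) (k≡ : k ≡ 8 + h) (short : ∀ i → ¬ C i (6 + h + i)) where

      n≥11+h : 11 + h ≤ n
      n≥11+h = ≤-trans (≤-reflexive (cong (3 +_) (sym k≡))) n≥

      too-long : ∀ {i j} → 6 + h + i ≤ j → ¬ C i j
      too-long {i} ≤j c = short i (C-mono ≤-refl ≤j c)

      -- In decreasing order, since the head of a Sparse list is coloured last.
      outer : ℕ → ℕ → List V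
      outer e zero    = []
      outer e (suc d) = val (suc d + e) ∷ outer e d

      ∈-outer⁻ : ∀ {v} e d → v ∈ outer e d → ∃ λ t → e < t × t ≤ d + e × v ≡ val t
      ∈-outer⁻ e (suc d) (here refl) = suc d + e , s≤s (m≤n+m e d) , ≤-refl , refl
      ∈-outer⁻ e (suc d) (there q) with ∈-outer⁻ e d q
      ... | t , e<t , t≤ , eq = t , e<t , m≤n⇒m≤1+n t≤ , eq

      ∈-outer⁺ : ∀ {t} e d → e < t → t ≤ d + e → val t ∈ outer e d
      ∈-outer⁺ e zero e<t t≤ = contradiction t≤ (<⇒≱ e<t)
      ∈-outer⁺ {t} e (suc d) e<t t≤ with t Data.Nat.≟ suc d + e
      ... | yes refl = here refl
      ... | no t≢    = there (∈-outer⁺ e d e<t (s≤s⁻¹ (≤∧≢⇒< t≤ t≢)))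

      outer-unique : ∀ e d → d ≤ n → Unique (outer e d)
      outer-unique e zero    d≤n = []
      outer-unique e (suc d) d≤n = All.¬Any⇒All¬ _ fresh ∷ outer-unique e d (<⇒≤ d≤n)
        where
        fresh : val (suc d + e) ∉ outer e d
        fresh q with ∈-outer⁻ e d q
        ... | t , e<t , t≤ , eq = distinct (s≤s t≤) (lin (e<t ⊕ d≤n) 0 (id {A = ∀ d e n t → suc (suc d + e) + (t + n) + 0 ≡ n + t + ((suc (e)) + (suc d))} solve-∀ d e n t)) (sym eq)

      module _ {p q u s e d : ℕ} (p<q : p < q) (q<u : q < u) (2+u≤s : 2 + u ≤ s) (s<e : s < e) (end : suc (d + e) ≡ n + p)
               (5+h≤e : 5 + h ≤ e) (cl : C p (suc u)) (cr : C u e) (p≁s : ¬ E p s) (q≁e : ¬ E q e) where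

        P W : List V
        P = val p ∷ val s ∷ val q ∷ val e ∷ []
        W = val u ∷ val (suc u) ∷ P

        e<n+p : e < n + p
        e<n+p = ≤-trans (s≤s (m≤n+m e d)) (≤-reflexive end)

        p<u = <-trans p<q q<u
        u<s = <-trans (n<1+n u) 2+u≤s
        u<e = <-trans u<s s<e

        ≢-near : ∀ {i j} → i < j → p ≤ i → j ≤ e → val i ≢ val j
        ≢-near i<j p≤i j≤e = distinct i<j (≤-<-trans j≤e (<-≤-trans e<n+p (+-monoʳ-≤ n p≤i)))

        P⁻ : ∀ {x} → x ∈ P → ∃ λ t → x ≡ val t × p ≤ t × t ≤ e × (t ≡ p ⊎ t ≡ q ⊎ s ≤ t)
        P⁻ (here refl)                         = p , refl , ≤-refl , <⇒≤ (<-trans p<u u<e) , inj₁ refl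
        P⁻ (there (here refl))                 = s , refl , <⇒≤ (<-trans p<u u<s) , <⇒≤ s<e , inj₂ (inj₂ ≤-refl)
        P⁻ (there (there (here refl)))         = q , refl , <⇒≤ p<q , <⇒≤ (<-trans q<u u<e) , inj₂ (inj₁ refl)
        P⁻ (there (there (there (here refl)))) = e , refl , <⇒≤ (<-trans p<u u<e) , ≤-refl , inj₂ (inj₂ (<⇒≤ s<e))

        W⁻ : ∀ {x} → x ∈ W → ∃ λ t → x ≡ val t × p ≤ t × t ≤ e
        W⁻ (here refl)         = u , refl , <⇒≤ p<u , <⇒≤ u<e
        W⁻ (there (here refl)) = suc u , refl , m≤n⇒m≤1+n (<⇒≤ p<u) , u<e
        W⁻ (there (there x∈)) with P⁻ x∈
        ... | t , eq , p≤t , t≤e , _ = t , eq , p≤t , t≤e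

        W! : Unique W
        W! = ((≢-near (n<1+n u) (<⇒≤ p<u) u<e) ∷ (≢-near p<u ≤-refl (<⇒≤ u<e) ∘ sym) ∷ (≢-near u<s (<⇒≤ p<u) (<⇒≤ s<e)) ∷
              (≢-near q<u (<⇒≤ p<q) (<⇒≤ u<e) ∘ sym) ∷ (≢-near u<e (<⇒≤ p<u) ≤-refl) ∷ []) ∷
             ((≢-near (m<n⇒m<1+n p<u) ≤-refl u<e ∘ sym) ∷ (≢-near 2+u≤s (m≤n⇒m≤1+n (<⇒≤ p<u)) (<⇒≤ s<e)) ∷
              (≢-near (m<n⇒m<1+n q<u) (<⇒≤ p<q) u<e ∘ sym) ∷ (≢-near (<-trans 2+u≤s s<e) (m≤n⇒m≤1+n (<⇒≤ p<u)) ≤-refl) ∷ []) ∷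
             ((≢-near (<-trans p<u u<s) ≤-refl (<⇒≤ s<e)) ∷ (≢-near p<q ≤-refl (<⇒≤ (<-trans q<u u<e))) ∷ (≢-near (<-trans p<u u<e) ≤-refl ≤-refl) ∷ []) ∷
             ((≢-near (<-trans q<u u<s) (<⇒≤ p<q) (<⇒≤ s<e) ∘ sym) ∷ (≢-near s<e (<⇒≤ (<-trans p<u u<s)) ≤-refl) ∷ []) ∷
             ((≢-near (<-trans q<u u<e) (<⇒≤ p<q) ≤-refl) ∷ []) ∷ [] ∷ []

        ∉outer : ∀ {t} d′ → d′ ≤ d → p ≤ t → t ≤ e → val t ∉ outer e d′
        ∉outer {t} d′ d′≤ p≤t t≤e x∈ with ∈-outer⁻ e d′ x∈
        ... | t′ , e<t′ , t′≤ , eq = distinct (≤-<-trans t≤e e<t′)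
          (lin (t′≤ ⊕ d′≤ ⊕ ≤-reflexive end ⊕ p≤t) 0 (id {A = ∀ d d′ e n p t t′ → suc (t′) + ((d′ + e) + d + (n + p) + t) + 0 ≡ n + t + (t′ + d′ + (suc (d + e)) + p)} solve-∀ d d′ e n p t t′)) eq

        I O : List V
        I = seg p n ∖ (W ++ outer e d)
        O = outer e d

        -- An edge going back from `w` spans a short clique, so it ends among the `5 + h = k − 3`
        -- preceding positions. An edge going forward passes the end of the turn; if it reached `s`
        -- or further, its clique would contain both `p` and `s`. This leaves `p` and `q`.
        outer-sparse : ∀ d′ → d′ ≤ d → Sparse k P (outer e d′)
        outer-sparse zero     _ = []
        outer-sparse (suc d′) d′< = few ∷ outer-sparse d′ (<⇒≤ d′<)
          where
          w = suc d′ + e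
          w<n+p : w < n + p
          w<n+p = (lin (≤-reflexive end ⊕ d′<) 0 (id {A = ∀ d d′ e n p → suc (suc d′ + e) + ((n + p) + d) + 0 ≡ n + p + ((suc (d + e)) + (suc d′))} solve-∀ d d′ e n p))
          base : ∃ λ w₀ → 5 + h + w₀ ≡ w
          -- The window of `5 + h` positions before `w` begins at a natural number because
          -- `5 + h ≤ e`.
          base = m≤n⇒∃[o]m+o≡n (≤-trans 5+h≤e (m≤n+m e (suc d′)))
          w₀ = proj₁ base
          cand : List V
          cand = val p ∷ val q ∷ seg w₀ (5 + h)
          place : ∀ {t} → E w t → t < w → p ≤ t → t ≡ p ⊎ t ≡ q ⊎ s ≤ t → val t ∈ cand
          place {t} a t<w p≤t why with arc t<w (<-≤-trans w<n+p (+-monoʳ-≤ n p≤t)) (adj-sym a)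
          place {t} a t<w p≤t why | inj₁ c with w Data.Nat.≤? 5 + h + t
          ... | yes w≤ = there (there (∈-seg⁺ w₀ (5 + h)
                  (+-cancelˡ-≤ (5 + h) _ _ (≤-trans (≤-reflexive (proj₂ base)) w≤)) (<-≤-trans t<w (≤-reflexive (sym (proj₂ base))))))
          ... | no w≰ = contradiction c (too-long (≰⇒> w≰))
          place a t<w p≤t (inj₁ refl)        | inj₂ c = here refl
          place a t<w p≤t (inj₂ (inj₁ refl)) | inj₂ c = there (here refl)
          place a t<w p≤t (inj₂ (inj₂ s≤t))  | inj₂ c =
            contradiction (on (C-down (C-mono (<⇒≤ w<n+p) (+-monoʳ-≤ n s≤t) c)) ≤-refl (<-trans p<u u<s) ≤-refl) p≁s
          sub : nbrs (val w) (outer e d′ ++ P) ⊆ cand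
          sub x∈ with ∈-nbrs⁻ (outer e d′ ++ P) x∈
          ... | x∈′ , a with ∈-++⁻ (outer e d′) x∈′
          ... | inj₁ y with ∈-outer⁻ e d′ y
          ... | t , e<t , t≤ , refl = place a (s≤s t≤) (<⇒≤ (<-trans (<-trans p<u u<e) e<t)) (inj₂ (inj₂ (<⇒≤ (<-trans s<e e<t))))
          sub x∈ | x∈′ , a | inj₂ y with P⁻ y
          ... | t , refl , p≤t , t≤e , why = place a (≤-<-trans t≤e (s≤s (m≤n+m e d′))) p≤t why
          O′P! : Unique (outer e d′ ++ P)
          O′P! = unique-++ (outer-unique e d′ (lin (d′< ⊕ ≤-reflexive end ⊕ p<u ⊕ u<e) 4 (id {A = ∀ d d′ e n p u → d′ + (d + (n + p) + u + e) + 4 ≡ n + ((suc d′) + (suc (d + e)) + (suc (p)) + (suc (u)))} solve-∀ d d′ e n p u)))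
            (Unique-tail (Unique-tail W!)) λ y z → case P⁻ z of λ { (t , refl , p≤t , t≤e , _) → ∉outer d′ (<⇒≤ d′<) p≤t t≤e y }
          few : length (nbrs (val w) (outer e d′ ++ P)) < k
          few = ≤-trans (s≤s (unique-⊆-length (Unique.filter⁺ (adj? (val w)) O′P!) sub))
            (≤-reflexive (trans (cong (3 +_) (length-seg w₀ (5 + h))) (sym k≡)))

        config-at : Colourable L vs
        config-at = config L! L≡ deg (val u) (val (suc u)) (val p) (val s) (val q) (val e) O I
          (≤-trans (lin (z≤n {0}) (3 + h) (id {A = ∀ h → 5 + (0) + (3 + h) ≡ 8 + h + (0)} solve-∀ h)) (≤-reflexive (sym k≡))) all! vs⊆ (outer-sparse d ≤-refl) inner
          (on cl (<⇒≤ p<u) (n<1+n u) ≤-refl)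
          (λ { (here refl) → adj-sym (on cl ≤-refl p<u (n≤1+n u)) ; (there (here refl)) → on cr ≤-refl u<s (<⇒≤ s<e)
             ; (there (there (here refl))) → adj-sym (on cl (<⇒≤ p<q) q<u (n≤1+n u))
             ; (there (there (there (here refl)))) → on cr ≤-refl u<e ≤-refl })
          (adj-sym (on cl ≤-refl (m<n⇒m<1+n p<u) ≤-refl)) (on cr (n≤1+n u) 2+u≤s (<⇒≤ s<e)) p≁s q≁e
          where
          I⁻ : ∀ {x} → x ∈ I → x ∈ seg p n × x ∉ W ++ O
          I⁻ = ∈-∖⁻ (seg p n) (W ++ O)
          O! : Unique O
          O! = outer-unique e d (lin (≤-reflexive end ⊕ p<u ⊕ u<e) 3 (id {A = ∀ d e n p u → d + ((n + p) + u + e) + 3 ≡ n + ((suc (d + e)) + (suc (p)) + (suc (u)))} solve-∀ d e n p u))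
          W∉O : ∀ {x} → x ∈ W → x ∉ O
          W∉O x∈ y with W⁻ x∈
          ... | t , refl , p≤t , t≤e = ∉outer d ≤-refl p≤t t≤e y
          OP! : Unique (O ++ P)
          OP! = unique-++ O! (Unique-tail (Unique-tail W!)) λ y z → W∉O (there (there z)) y
          IOP! : Unique (I ++ O ++ P)
          IOP! = unique-++ (unique-∖ (W ++ O) (seg-unique p n ≤-refl)) OP! λ x∈ y → proj₂ (I⁻ x∈)
            (case ∈-++⁻ O y of λ { (inj₁ z) → ∈-++⁺ʳ W z ; (inj₂ z) → ∈-++⁺ˡ {xs = W} (there (there z)) })
          fresh : ∀ {x} → x ∈ W → x ∉ P → x ∉ I ++ O ++ P
          fresh x∈W x∉P y with ∈-++⁻ I y
          ... | inj₁ z = proj₂ (I⁻ z) (∈-++⁺ˡ x∈W)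
          ... | inj₂ z with ∈-++⁻ O z
          ... | inj₁ o = W∉O x∈W o
          ... | inj₂ o = x∉P o
          all! : Unique (val u ∷ val (suc u) ∷ I ++ O ++ P)
          all! = All.¬Any⇒All¬ _ (λ { (here eq) → Unique-head W! (here eq) ; (there y) → fresh (here refl) (Unique-head W! ∘ there) y }) ∷
                 All.¬Any⇒All¬ _ (fresh (there (here refl)) (Unique-head (Unique-tail W!))) ∷ IOP!
          vs⊆ : vs ⊆ val u ∷ val (suc u) ∷ I ++ O ++ P
          vs⊆ {v} v∈ with v ∈? W
          ... | yes (here eq)           = here eq
          ... | yes (there (here eq))   = there (here eq)
          ... | yes (there (there x∈P)) = there (there (∈-++⁺ʳ I (∈-++⁺ʳ O x∈P)))
          ... | no v∉W with v ∈? O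
          ... | yes v∈O = there (there (∈-++⁺ʳ I (∈-++⁺ˡ v∈O)))
          ... | no v∉O with cover p v∈
          ... | t , p≤t , t< , refl = there (there (∈-++⁺ˡ (∈-∖⁺ (∈-seg⁺ p n p≤t t<)
                λ y → case ∈-++⁻ W y of λ { (inj₁ z) → v∉W z ; (inj₂ z) → v∉O z })))
          inner : ∀ {x} → x ∈ I → Adj x (val u) × Adj x (val (suc u))
          inner x∈ with I⁻ x∈
          ... | x∈seg , x∉ with ∈-seg⁻ p n x∈seg
          ... | t , p≤t , t< , refl with t Data.Nat.≤? e
          ... | no t≰e = contradiction (∈-++⁺ʳ W (∈-outer⁺ e d (≰⇒> t≰e) (s≤s⁻¹ (≤-trans t< (≤-reflexive (sym end)))))) x∉
          ... | yes t≤e with <-cmp t u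
          ... | tri< t<u _ _ = on cl p≤t t<u (n≤1+n u) , on cl p≤t (m<n⇒m<1+n t<u) ≤-refl
          ... | tri≈ _ refl _ = contradiction (here refl) x∉
          ... | tri> _ _ u<t with t Data.Nat.≟ suc u
          ... | yes refl = contradiction (there (here refl)) x∉
          ... | no t≢ = let 1+u<t = ≤∧≢⇒< u<t (t≢ ∘ sym) in
                adj-sym (on cr ≤-refl u<t t≤e) , adj-sym (on cr (n≤1+n u) 1+u<t t≤e)

      trivial : ∀ {i j} → j ≤ i → C i j
      trivial j≤i = clique λ i≤a a<b b≤j → contradiction (<-≤-trans a<b (≤-trans b≤j (≤-trans j≤i i≤a))) (n≮n _)

      left-end : ∀ {v} a → v ≡ 6 + h + a → ∃ λ l → a ≤ l × l < v × ¬ C l v × C (suc l) v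
      left-end {v} a refl = last-false (λ t → C? t v) a (6 + h) (too-long ≤-refl) (trivial ≤-refl)

      right-end : ∀ v → ∃ λ r → v ≤ r × r < 6 + h + v × C v r × ¬ C v (suc r)
      right-end v = last-true (C? v) v (6 + h) (trivial ≤-refl) (too-long ≤-refl)

      -- If the two cliques met on the far side, `v` would be adjacent to every vertex. Otherwise
      -- all neighbours of `v` lie after `l` and not beyond `r`; there are at least `8 + h` of them,
      -- and `v` itself makes it `9 + h`.
      span : ∀ {l v r} → l < v → v ≤ r → ¬ C l v → C (suc l) v → C v r → ¬ C v (suc r) → r < n + l × 9 + h + l ≤ r
      span {l} {v} {r} l<v v≤r ¬l cl cr ¬r with suc r Data.Nat.≤? n + l
      ... | no r≮ = contradiction (subst (λ i → C i (n + v)) (+-suc n l) (C-up cl)) (no-universal (C-mono ≤-refl (s≤s⁻¹ (≰⇒> r≮)) cr))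
      ... | yes r< with m≤n⇒∃[o]m+o≡n (≤-trans l<v v≤r)
      ... | d , eq = r< , (lin ((degree-within d l<v v≤r r< (sym eq) ¬r ¬l) ⊕ ≤-reflexive (sym k≡) ⊕ ≤-reflexive eq) 0 (id {A = ∀ d h k l r → 9 + h + l + (d + k + r) + 0 ≡ r + (k + (8 + h) + (suc l + d))} solve-∀ d h k l r))

      -- Here `v` and `suc v` are coloured last. The last hypothesis makes `p = suc l` adjacent to
      -- both of them; `s` is the position where the clique from `p` breaks off. The clique from `v`
      -- ends at `e`, and `q` is the last position from which no clique reaches `e`.
      extended : ∀ {v l} → v ≤ 6 + h + l → l < v → ¬ C l v → C (suc l) v → C (suc l) (suc v) → Colourable L vs
      extended {v} {l} v≤ l<v ¬l cl cl⁺ with right-end v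
      ... | r , v≤r , r< , cr , ¬r with span l<v v≤r ¬l cl cr ¬r
      ... | r<n+l , long with m≤n⇒∃[o]m+o≡n {2 + v} {r} (lin (long ⊕ v≤) 1 (id {A = ∀ h l r v → 2 + v + (r + (6 + h + l)) + 1 ≡ r + ((9 + h + l) + v)} solve-∀ h l r v))
      ... | o , refl with last-true (C? (suc l)) (suc v) o cl⁺ (too-long (lin long 1 (id {A = ∀ h l o v → 6 + h + suc l + (2 + v + o) + 1 ≡ o + suc v + (9 + h + l)} solve-∀ h l o v)))
      ... | t , v<t , t< , ct , ¬ct with 2 + l Data.Nat.≤? v
      ... | no l≮ = contradiction (C-mono (s≤s⁻¹ (≤-trans (≰⇒> l≮) (n≤1+n _))) ≤-refl cr) (too-long (lin long 1 (id {A = ∀ h l o v → 6 + h + (2 + l) + (2 + v + o) + 1 ≡ 2 + v + o + (9 + h + l)} solve-∀ h l o v)))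
      ... | yes 2+l≤v with m≤n⇒∃[o]m+o≡n 2+l≤v
      ... | o′ , eq with last-false (λ i → C? i (2 + v + o)) (2 + l) o′ (too-long (lin long 1 (id {A = ∀ h l o v → 6 + h + (2 + l) + (2 + v + o) + 1 ≡ 2 + v + o + (9 + h + l)} solve-∀ h l o v)))
                           (subst (λ i → C i (2 + v + o)) (trans (sym eq) (+-comm (2 + l) o′)) cr)
      ... | q , l<q , q< , ¬cq , cq with m≤n⇒∃[o]m+o≡n {suc (2 + v + o)} {n + suc l} (lin r<n+l 1 (id {A = ∀ l n o v → suc (2 + v + o) + (n + l) + 1 ≡ n + suc l + (suc (2 + v + o))} solve-∀ l n o v))
      ... | d , eq′ = config-at {suc l} {q} {v} {suc t} {2 + v + o} {d} l<q (lin (q< ⊕ ≤-reflexive eq) 0 (id {A = ∀ l o′ q v → suc (q) + ((o′ + (2 + l)) + v) + 0 ≡ v + ((suc (q)) + (2 + l + o′))} solve-∀ l o′ q v)) (s≤s v<t)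
        (lin t< 0 (id {A = ∀ o t v → suc (suc t) + (o + suc v) + 0 ≡ 2 + v + o + (suc (t))} solve-∀ o t v)) (trans (cong suc (+-comm d (2 + v + o))) eq′) (lin long (4 + l) (id {A = ∀ h l o v → 5 + h + (2 + v + o) + (4 + l) ≡ 2 + v + o + (9 + h + l)} solve-∀ h l o v)) cl⁺ cr
        (nonadjacent-right (lin (v<t ⊕ l<v) 1 (id {A = ∀ l t v → suc l + (t + v) + 1 ≡ t + ((suc v) + (suc (l)))} solve-∀ l t v))
          (lin (r<n+l ⊕ t<) 2 (id {A = ∀ l n o t v → suc (suc t) + ((n + l) + (o + suc v)) + 2 ≡ n + suc l + ((suc (2 + v + o)) + (suc (t)))} solve-∀ l n o t v)) ct ¬ct)
        (nonadjacent-left (lin (q< ⊕ ≤-reflexive eq) (2 + o) (id {A = ∀ l o o′ q v → suc (q) + ((o′ + (2 + l)) + v) + (2 + o) ≡ 2 + v + o + ((suc (q)) + (2 + l + o′))} solve-∀ l o o′ q v))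
          (lin (r<n+l ⊕ l<q) 2 (id {A = ∀ l n o q v → suc (2 + v + o) + ((n + l) + q) + 2 ≡ n + q + ((suc (2 + v + o)) + (2 + l))} solve-∀ l n o q v)) cq ¬cq)

      before : ∀ {i j v} → C i v → ¬ C j v → j < i
      before {i} {j} c ¬c with i Data.Nat.≤? j
      ... | yes i≤j = contradiction (C-mono i≤j ≤-refl c) ¬c
      ... | no i≰j = ≰⇒> i≰j

      -- If the cliques ending at 1 + v and 2 + v do not extend, those ending at
      -- 1 + v, 2 + v, 3 + v start further and further to the right, and the position
      -- just before the start of each carries a nonneighbour of its end.
      staggered : ∀ {v l₁ l₂ l₃} → v ≤ 6 + h → 5 + h ≤ v → l₂ < 2 + v → l₃ < 3 + v → C (suc l₁) (1 + v) → ¬ C (suc l₁) (2 + v) →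
                  ¬ C l₂ (2 + v) → C (suc l₂) (2 + v) → ¬ C (suc l₂) (3 + v) →
                  ¬ C l₃ (3 + v) → C (suc l₃) (3 + v) → C v (3 + v) → Colourable L vs
      staggered {v} {l₁} {l₂} {l₃} v≤ ≤v l₂< l₃< cl₁ ¬c₁ ¬l₂ cl₂ ¬c₂ ¬l₃ cl₃ c₃ = config-at {l₂} {l₃} {v} {2 + v} {3 + v} {d}
          p<q (before c₃ ¬l₃) ≤-refl ≤-refl end 5+h≤e (C-mono (s≤s⁻¹ (before cl₂ ¬c₁)) ≤-refl cl₁) c₃
          (nonadjacent-left l₂< (≤-trans (n≤1+n _) e<) cl₂ ¬l₂) (nonadjacent-left l₃< (≤-trans e< (+-monoʳ-≤ n (<⇒≤ p<q))) cl₃ ¬l₃)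
        where
        p<q : l₂ < l₃
        p<q = s≤s⁻¹ (before cl₃ ¬c₂)
        e< : 3 + v < n + l₂
        e< = (lin (n≥11+h ⊕ v≤) (l₂ + 1) (id {A = ∀ h l₂ n v → suc (3 + v) + (n + (6 + h)) + (l₂ + 1) ≡ n + l₂ + ((11 + h) + v)} solve-∀ h l₂ n v))
        gap : ∃ λ d → suc (3 + v) + d ≡ n + l₂
        gap = m≤n⇒∃[o]m+o≡n e<
        d = proj₁ gap
        end : suc (d + (3 + v)) ≡ n + l₂
        end = trans (cong suc (+-comm d (3 + v))) (proj₂ gap)
        5+h≤e : 5 + h ≤ 3 + v
        5+h≤e = ≤-trans ≤v (m≤n+m v 3)

      -- Position `6 + h` is the first for which the search for a left end, which may go back
      -- `6 + h` steps, stays in the natural numbers. If the maximal clique ending at `7 + h` or at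
      -- `8 + h` goes on for one more position, `extended` applies; otherwise their starts move with
      -- their ends.
      short-case : Colourable L vs
      short-case = first (left-end 1 (≤-antisym (lin (z≤n {0}) 0 (id {A = ∀ h → 7 + h + (0) + 0 ≡ 6 + h + 1 + (0)} solve-∀ h)) (lin (z≤n {0}) 0 (id {A = ∀ h → 6 + h + 1 + (0) + 0 ≡ 7 + h + (0)} solve-∀ h)))) (left-end 2 (≤-antisym (lin (z≤n {0}) 0 (id {A = ∀ h → 8 + h + (0) + 0 ≡ 6 + h + 2 + (0)} solve-∀ h)) (lin (z≤n {0}) 0 (id {A = ∀ h → 6 + h + 2 + (0) + 0 ≡ 8 + h + (0)} solve-∀ h)))) (left-end 3 (≤-antisym (lin (z≤n {0}) 0 (id {A = ∀ h → 9 + h + (0) + 0 ≡ 6 + h + 3 + (0)} solve-∀ h)) (lin (z≤n {0}) 0 (id {A = ∀ h → 6 + h + 3 + (0) + 0 ≡ 9 + h + (0)} solve-∀ h))))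
                         (left-end 0 (≤-antisym (lin (z≤n {0}) 0 (id {A = ∀ h → 6 + h + (0) + 0 ≡ 6 + h + 0 + (0)} solve-∀ h)) (lin (z≤n {0}) 0 (id {A = ∀ h → 6 + h + 0 + (0) + 0 ≡ 6 + h + (0)} solve-∀ h)))) (right-end (6 + h))
        where
        LeftEnd : ℕ → ℕ → Set
        LeftEnd v a = ∃ λ l → a ≤ l × l < v × ¬ C l v × C (suc l) v
        first : LeftEnd (7 + h) 1 → LeftEnd (8 + h) 2 → LeftEnd (9 + h) 3 → LeftEnd (6 + h) 0 →
                (∃ λ r → 6 + h ≤ r × r < 6 + h + (6 + h) × C (6 + h) r × ¬ C (6 + h) (suc r)) → Colourable L vs
        first (l₁ , 1≤ , l₁< , ¬l₁ , cl₁) (l₂ , 2≤ , l₂< , ¬l₂ , cl₂) (l₃ , _ , l₃< , ¬l₃ , cl₃) (l₀ , _ , l₀< , ¬l₀ , cl₀) (r , ≤r , _ , cr , ¬r)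
          with C? (suc l₁) (8 + h) | C? (suc l₂) (9 + h)
        ... | yes c | _ = extended (lin 1≤ 0 (id {A = ∀ h l₁ → 7 + h + (l₁) + 0 ≡ 6 + h + l₁ + (1)} solve-∀ h l₁)) l₁< ¬l₁ cl₁ c
        ... | no _ | yes c = extended (lin 2≤ 0 (id {A = ∀ h l₂ → 8 + h + (l₂) + 0 ≡ 6 + h + l₂ + (2)} solve-∀ h l₂)) l₂< ¬l₂ cl₂ c
        ... | no ¬c₁ | no ¬c₂ = staggered ≤-refl (n≤1+n _) l₂< l₃< cl₁ ¬c₁ ¬l₂ cl₂ ¬c₂ ¬l₃ cl₃
                -- The clique ending at `6 + h` starts after `l₀ ≥ 0`, so the degree of this
                -- position forces its clique to the right to reach `9 + h`.
                (C-mono ≤-refl (≤-trans (m≤m+n (9 + h) l₀) (proj₂ (span l₀< ≤r ¬l₀ cl₀ cr ¬r))) cr)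

    -- The two cases together

    everywhere : ∀ d → (∀ {i} → i < n → ¬ C i (d + i)) → ∀ i → ¬ C i (d + i)
    everywhere d none i = go i i ≤-refl
      where
      go : ∀ N i → i ≤ N → ¬ C i (d + i)
      go N i i≤N c with suc i Data.Nat.≤? n
      ... | yes i<n = none i<n c
      ... | no  i≮n with m≤n⇒∃[o]m+o≡n (s≤s⁻¹ (≰⇒> i≮n))
      go zero    _ i≤N c | no _ | i , refl = (linᶜ (n≥ ⊕ i≤N) (2 + k + i) (id {A = ∀ i k n → (3 + k) + (n + i) ≡ n + 0 + suc (2 + k + i)} solve-∀ i k n))
      go (suc N) _ i≤N c | no _ | i , refl = go N i (lin (n≥ ⊕ i≤N) (2 + k) (id {A = ∀ N i k n → i + (n + (suc N)) + (2 + k) ≡ N + ((3 + k) + (n + i))} solve-∀ N i k n))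
        (C-down (C-mono ≤-refl (lin (z≤n {0}) 0 (id {A = ∀ d i n → n + (d + i) + (0) + 0 ≡ d + (n + i) + (0)} solve-∀ d i n)) c))

    circle-colourable : ∀ h → k ≡ 8 + h → (∀ {K} → AllPairs Adj K → length K ≢ suc k) → Colourable L vs
    circle-colourable h k≡ noclique with anyUpTo? (λ i → C? i (7 + h + i)) n
    -- A full turn is added so that the two positions before the clique are natural numbers.
    ... | yes (i , _ , c) with m≤n⇒∃[o]m+o≡n {2} {n + i} (lin n≥ (i + 1 + k) (id {A = ∀ i k n → 2 + (n) + (i + 1 + k) ≡ n + i + (3 + k)} solve-∀ i k n))
    ... | a , eq = NearMaximum.near-maximum a (1 + h) (≤-reflexive (sym k≡))
        (C-mono (≤-reflexive (sym eq)) (lin (≤-reflexive eq) 0 (id {A = ∀ a h i n → 8 + (1 + h) + a + (n + i) + 0 ≡ n + (7 + h + i) + (2 + a)} solve-∀ a h i n)) (C-up c))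
        (λ j c′ → noclique (clique⇒AllPairs (seg-unique j (9 + h) (lin (n≥ ⊕ ≤-reflexive (sym k≡)) 2 (id {A = ∀ h k n → 9 + h + (n + k) + 2 ≡ n + ((3 + k) + (8 + h))} solve-∀ h k n)))
                                            (seg-clique j (9 + h) (8 + h + j) ≤-refl c′))
                           (trans (length-seg j (9 + h)) (cong suc (sym k≡))))
        (lin (≤-reflexive k≡) 1 (id {A = ∀ h k → k + (8 + h) + 1 ≡ 9 + h + (k)} solve-∀ h k))
    circle-colourable h k≡ noclique | no none₈ with anyUpTo? (λ i → C? i (6 + h + i)) n
    ... | yes (i , _ , c) with m≤n⇒∃[o]m+o≡n {2} {n + i} (lin n≥ (i + 1 + k) (id {A = ∀ i k n → 2 + (n) + (i + 1 + k) ≡ n + i + (3 + k)} solve-∀ i k n))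
    ... | a , eq = NearMaximum.near-maximum a h (lin (≤-reflexive (sym k≡)) 1 (id {A = ∀ h k → 7 + h + (k) + 1 ≡ k + (8 + h)} solve-∀ h k))
        (C-mono (≤-reflexive (sym eq)) (lin (≤-reflexive eq) 0 (id {A = ∀ a h i n → 8 + h + a + (n + i) + 0 ≡ n + (6 + h + i) + (2 + a)} solve-∀ a h i n)) (C-up c))
        (everywhere (7 + h) λ i<n c′ → none₈ (_ , i<n , c′)) (≤-reflexive k≡)
    circle-colourable h k≡ noclique | no none₈ | no none₇ =
      Short.short-case h k≡ (everywhere (6 + h) λ i<n c′ → none₇ (_ , i<n , c′))

  -- From the order of the angles to the cyclic numbering

  nth : V → List V → ℕ → V
  nth v₀ []       _       = v₀
  nth v₀ (x ∷ xs) zero    = x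
  nth v₀ (x ∷ xs) (suc i) = nth v₀ xs i

  nth-∈ : ∀ v₀ xs {i} → i < length xs → nth v₀ xs i ∈ xs
  nth-∈ v₀ (x ∷ xs) {zero}  _  = here refl
  nth-∈ v₀ (x ∷ xs) {suc i} i< = there (nth-∈ v₀ xs (s≤s⁻¹ i<))

  nth-index : ∀ v₀ xs {v} → v ∈ xs → ∃ λ i → i < length xs × nth v₀ xs i ≡ v
  nth-index v₀ (x ∷ xs) (here refl) = 0 , s≤s z≤n , refl
  nth-index v₀ (x ∷ xs) (there q) with nth-index v₀ xs q
  ... | i , i< , e = suc i , s≤s i< , e

  nth-AllPairs : ∀ {R : V → V → Set} v₀ {xs i j} → AllPairs R xs → i < j → j < length xs → R (nth v₀ xs i) (nth v₀ xs j)
  nth-AllPairs v₀ {x ∷ xs} {zero}  {suc j} (r ∷ _)  _   j< = All.lookup r (nth-∈ v₀ xs (s≤s⁻¹ j<))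
  nth-AllPairs v₀ {x ∷ xs} {suc i} {suc j} (_ ∷ rs) i<j j< = nth-AllPairs v₀ rs (s≤s⁻¹ i<j) (s≤s⁻¹ j<)

  -- Vertices in the order ≼ of their angles.  An arc containing u and v contains
  -- all vertices between them or all vertices not between them.
  record ArcProperty (_≼_ : V → V → Set) : Set where
    field
      ≼-refl : ∀ {u} → u ≼ u
      arcs   : ∀ {u v} → Adj u v → u ≼ v →
               (∀ {w x} → u ≼ w → w ≼ v → u ≼ x → x ≼ v → w ≢ x → Adj w x) ⊎
               (∀ {w x} → w ≼ u ⊎ v ≼ w → x ≼ u ⊎ v ≼ x → w ≢ x → Adj w x)

  module _ {_≼_ : V → V → Set} (property : ArcProperty _≼_) {k : ℕ} {L : V → List ℕ}
           (L! : ∀ v → Unique (L v)) (L≡ : ∀ v → length (L v) ≡ k)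
           (deg : ∀ {v ns} → Unique ns → (∀ {u} → u ∈ ns → Adj v u) → length ns ≤ suc k)
           (noclique : ∀ {K} → AllPairs Adj K → length K ≢ suc k) where

    open ArcProperty property

    module Winding (v₀ : V) (vs₀ : List V) (vs! : Unique (v₀ ∷ vs₀)) (sorted : AllPairs _≼_ (v₀ ∷ vs₀)) where

      vs : List V
      vs = v₀ ∷ vs₀

      n : ℕ
      n = suc (length vs₀)

      at : ℕ → V
      at = nth v₀ vs

      at-≼ : ∀ {i j} → i ≤ j → j < n → at i ≼ at j
      at-≼ {i} {j} i≤j j<n with i Data.Nat.≟ j
      ... | yes refl = ≼-refl
      ... | no i≢j   = nth-AllPairs v₀ sorted (≤∧≢⇒< i≤j i≢j) j<n

      at-≢ : ∀ {i j} → i < n → j < n → i ≢ j → at i ≢ at j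
      at-≢ {i} {j} i<n j<n i≢j with <-cmp i j
      ... | tri< i<j _ _  = nth-AllPairs v₀ vs! i<j j<n
      ... | tri≈ _ i≡j _  = contradiction i≡j i≢j
      ... | tri> _ _ j<i  = nth-AllPairs v₀ vs! j<i i<n ∘ sym

      abstract
        val : ℕ → V
        val i = at (i % n)

        val-lap : ∀ {b} q → b < n → val (b + q * n) ≡ at b
        val-lap {b} q b<n = cong at (trans ([m+kn]%n≡m%n b q n) (m<n⇒m%n≡m b<n))

        val∈ : ∀ i → val i ∈ vs
        val∈ i = nth-∈ v₀ vs (m%n<n i n)

      -- `Q` is where the turn containing `i` begins. A window of length `n` from `i` meets only
      -- this turn and the next, so the record describes these two and hides the division by `n`.
      record Lap (i a Q : ℕ) : Set where
        field
          split : i ≡ a + Q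
          a<n   : a < n
          this  : ∀ {b} → b < n → val (b + Q) ≡ at b
          next  : ∀ {b} → b < n → val (b + (n + Q)) ≡ at b

      lap : ∀ i → ∃ λ a → ∃ λ Q → Lap i a Q
      lap i = i % n , i / n * n , record
        { split = m≡m%n+[m/n]*n i n ; a<n = m%n<n i n ; this = val-lap (i / n) ; next = val-lap (suc (i / n)) }

      module FromLap {i a Q : ℕ} (l : Lap i a Q) where
        open Lap l

        locate : ∀ {t} → i ≤ t → (∃ λ b → t ≡ b + Q × a ≤ b × b < n) ⊎ (∃ λ b → t ≡ b + (n + Q))
        locate {t} i≤t with suc t Data.Nat.≤? n + Q
        ... | yes t< with m≤n⇒∃[o]m+o≡n {Q} {t} (lin (≤-reflexive (sym split) ⊕ i≤t) a (id {A = ∀ Q a i t → Q + (i + t) + a ≡ t + ((a + Q) + i)} solve-∀ Q a i t))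
        ...   | b , refl = inj₁ (b , +-comm Q b , (lin (≤-reflexive (sym split) ⊕ i≤t) 0 (id {A = ∀ Q a b i → a + (i + (Q + b)) + 0 ≡ b + ((a + Q) + i)} solve-∀ Q a b i)) , (lin t< 0 (id {A = ∀ Q b n → suc (b) + (n + Q) + 0 ≡ n + (suc (Q + b))} solve-∀ Q b n)))
        locate {t} i≤t | no t≮ with m≤n⇒∃[o]m+o≡n (s≤s⁻¹ (≰⇒> t≮))
        ...   | b , refl = inj₂ (b , +-comm (n + Q) b)

      distinct : ∀ {i j} → i < j → j < n + i → val i ≢ val j
      distinct {i} {j} i<j j< with lap i
      ... | a , Q , l with FromLap.locate l (<⇒≤ i<j)
      ... | inj₁ (b , refl , a≤b , b<n) = subst₂ _≢_ (sym (trans (cong val split) (this a<n))) (sym (this b<n))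
            (at-≢ a<n b<n λ { refl → n≮n _ (<-≤-trans i<j (≤-reflexive (sym split))) })
        where open Lap l
      ... | inj₂ (b , refl) = subst₂ _≢_ (sym (trans (cong val split) (this a<n))) (sym (next b<n))
            (at-≢ a<n b<n λ { refl → n≮n _ b<a })
        where
        open Lap l
        b<a : b < a
        b<a = (lin (j< ⊕ ≤-reflexive split) 0 (id {A = ∀ Q a b i n → suc (b) + ((n + i) + (a + Q)) + 0 ≡ a + ((suc (b + (n + Q))) + i)} solve-∀ Q a b i n))
        b<n : b < n
        b<n = <-trans b<a a<n

      periodic : ∀ i → val (n + i) ≡ val i
      periodic i with lap i
      ... | a , Q , l = trans (cong val (≤-antisym (lin (≤-reflexive split) 0 (id {A = ∀ Q a i n → n + i + (a + Q) + 0 ≡ a + (n + Q) + (i)} solve-∀ Q a i n)) (lin (≤-reflexive (sym split)) 0 (id {A = ∀ Q a i n → a + (n + Q) + (i) + 0 ≡ n + i + (a + Q)} solve-∀ Q a i n))))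
                          (trans (next a<n) (sym (trans (cong val split) (this a<n))))
        where open Lap l

      cover : ∀ {v} s → v ∈ vs → ∃ λ t → s ≤ t × t < n + s × val t ≡ v
      cover {v} s v∈ with lap s | nth-index v₀ vs v∈
      ... | a , Q , l | c , c<n , refl with a Data.Nat.≤? c
      ... | yes a≤c = c + Q , (lin (≤-reflexive split ⊕ a≤c) 0 (id {A = ∀ Q a c s → s + ((a + Q) + c) + 0 ≡ c + Q + (s + a)} solve-∀ Q a c s)) , (lin (≤-reflexive (sym split) ⊕ c<n) a (id {A = ∀ Q a c n s → suc (c + Q) + (s + n) + a ≡ n + s + ((a + Q) + (suc (c)))} solve-∀ Q a c n s)) , this c<n
        where open Lap l
      ... | no a≰c = c + (n + Q) , (lin (≤-reflexive split ⊕ a<n) (c + 1) (id {A = ∀ Q a c n s → s + ((a + Q) + n) + (c + 1) ≡ c + (n + Q) + (s + (suc (a)))} solve-∀ Q a c n s)) ,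
                     (lin (≤-reflexive (sym split) ⊕ (≰⇒> a≰c)) 0 (id {A = ∀ Q a c n s → suc (c + (n + Q)) + (s + a) + 0 ≡ n + s + ((a + Q) + (suc (c)))} solve-∀ Q a c n s)) , next c<n
        where open Lap l

      arc : ∀ {i j} → i < j → j < n + i → Adj (val i) (val j) → Cl val i j ⊎ Cl val j (n + i)
      arc {i} {j} i<j j< adj with lap i
      ... | a , Q , l with FromLap.locate l (<⇒≤ i<j)
      ... | inj₁ (b , refl , a≤b , b<n) = case arcs (subst₂ Adj (trans (cong val split) (this a<n)) (this b<n) adj) (at-≼ a≤b b<n) of λ
        { (inj₁ h) → inj₁ (clique λ i≤s s<t t≤j → h (between-l i≤s (≤-trans (<⇒≤ s<t) t≤j)) (between-r i≤s (≤-trans (<⇒≤ s<t) t≤j))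
            (between-l (≤-trans i≤s (<⇒≤ s<t)) t≤j) (between-r (≤-trans i≤s (<⇒≤ s<t)) t≤j)
            (distinct s<t (≤-<-trans t≤j (<-≤-trans j< (+-monoʳ-≤ n i≤s)))))
        ; (inj₂ h) → inj₂ (clique λ j≤s s<t t≤ → h (beyond j≤s (≤-trans (<⇒≤ s<t) t≤)) (beyond (≤-trans j≤s (<⇒≤ s<t)) t≤)
            (distinct s<t (≤-<-trans t≤ (+-monoʳ-< n (<-≤-trans i<j j≤s))))) }
        where
        open Lap l
        between : ∀ {s} → i ≤ s → s ≤ b + Q → at a ≼ val s × val s ≼ at b
        between i≤s s≤ with FromLap.locate l i≤s
        ... | inj₁ (c , refl , a≤c , c<n) = subst (at a ≼_) (sym (this c<n)) (at-≼ a≤c c<n) ,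
              subst (_≼ at b) (sym (this c<n)) (at-≼ (+-cancelʳ-≤ Q c b s≤) b<n)
        ... | inj₂ (c , refl) = (linᶜ (s≤ ⊕ b<n) c (id {A = ∀ Q b c n → (c + (n + Q)) + (suc (b)) ≡ (b + Q) + n + suc c} solve-∀ Q b c n))
        between-l : ∀ {s} → i ≤ s → s ≤ b + Q → at a ≼ val s
        between-l i≤s s≤ = proj₁ (between i≤s s≤)
        between-r : ∀ {s} → i ≤ s → s ≤ b + Q → val s ≼ at b
        between-r i≤s s≤ = proj₂ (between i≤s s≤)
        beyond : ∀ {s} → b + Q ≤ s → s ≤ n + i → val s ≼ at a ⊎ at b ≼ val s
        beyond b≤s s≤ with FromLap.locate l (≤-trans (<⇒≤ i<j) b≤s)
        ... | inj₁ (c , refl , _ , c<n) = inj₂ (subst (at b ≼_) (sym (this c<n)) (at-≼ (+-cancelʳ-≤ Q b c b≤s) c<n))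
        ... | inj₂ (c , refl) = inj₁ (subst (_≼ at a) (sym (next (≤-<-trans c≤a a<n))) (at-≼ c≤a a<n))
          where
          c≤a : c ≤ a
          c≤a = (lin (s≤ ⊕ ≤-reflexive split) 0 (id {A = ∀ Q a c i n → c + ((n + i) + (a + Q)) + 0 ≡ a + ((c + (n + Q)) + i)} solve-∀ Q a c i n))
      -- Now `j` lies in the next turn, so its angle is the smaller one: the vertices between the
      -- two angles are those from `j` to `n + i`, and the two sides change places.
      arc {i} {j} i<j j< adj | a , Q , l | inj₂ (b , refl) =
        case arcs (adj-sym (subst₂ Adj (trans (cong val split) (this a<n)) (next b<n) adj)) (at-≼ (<⇒≤ b<a) a<n) of λ
        { (inj₁ h) → inj₂ (clique λ j≤s s<t t≤ → let s≤ = ≤-trans (<⇒≤ s<t) t≤ ; j≤t = ≤-trans j≤s (<⇒≤ s<t) in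
            h (proj₁ (between j≤s s≤)) (proj₂ (between j≤s s≤)) (proj₁ (between j≤t t≤)) (proj₂ (between j≤t t≤))
            (distinct s<t (≤-<-trans t≤ (+-monoʳ-< n (<-≤-trans i<j j≤s)))))
        ; (inj₂ h) → inj₁ (clique λ i≤s s<t t≤ → h (beyond i≤s (≤-trans (<⇒≤ s<t) t≤)) (beyond (≤-trans i≤s (<⇒≤ s<t)) t≤)
            (distinct s<t (≤-<-trans t≤ (<-≤-trans j< (+-monoʳ-≤ n i≤s))))) }
        where
        open Lap l
        b<a : b < a
        b<a = (lin (j< ⊕ ≤-reflexive split) 0 (id {A = ∀ Q a b i n → suc (b) + ((n + i) + (a + Q)) + 0 ≡ a + ((suc (b + (n + Q))) + i)} solve-∀ Q a b i n))
        b<n : b < n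
        b<n = <-trans b<a a<n
        between : ∀ {s} → b + (n + Q) ≤ s → s ≤ n + i → at b ≼ val s × val s ≼ at a
        between j≤s s≤ with FromLap.locate l (≤-trans (<⇒≤ i<j) j≤s)
        ... | inj₁ (c , refl , _ , c<n) = (linᶜ (j≤s ⊕ c<n) b (id {A = ∀ Q b c n → (b + (n + Q)) + (suc (c)) ≡ (c + Q) + n + suc b} solve-∀ Q b c n))
        ... | inj₂ (c , refl) = subst (at b ≼_) (sym (next c<n)) (at-≼ (+-cancelʳ-≤ (n + Q) b c j≤s) c<n) ,
                                subst (_≼ at a) (sym (next c<n)) (at-≼ c≤a a<n)
          where
          c≤a : c ≤ a
          c≤a = (lin (s≤ ⊕ ≤-reflexive split) 0 (id {A = ∀ Q a c i n → c + ((n + i) + (a + Q)) + 0 ≡ a + ((c + (n + Q)) + i)} solve-∀ Q a c i n))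
          c<n : c < n
          c<n = ≤-<-trans c≤a a<n
        beyond : ∀ {s} → i ≤ s → s ≤ b + (n + Q) → val s ≼ at b ⊎ at a ≼ val s
        beyond i≤s s≤ with FromLap.locate l i≤s
        ... | inj₁ (c , refl , a≤c , c<n) = inj₂ (subst (at a ≼_) (sym (this c<n)) (at-≼ a≤c c<n))
        ... | inj₂ (c , refl) = inj₁ (subst (_≼ at b) (sym (next (≤-<-trans c≤b b<n))) (at-≼ c≤b b<n))
          where
          c≤b : c ≤ b
          c≤b = +-cancelʳ-≤ (n + Q) c b s≤

    -- The induction runs over sorted lists because a sublist remains sorted, so that no angles have
    -- to be compared again. A vertex of degree less than `k` is coloured last, after the rest.
    sorted-colourable : ∀ h → k ≡ 8 + h → ∀ N vs → length vs ≤ N → Unique vs → AllPairs _≼_ vs → Colourable L vs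
    sorted-colourable h k≡ _ [] _ _ _ = (λ _ → 0) , (λ ()) , λ ()
    sorted-colourable h k≡ (suc N) vs@(v₀ ∷ vs₀) ≤N vs! sorted with any? (λ v → length (nbrs v vs) Data.Nat.<? k) vs
    ... | yes low = degenerate (find low)
      where
      degenerate : (∃ λ v → v ∈ vs × length (nbrs v vs) < k) → Colourable L vs
      degenerate (v , v∈ , few) =
        let us = vs ∖ (v ∷ [])
            us! = unique-∖ (v ∷ []) vs!
            v∉ = λ q → proj₂ (∈-∖⁻ vs (v ∷ []) q) (here refl)
            us⊆ = λ {x} (q : x ∈ us) → proj₁ (∈-∖⁻ vs (v ∷ []) q)
            φ , col = sorted-colourable h k≡ N us
              (s≤s⁻¹ (≤-trans (unique-⊆-length {xs = v ∷ us} (All.¬Any⇒All¬ _ v∉ ∷ us!) λ { (here refl) → v∈ ; (there q) → us⊆ q }) ≤N))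
              us! (AllPairs.filter⁺ (λ x → ¬? (x ∈? v ∷ [])) sorted)
            φ′ , col′ , _ = greedy col v∉ (L! v) (≤-trans (s≤s (unique-⊆-length (Unique.filter⁺ (adj? v) us!)
              λ q → let x∈ , a = ∈-nbrs⁻ us q in ∈-nbrs⁺ (us⊆ x∈) a)) (≤-trans few (≤-reflexive (sym (L≡ v)))))
        in φ′ , colours-⊆ {L = L} (λ {x} x∈ → case x ≟ v of λ { (yes refl) → here refl ; (no x≢v) → there (∈-∖⁺ {bad = v ∷ []} x∈ λ { (here e) → x≢v e }) }) col′
    ... | no none = by-size (<-cmp (length vs) (2 + k))
      where
      mindeg : ∀ {v} → v ∈ vs → k ≤ length (nbrs v vs)
      mindeg v∈ = ≮⇒≥ λ few → none (lose v∈ few)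
      large : 1 + k ≤ length vs
      large = ≤-trans (s≤s (mindeg (here refl))) (unique-⊆-length {xs = v₀ ∷ nbrs v₀ vs}
        (All.¬Any⇒All¬ _ (λ q → adj-irrefl (proj₂ (∈-nbrs⁻ vs q))) ∷ Unique.filter⁺ (adj? v₀) vs!)
        λ { (here refl) → here refl ; (there q) → proj₁ (∈-nbrs⁻ vs q) })
      outside : ∀ {H v} → v ∈ H → v ∈ vs → Colourable L (vs ∖ H)
      outside {H} {v} v∈H v∈ = sorted-colourable h k≡ N (vs ∖ H)
        (s≤s⁻¹ (≤-trans (unique-⊆-length {xs = v ∷ vs ∖ H} (All.¬Any⇒All¬ _ (λ q → proj₂ (∈-∖⁻ vs H q) v∈H) ∷ unique-∖ H vs!)
          λ { (here refl) → v∈ ; (there q) → proj₁ (∈-∖⁻ vs H q) }) ≤N))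
        (unique-∖ H vs!) (AllPairs.filter⁺ (λ x → ¬? (x ∈? H)) sorted)
      k≥ : ∀ c → c ≤ 8 → c ≤ k
      k≥ c c≤8 = ≤-trans c≤8 (≤-trans (m≤m+n 8 h) (≤-reflexive (sym k≡)))
      open Winding v₀ vs₀ vs! sorted using (val; val∈; periodic; distinct; cover; arc)
      by-size : Tri (length vs < 2 + k) (length vs ≡ 2 + k) (2 + k < length vs) → Colourable L vs
      by-size (tri< n< _ _)  = one-missing L! L≡ noclique (k≥ 3 (s≤s (s≤s (s≤s z≤n)))) vs! (≤-antisym (s≤s⁻¹ n<) large)
      by-size (tri≈ _ n≡ _)  = two-missing L! L≡ noclique (k≥ 4 (s≤s (s≤s (s≤s (s≤s z≤n))))) vs! n≡ mindeg
      by-size (tri> _ _ n>)  = Around.circle-colourable val vs! L! L≡ deg mindeg outside n> val∈ periodic distinct cover arc h k≡ noclique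

-- Decidability and the order of Dedekind cuts

dec-∃-list : ∀ {n} m {P : List (Fin n) → Set} → (∀ K → Dec (P K)) → Dec (∃ λ K → length K ≡ m × P K)
dec-∃-list zero P? with P? []
... | yes p = yes ([] , refl , p)
... | no ¬p = no λ { ([] , _ , p) → ¬p p }
dec-∃-list (suc m) P? with Fin.any? (λ x → dec-∃-list m (λ K → P? (x ∷ K)))
... | yes (x , K , e , p) = yes (x ∷ K , cong suc e , p)
... | no ¬p = no λ { (x ∷ K , e , p) → ¬p (x , K , suc-injective e , p) }

¬¬-∀-Fin : ∀ {n} {P : Fin n → Set} → (∀ i → ¬ ¬ P i) → ¬ ¬ (∀ i → P i)
¬¬-∀-Fin {zero}  _ k = k λ ()
¬¬-∀-Fin {suc n} h k = h Fin.zero λ p → ¬¬-∀-Fin (h ∘ Fin.suc) λ q → k λ { Fin.zero → p ; (Fin.suc i) → q i }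

-- A rational `q` below `y` has a larger `r` still below `y`. By locatedness `q` is below `x`, as
-- wanted, or `r` is above `x`; the latter separates `x` from `y` and gives the excluded `x ≤ y`.
≰⇒≥ᴿ : ∀ x y → ¬ (x ≤ᴿ y) → y ≤ᴿ x
≰⇒≥ᴿ x y ¬x≤y q q∈y with Equivalence.to (ℝ.L-rounded y q) q∈y
... | r , q<r , r∈y with ℝ.located x q r q<r
... | inj₁ q∈x = q∈x
... | inj₂ r∈x = contradiction x≤y ¬x≤y
  where
  x≤y : x ≤ᴿ y
  x≤y p p∈x = Equivalence.from (ℝ.L-rounded y p) (r , p<r , r∈y)
    where
    p<r : p ℚ.< r
    p<r with ℚ.<-cmp p r
    ... | tri< p<r _ _  = p<r
    ... | tri≈ _ refl _ = contradiction (p∈x , r∈x) (ℝ.disjoint x p)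
    ... | tri> _ _ r<p  = contradiction (p∈x , Equivalence.from (ℝ.U-rounded x p) (r , r<p , r∈x)) (ℝ.disjoint x p)

<⇒≱ᴿ : ∀ {x y} → x <ᴿ y → ¬ (y ≤ᴿ x)
<⇒≱ᴿ {x} (q , q∈U , q∈L) y≤x = ℝ.disjoint x q (y≤x q q∈L , q∈U)

-- Circular interval graphs

module _ {n : ℕ} (G : Graph n) where

  open Graph G using (Adj; adj?) renaming (sym to adj-sym)

  adj-irrefl : ∀ {v} → ¬ Adj v v
  adj-irrefl = Graph.irrefl G refl

  open Colouring Fin._≟_ Adj adj? adj-sym adj-irrefl

  lookup-adj : ∀ {K} → AllPairs Adj K → ∀ i j → i ≢ j → Adj (lookup K i) (lookup K j)
  lookup-adj (_ ∷ _)  Fin.zero    Fin.zero    i≢j = contradiction refl i≢j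
  lookup-adj {_ ∷ K} (a ∷ _) Fin.zero (Fin.suc j) _ = All.lookup a (∈-lookup {xs = K} j)
  lookup-adj {_ ∷ K} (a ∷ _) (Fin.suc i) Fin.zero _ = adj-sym (All.lookup a (∈-lookup {xs = K} i))
  lookup-adj (_ ∷ as) (Fin.suc i) (Fin.suc j) i≢j = lookup-adj as i j (i≢j ∘ cong Fin.suc)

  clique⇒complete : ∀ {K} → AllPairs Adj K → ContainsComplete G (length K)
  clique⇒complete {K} as = mk↣ injective , lookup-adj as
    where
    injective : ∀ {i j} → lookup K i ≡ lookup K j → i ≡ j
    injective {i} {j} e with i Fin.≟ j
    ... | yes i≡j = i≡j
    ... | no i≢j  = contradiction (subst (Adj _) (sym e) (lookup-adj as i j i≢j)) adj-irrefl

  degree≤Δ : ∀ {v ns} → Unique ns → (∀ {u} → u ∈ ns → Adj v u) → length ns ≤ Δ G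
  degree≤Δ {v} ns! adj = ≤-trans
    (unique-⊆-length ns! λ {u} u∈ → ∈-filter⁺ (adj? v) (∈-allFin u) (adj u∈))
    (All.lookup (xs≤max 0 _) (∈-map⁺ (Graph.degree G) (∈-allFin v)))

  module _ (ci : CircularInterval G) where

    open CircularInterval ci

    θ : Fin n → ℝ
    θ v = angle (point v)

    _≼_ : Fin n → Fin n → Set
    u ≼ v = θ u ≤ᴿ θ v

    ≼-trans : ∀ {u v w} → u ≼ v → v ≼ w → u ≼ w
    ≼-trans u≼v v≼w q = v≼w q ∘ u≼v q

    arcProperty : ArcProperty _≼_
    arcProperty = record { ≼-refl = λ _ → id ; arcs = arcs }
      where
      Inside Outside : Fin n → Fin n → Set
      Inside u v  = ∀ {w x} → u ≼ w → w ≼ v → u ≼ x → x ≼ v → w ≢ x → Adj w x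
      Outside u v = ∀ {w x} → w ≼ u ⊎ v ≼ w → x ≼ u ⊎ v ≼ x → w ≢ x → Adj w x
      arcs : ∀ {u v} → Adj u v → u ≼ v → Inside u v ⊎ Outside u v
      arcs {u} {v} a u≼v with Equivalence.to (adjacency u v) a
      ... | _ , J , J∈C , u∈J , v∈J = go u∈J v∈J
        where
        s = angle (Arc.start J)
        e = angle (Arc.end J)
        join : ∀ {w x} → point w ∈ᴬ J → point x ∈ᴬ J → w ≢ x → Adj w x
        join {w} {x} w∈ x∈ w≢x = Equivalence.from (adjacency w x) (w≢x , J , J∈C , w∈ , x∈)
        not-both : ∀ {A : Set} {w} → s ≤ᴿ θ w → θ w ≤ᴿ e → e <ᴿ s → A
        not-both s≤ ≤e e<s = contradiction (λ q → ≤e q ∘ s≤ q) (<⇒≱ᴿ {e} {s} e<s)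
        go : point u ∈ᴬ J → point v ∈ᴬ J → Inside u v ⊎ Outside u v
        go (plain s≤u u≤e) (plain s≤v v≤e) = inj₁ λ u≼w w≼v u≼x x≼v →
          join (plain (λ q → u≼w q ∘ s≤u q) (λ q → v≤e q ∘ w≼v q)) (plain (λ q → u≼x q ∘ s≤u q) (λ q → v≤e q ∘ x≼v q))
        go (plain s≤u u≤e) (wrap e<s _)    = not-both {w = u} s≤u u≤e e<s
        go (wrap e<s _)    (plain s≤v v≤e) = not-both {w = v} s≤v v≤e e<s
        -- The interval contains every angle from that of `u` upwards.
        go (wrap e<s (inj₁ s≤u)) (wrap _ _) = inj₁ λ u≼w _ u≼x _ →
          join (wrap e<s (inj₁ λ q → u≼w q ∘ s≤u q)) (wrap e<s (inj₁ λ q → u≼x q ∘ s≤u q))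
        go (wrap e<s (inj₂ u≤e)) (wrap _ (inj₂ v≤e)) = inj₁ λ _ w≼v _ x≼v →
          join (wrap e<s (inj₂ λ q → v≤e q ∘ w≼v q)) (wrap e<s (inj₂ λ q → v≤e q ∘ x≼v q))
        -- The interval runs from before `v` through the angle 0 to beyond `u`, so it covers the
        -- complement of the stretch between them.
        go (wrap e<s (inj₂ u≤e)) (wrap _ (inj₁ s≤v)) = inj₂ λ hw hx → join (inside hw) (inside hx)
          where
          inside : ∀ {w} → w ≼ u ⊎ v ≼ w → point w ∈ᴬ J
          inside (inj₁ w≼u) = wrap e<s (inj₂ λ q → u≤e q ∘ w≼u q)
          inside (inj₂ v≼w) = wrap e<s (inj₁ λ q → v≼w q ∘ s≤v q)

    choosable : (∀ u v → Dec (u ≼ v)) → ∀ h → Δ G ≡ 9 + h →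
                ¬ (∃ λ K → length K ≡ Δ G × AllPairs Adj K) → Choosable G (8 + h)
    choosable ≼? h Δ≡ noclique L L! L≥ =
      φ , (λ v → All.lookup (All.take⁺ (8 + h) (All.tabulate id)) (proj₁ col (all∈ v))) , λ u v → proj₂ col (all∈ u) (all∈ v)
      where
      total : ∀ u v → u ≼ v ⊎ v ≼ u
      total u v with ≼? u v
      ... | yes u≼v = inj₁ u≼v
      ... | no ¬u≼v = inj₂ (≰⇒≥ᴿ (θ u) (θ v) ¬u≼v)
      order : DecTotalOrder _ _ _
      order = record { isDecTotalOrder = record
        { isTotalOrder = record
          { isPartialOrder = record
            { isPreorder = record
              { isEquivalence = isEquivalence ; reflexive = λ { refl _ → id }
              ; trans = λ {u} {v} {w} → ≼-trans {u} {v} {w} }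
            ; antisym = λ {u} {v} u≼v v≼u → injective u v (u≼v , v≼u) }
          ; total = total }
        ; _≟_ = Fin._≟_ ; _≤?_ = ≼? } }
      open Data.List.Sort order using (sort; sort-↭; sort-↗)
      vs : List (Fin n)
      vs = sort (allFin n)
      all∈ : ∀ v → v ∈ vs
      all∈ v = Perm.∈-resp-↭ (↭-sym (sort-↭ (allFin n))) (∈-allFin v)
      -- Lists are cut to exactly `k` colours, since saving a colour at two vertices at once
      -- compares lists of equal length.
      solution : Colourable (λ v → take (8 + h) (L v)) vs
      solution = sorted-colourable arcProperty (λ v → Unique.take⁺ (8 + h) (L! v))
        (λ v → trans (length-take (8 + h) (L v)) (m≤n⇒m⊓n≡m (L≥ v)))
        (λ ns! adj → ≤-trans (degree≤Δ ns! adj) (≤-reflexive Δ≡))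
        (λ {K} as e → noclique (K , trans e (sym Δ≡) , as))
        h refl (length vs) vs ≤-refl (unique-resp-↭ (↭-sym (sort-↭ (allFin n))) (Unique.allFin⁺ n))
        (Sorted⇒AllPairs (DecTotalOrder.totalOrder order) (sort-↗ (allFin n)))
      φ = proj₁ solution
      col = proj₂ solution

lemma3p1 : ∀ (n : ℕ) (G : Graph n) → CircularInterval G →
    ∀ (χₗ : ℕ) → IsListChromaticNumber G χₗ →
    χₗ ≥ Δ G → Δ G ≥ 9 →
    ContainsComplete G (Δ G)
lemma3p1 n G ci χₗ (_ , minimal) χₗ≥Δ Δ≥9 with dec-∃-list (Δ G) (allPairs? (Graph.adj? G))
... | yes (K , e , as) = subst (ContainsComplete G) e (clique⇒complete G as)
... | no noclique = ⊥-elim (¬¬-∀-Fin (λ u → ¬¬-∀-Fin (λ v → ¬¬-excluded-middle)) λ ≼? →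
  let h , 9+h≡Δ = m≤n⇒∃[o]m+o≡n Δ≥9
      χₗ≤8+h = minimal (8 + h) (choosable G ci ≼? h (sym 9+h≡Δ) noclique)
  in n≮n _ (≤-trans (≤-reflexive 9+h≡Δ) (≤-trans χₗ≥Δ χₗ≤8+h)))
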